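{- Let $G$ be a connected simple graph on $[N]$ with an edge $e=uv$ such that $\deg_G(u)=2$. Let $G\triangle e$ be the graph on $[N+1]$ with edge set $E(G)\cup\{u(N+1),v(N+1)\}$. Then \[ \mathrm{NVol}(\nabla^{\mathrm{PQ}}_{G\triangle e}) = 3\,\mathrm{NVol}(\nabla^{\mathrm{PQ}}_G). \]
   Context: For a simple graph $G$ on vertex set $[N]=\{1,\dots,N\}$, the PQ-type adjacency polytope is $\nabla^{\mathrm{PQ}}_G=\mathrm{conv}\{(e_i,e_j)\in\mathbb{R}^{2N} : ij\in E(G)\text{ or } i=j\}$, where $e_1,\dots,e_N$ are the standard basis vectors of $\mathbb{R}^N$. For a lattice polytope $P$, $\mathrm{NVol}(P)=(\dim P)!\,\mathrm{vol}(P)$, where $\mathrm{vol}(P)$ is the relative volume of $P$ (normalized with respect to the lattice in its affine span). -}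

module Defs where

open import Data.Bool using (Bool; true; false; _∨_; if_then_else_)
open import Data.Nat as ℕ using (ℕ; zero; suc)
open import Data.Nat.Base using (_!)
open import Data.Fin using (Fin; zero; suc; _≟_)
open import Data.Vec using (Vec; lookup)
open import Data.List using (List; length; filterᵇ; allFin)
open import Data.List.Relation.Unary.Unique.Propositional using (Unique)
open import Data.List.Membership.Propositional using (_∈_)
open import Data.Maybe using (Maybe; just; nothing)
import Data.Maybe as Maybe
open import Data.Integer using (ℤ; +_)
open import Data.Rational using (ℚ; _/_; 0ℚ; _+_; _*_; _-_; _≤_; _<_; ∣_∣)
open import Data.Product using (Σ; ∃; _×_; _,_; proj₁; proj₂)
open import Data.Sum using (_⊎_)
open import Relation.Binary.PropositionalEquality using (_≡_; refl)
open import Relation.Nullary using (¬_)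
open import Relation.Nullary.Decidable using (⌊_⌋)
open import Function.Bundles using (_⇔_)

-- A finite simple graph on the vertex set Fin N (vertex i ↔ element i+1 of [N]),
-- given by a symmetric, irreflexive, Boolean adjacency relation.
record SimpleGraph (N : ℕ) : Set where
  field
    adj     : Fin N → Fin N → Bool
    sym     : ∀ i j → adj i j ≡ adj j i
    irrefl  : ∀ i → adj i i ≡ false
open SimpleGraph public

data Reach {N : ℕ} (G : SimpleGraph N) : Fin N → Fin N → Set where
  here : ∀ {i} → Reach G i i
  step : ∀ {i k j} → adj G i k ≡ true → Reach G k j → Reach G i j

Connected : ∀ {N} → SimpleGraph N → Set
Connected G = ∀ i j → Reach G i j

degree : ∀ {N} → SimpleGraph N → Fin N → ℕ
degree {N} G u = length (filterᵇ (adj G u) (allFin N))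

-- classify i = nothing iff i is the last element (the new vertex N+1),
-- otherwise classify (inject₁ j) = just j.
classify : ∀ {N} → Fin (suc N) → Maybe (Fin N)
classify {zero}  zero    = nothing
classify {suc N} zero    = just zero
classify {suc N} (suc i) = Maybe.map suc (classify i)

eqᵇ : ∀ {N} → Fin N → Fin N → Bool
eqᵇ i j = ⌊ i ≟ j ⌋

triAdjM : ∀ {N} → SimpleGraph N → Fin N → Fin N → Maybe (Fin N) → Maybe (Fin N) → Bool
triAdjM G u v (just a) (just b) = adj G a b
triAdjM G u v (just a) nothing  = eqᵇ a u ∨ eqᵇ a v
triAdjM G u v nothing  (just b) = eqᵇ b u ∨ eqᵇ b v
triAdjM G u v nothing  nothing  = false

triAdjM-sym : ∀ {N} (G : SimpleGraph N) u v m n → triAdjM G u v m n ≡ triAdjM G u v n m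
triAdjM-sym G u v (just a) (just b) = sym G a b
triAdjM-sym G u v (just a) nothing  = refl
triAdjM-sym G u v nothing  (just b) = refl
triAdjM-sym G u v nothing  nothing  = refl

triAdjM-irrefl : ∀ {N} (G : SimpleGraph N) u v m → triAdjM G u v m m ≡ false
triAdjM-irrefl G u v (just a) = irrefl G a
triAdjM-irrefl G u v nothing  = refl

_△_ : ∀ {N} → SimpleGraph N → Fin N × Fin N → SimpleGraph (suc N)
_△_ G (u , v) = record
  { adj    = λ i j → triAdjM G u v (classify i) (classify j)
  ; sym    = λ i j → triAdjM-sym G u v (classify i) (classify j)
  ; irrefl = λ i → triAdjM-irrefl G u v (classify i)
  }

-- The PQ-type adjacency polytope ∇^PQ_G ⊂ ℝ^{2N} = ℝ^N × ℝ^N,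
-- conv { (e_i , e_j) : ij ∈ E(G) or i = j }.

-- (i , j) indexes a vertex (e_i , e_j) of the generating set
Allowed : ∀ {N} → SimpleGraph N → Fin N → Fin N → Set
Allowed G i j = i ≡ j ⊎ adj G i j ≡ true

∑ : ∀ {n} → (Fin n → ℚ) → ℚ
∑ {zero}  f = 0ℚ
∑ {suc n} f = f zero + ∑ (λ i → f (suc i))

ℤ→ℚ : ℤ → ℚ
ℤ→ℚ z = z / 1

ℕ→ℚ : ℕ → ℚ
ℕ→ℚ n = + n / 1

-- (x , y) ∈ ℤ^N × ℤ^N lies in the dilate t·∇^PQ_G : it is a convex-conic
-- combination Σ λ_ij (e_i , e_j) of the generators with total weight t.
-- The P-coordinate a of Σ λ_ij (e_i,e_j) is Σ_j λ_aj, the Q-coordinate b is Σ_i λ_ib.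
InDilate : ∀ {N} → SimpleGraph N → ℕ → Vec ℤ N × Vec ℤ N → Set
InDilate {N} G t (x , y) =
  Σ (Fin N → Fin N → ℚ) λ λ′ →
    (∀ i j → 0ℚ ≤ λ′ i j) ×
    (∀ i j → ¬ Allowed G i j → λ′ i j ≡ 0ℚ) ×
    (∑ (λ i → ∑ (λ j → λ′ i j)) ≡ ℕ→ℚ t) ×
    (∀ a → ∑ (λ j → λ′ a j) ≡ ℤ→ℚ (lookup x a)) ×
    (∀ b → ∑ (λ i → λ′ i b) ≡ ℤ→ℚ (lookup y b))

LatticeCount : ∀ {N} → SimpleGraph N → ℕ → ℕ → Set
LatticeCount {N} G t c =
  Σ (List (Vec ℤ N × Vec ℤ N)) λ L →
    Unique L × (∀ p → p ∈ L ⇔ InDilate G t p) × length L ≡ c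

AffIndep : ∀ {N k} → SimpleGraph N → (Fin k → Fin N × Fin N) → Set
AffIndep {N} {k} G f =
  (μ : Fin k → ℚ) →
  ∑ μ ≡ 0ℚ →
  (∀ a → ∑ (λ s → if eqᵇ (proj₁ (f s)) a then μ s else 0ℚ) ≡ 0ℚ) →
  (∀ b → ∑ (λ s → if eqᵇ (proj₂ (f s)) b then μ s else 0ℚ) ≡ 0ℚ) →
  ∀ s → μ s ≡ 0ℚ

AllowedFamily : ∀ {N k} → SimpleGraph N → (Fin k → Fin N × Fin N) → Set
AllowedFamily G f = ∀ s → Allowed G (proj₁ (f s)) (proj₂ (f s))

Dim : ∀ {N} → SimpleGraph N → ℕ → Set
Dim {N} G d =
  (Σ (Fin (suc d) → Fin N × Fin N) λ f → AllowedFamily G f × AffIndep G f) ×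
  (∀ (f : Fin (suc (suc d)) → Fin N × Fin N) → AllowedFamily G f → ¬ AffIndep G f)

-- NVol(∇^PQ_G) = k, where NVol = (dim)! · (relative volume) and the relative
-- volume w.r.t. the lattice aff(∇) ∩ ℤ^{2N} is the (Jordan/Riemann) limit
--   vol = lim_{t→∞} #(t∇ ∩ ℤ^{2N}) / t^d.
-- Written without division: | d!·c_t − k·t^d | < ε·t^d for all large t.
NVolIs : ∀ {N} → SimpleGraph N → ℚ → Set
NVolIs G k =
  Σ ℕ λ d → Dim G d ×
    (∀ (ε : ℚ) → 0ℚ < ε →
      Σ ℕ λ T → ∀ t → T ℕ.≤ t →
        Σ ℕ λ c → LatticeCount G t c ×
          (∣ ℕ→ℚ ((d !) ℕ.* c) - k * ℕ→ℚ (t ℕ.^ d) ∣ < ε * ℕ→ℚ (t ℕ.^ d)))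

-- A lattice point of t∇ is a sum of t generators (e_i , e_j): integrality of bipartite flows. Let c(t) be the
-- number of such points. Let a vertex n be joined to p and q. In a sum with x_n ≥ y_n one may assume that the
-- right vertex n is fed by the loop nn only, provided that virtual edges pq and qp are admitted, each paid for by
-- one nn. This reduces the count to fans, where just the left vertex n is attached to p and q; the points of a fan
-- are counted by c and by the number m of points left after the right vertices p and q are identified.
-- G is such an extension of G - u, and G △ e is one of G at u and v. The same m occurs in both cases, because
-- identifying the right vertices u and v of G yields a fan over G - u. The outcome is, with C = ∑∑ c_G,
--   c_{G△e}(t) ≤ 3 C(t) ≤ c_{G△e}(t + 2).
-- Summation carries the asymptotics from c_G to C, and a Tauberian argument for monotone sequences carries it back.
module Submission where

-- The factor 3 is 2 · (1 + 1/2). With b(t) the sum of m(s) over s < t, the two halves of G yield 2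
-- b(t) ≤ c(t) ≤ 2 b(t + 1); the fan in G △ e then counts ∑ c + ∑ b, about 3/2 of ∑ c, and the count
-- of G △ e is nearly twice the sum of these fan counts. The two summations match the rise of the
-- dimension from 2N - 2 to 2N. Every exact count rests on one fact: the semigroup of the generators
-- is normal, so a line in any direction meets it in a run of consecutive points. Points gained by
-- an edge can therefore be counted by the last old point below them, and the last points in a
-- direction that moves weight between two right vertices correspond to the points of the graph in
-- which these vertices are identified. The equivalence has to hold for every k, also from G △ e
-- back to G, where the existence of the volume of G may not be presumed. Hence the counts are
-- compared as plain sequences, and monotonicity of c replaces any knowledge of polynomial growth.
-- The shift t + 2 is harmless because C(t + 1 + d, d) / C(t + d, d) tends to 1.

module Flows where

  open import Data.Nat hiding (_≟_)
  open import Data.Nat.Properties hiding (_≟_)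
  open import Data.Nat.Tactic.RingSolver using (solve-∀)
  open import Data.Fin.Base using (Fin; zero; suc)
  open import Data.Fin.Properties using (_≟_; any?)
  open import Data.List.Base using (List; []; _∷_; _++_; length; allFin)
  open import Data.List.Properties using (length-++)
  open import Data.List.Membership.Propositional using (_∈_; _∉_)
  open import Data.List.Membership.Propositional.Properties using (∈-∃++; ∈-++⁺ˡ; ∈-++⁺ʳ; ∈-++⁻; ∈-allFin)
  open import Data.List.Relation.Unary.Any using (here; there)
  open import Data.Product.Base using (Σ; ∃; _×_; _,_)
  open import Data.Sum.Base using (_⊎_; inj₁; inj₂)
  open import Data.Bool.Base using (if_then_else_)
  open import Function.Base using (_∘_)
  open import Relation.Binary.PropositionalEquality
  open import Relation.Binary.Definitions using (Decidable)
  open import Relation.Nullary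
  open import Algebra.Properties.Semiring.Sum +-*-semiring public
    using (sum; sum-cong-≗; ∑-distrib-+; ∑-comm; *-distribˡ-sum; *-distribʳ-sum; sum-replicate-zero)

  -- Integral bipartite flows with prescribed marginals

  Matrix : ℕ → Set
  Matrix M = Fin M → Fin M → ℕ

  ind : ∀ {P : Set} → Dec P → ℕ
  ind P? = if does P? then 1 else 0

  ind-yes : ∀ {P : Set} (P? : Dec P) → P → ind P? ≡ 1
  ind-yes (yes _) _ = refl
  ind-yes (no ¬p) p = contradiction p ¬p

  ind-no : ∀ {P : Set} (P? : Dec P) → ¬ P → ind P? ≡ 0
  ind-no (yes p) ¬p = contradiction p ¬p
  ind-no (no _) _ = refl

  δ : ∀ {M} → Fin M → Fin M → ℕ
  δ i a = ind (i ≟ a)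

  δ-refl : ∀ {M} (i : Fin M) → δ i i ≡ 1
  δ-refl i = ind-yes (i ≟ i) refl

  δ-suc : ∀ {M} (i a : Fin M) → δ (suc i) (suc a) ≡ δ i a
  δ-suc i a with i ≟ a
  ... | yes _ = refl
  ... | no _ = refl

  sum-δ* : ∀ {M} (i : Fin M) (f : Fin M → ℕ) → sum (λ a → δ i a * f a) ≡ f i
  sum-δ* {suc M} zero f = begin
    1 * f zero + sum (λ (a : Fin M) → 0) ≡⟨ cong₂ _+_ (*-identityˡ (f zero)) (sum-replicate-zero M) ⟩
    f zero + 0                           ≡⟨ +-identityʳ _ ⟩
    f zero ∎
    where open ≡-Reasoning
  sum-δ* {suc M} (suc i) f =
    trans (sum-cong-≗ (λ a → cong (_* f (suc a)) (δ-suc i a))) (sum-δ* i (f ∘ suc))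

  sum-δ : ∀ {M} (i : Fin M) → sum (δ i) ≡ 1
  sum-δ i = trans (sum-cong-≗ (λ a → sym (*-identityʳ (δ i a)))) (sum-δ* i (λ _ → 1))

  sum-mono : ∀ {M} {f g : Fin M → ℕ} → (∀ i → f i ≤ g i) → sum f ≤ sum g
  sum-mono {zero} f≤g = z≤n
  sum-mono {suc M} f≤g = +-mono-≤ (f≤g zero) (sum-mono (f≤g ∘ suc))

  term≤sum : ∀ {M} (f : Fin M → ℕ) i → f i ≤ sum f
  term≤sum f zero = m≤m+n _ _
  term≤sum f (suc i) = ≤-trans (term≤sum (f ∘ suc) i) (m≤n+m _ _)

  sum≡0⇒ : ∀ {M} (f : Fin M → ℕ) → sum f ≡ 0 → ∀ i → f i ≡ 0
  sum≡0⇒ f eq i = n≤0⇒n≡0 (subst (f i ≤_) eq (term≤sum f i))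

  sum>0⇒ : ∀ {M} (f : Fin M → ℕ) {k} → sum f ≡ suc k → ∃ λ i → 0 < f i
  sum>0⇒ {suc M} f eq with f zero in eq₀
  ... | suc _ = zero , subst (0 <_) (sym eq₀) z<s
  ... | zero with sum>0⇒ (f ∘ suc) eq
  ...   | i , h = suc i , h

  row col : ∀ {M} → Matrix M → Fin M → ℕ
  row μ i = sum (μ i)
  col μ j = sum (λ i → μ i j)

  sum-row≡sum-col : ∀ {M} (μ : Matrix M) → sum (row μ) ≡ sum (col μ)
  sum-row≡sum-col μ = ∑-comm μ

  unit : ∀ {M} → Fin M → Fin M → Matrix M
  unit i j a b = δ i a * δ j b

  bump drop : ∀ {M} → Matrix M → Fin M → Fin M → Matrix M
  bump μ i j a b = μ a b + unit i j a b
  drop μ i j a b = μ a b ∸ unit i j a b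

  row-bump : ∀ {M} (μ : Matrix M) i j a → row (bump μ i j) a ≡ row μ a + δ i a
  row-bump μ i j a = begin
    row (bump μ i j) a                   ≡⟨ ∑-distrib-+ (μ a) (unit i j a) ⟩
    row μ a + sum (λ b → δ i a * δ j b)  ≡⟨ cong (row μ a +_) (*-distribˡ-sum (δ i a) (δ j)) ⟨
    row μ a + δ i a * sum (δ j)          ≡⟨ cong (λ s → row μ a + δ i a * s) (sum-δ j) ⟩
    row μ a + δ i a * 1                  ≡⟨ cong (row μ a +_) (*-identityʳ _) ⟩
    row μ a + δ i a                      ∎
    where open ≡-Reasoning

  col-bump : ∀ {M} (μ : Matrix M) i j b → col (bump μ i j) b ≡ col μ b + δ j b
  col-bump μ i j b = begin
    col (bump μ i j) b                   ≡⟨ ∑-distrib-+ (λ a → μ a b) (λ a → unit i j a b) ⟩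
    col μ b + sum (λ a → δ i a * δ j b)  ≡⟨ cong (col μ b +_) (sum-δ* i (λ _ → δ j b)) ⟩
    col μ b + δ j b                      ∎
    where open ≡-Reasoning

  unit≤ : ∀ {M} (μ : Matrix M) i j → 0 < μ i j → ∀ a b → unit i j a b ≤ μ a b
  unit≤ μ i j h a b with i ≟ a | j ≟ b
  ... | yes refl | yes refl = h
  ... | yes _ | no _ = z≤n
  ... | no _ | yes _ = z≤n
  ... | no _ | no _ = z≤n

  bump-drop : ∀ {M} (μ : Matrix M) i j → 0 < μ i j → ∀ a b → bump (drop μ i j) i j a b ≡ μ a b
  bump-drop μ i j h a b = m∸n+n≡m (unit≤ μ i j h a b)

  unit≡0 : ∀ {M} {i a : Fin M} → i ≢ a → ∀ j b → unit i j a b ≡ 0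
  unit≡0 {i = i} {a} i≢a j b = cong (_* δ j b) (ind-no (i ≟ a) i≢a)

  Supported : ∀ {M} → (Fin M → Fin M → Set) → Matrix M → Set
  Supported W μ = ∀ i j → 0 < μ i j → W i j

  bump-supported : ∀ {M} {W : Fin M → Fin M → Set} {μ : Matrix M} {i j} →
                   W i j → Supported W μ → Supported W (bump μ i j)
  bump-supported {W = W} {μ} {i} {j} w supp a b h with i ≟ a | j ≟ b
  ... | yes refl | yes refl = w
  ... | yes _ | no _ = supp a b (subst (0 <_) (+-identityʳ _) h)
  ... | no _ | yes _ = supp a b (subst (0 <_) (+-identityʳ _) h)
  ... | no _ | no _ = supp a b (subst (0 <_) (+-identityʳ _) h)

  drop-supported : ∀ {M} {W : Fin M → Fin M → Set} {μ : Matrix M} {i j} →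
                   Supported W μ → Supported W (drop μ i j)
  drop-supported {μ = μ} {i} {j} supp a b h = supp a b (<-≤-trans h (m∸n≤m (μ a b) (unit i j a b)))

  module _ {M : ℕ} {W : Fin M → Fin M → Set} (W? : Decidable W) where

    open import Data.List.Membership.DecPropositional (_≟_ {M}) using (_∈?_)

    -- The list holds the rows reached so far by alternating paths from l₀, newest first.
    data Reached (μ : Matrix M) (l₀ : Fin M) : List (Fin M) → Set where
      root : Reached μ l₀ (l₀ ∷ [])
      grow : ∀ {S i i′ j} → i ∉ S → i′ ∈ S → W i′ j → 0 < μ i j → Reached μ l₀ S → Reached μ l₀ (i ∷ S)

    -- Rerouting changes each row of the path only once, so it suffices that the current flow ν
    -- still agrees with μ on the rows that may be visited later.
    augment : ∀ {μ l₀ S} → Reached μ l₀ S → ∀ {i j} → i ∈ S → W i j →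
              (ν : Matrix M) → Supported W ν → (∀ a → a ∈ S → ∀ b → ν a b ≡ μ a b) →
              Σ (Matrix M) λ ν′ → Supported W ν′ ×
                (∀ a → row ν′ a ≡ row ν a + δ l₀ a) × (∀ b → col ν′ b ≡ col ν b + δ j b)
    augment root {i} {j} (here refl) w ν supp agree =
      bump ν i j , bump-supported w supp , row-bump ν i j , col-bump ν i j
    augment {μ} {l₀} (grow {S} {i} {i′} {j′} i∉S i′∈S w′ μ>0 tree) {j = j} (here refl) w ν supp agree
      with augment tree i′∈S w′ ν₁ (bump-supported w (drop-supported {i = i} {j′} supp)) agree₁
      where
      ν₁ = bump (drop ν i j′) i j
      agree₁ : ∀ a → a ∈ S → ∀ b → ν₁ a b ≡ μ a b
      agree₁ a a∈S b = begin
        ν a b ∸ unit i j′ a b + unit i j a b  ≡⟨ cong₂ (λ x y → ν a b ∸ x + y) (unit≡0 i≢a j′ b) (unit≡0 i≢a j b) ⟩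
        ν a b + 0                             ≡⟨ +-identityʳ _ ⟩
        ν a b                                 ≡⟨ agree a (there a∈S) b ⟩
        μ a b ∎
        where
        open ≡-Reasoning
        i≢a : i ≢ a
        i≢a refl = i∉S a∈S
    ... | ν′ , supp′ , rows , cols = ν′ , supp′ , rows′ , cols′
      where
      ν₀ = drop ν i j′
      ν>0 : 0 < ν i j′
      ν>0 = subst (0 <_) (sym (agree i (here refl) j′)) μ>0
      rows′ : ∀ a → row ν′ a ≡ row ν a + δ l₀ a
      rows′ a = trans (rows a) (cong (_+ δ l₀ a) (begin
        row (bump ν₀ i j) a   ≡⟨ row-bump ν₀ i j a ⟩
        row ν₀ a + δ i a      ≡⟨ row-bump ν₀ i j′ a ⟨
        row (bump ν₀ i j′) a  ≡⟨ sum-cong-≗ (bump-drop ν i j′ ν>0 a) ⟩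
        row ν a ∎))
        where open ≡-Reasoning
      cols′ : ∀ b → col ν′ b ≡ col ν b + δ j b
      cols′ b = begin
        col ν′ b                         ≡⟨ cols b ⟩
        col (bump ν₀ i j) b + δ j′ b     ≡⟨ cong (_+ δ j′ b) (col-bump ν₀ i j b) ⟩
        col ν₀ b + δ j b + δ j′ b        ≡⟨ +-assoc (col ν₀ b) _ _ ⟩
        col ν₀ b + (δ j b + δ j′ b)      ≡⟨ cong (col ν₀ b +_) (+-comm (δ j b) _) ⟩
        col ν₀ b + (δ j′ b + δ j b)      ≡⟨ +-assoc (col ν₀ b) _ _ ⟨
        col ν₀ b + δ j′ b + δ j b        ≡⟨ cong (_+ δ j b) (col-bump ν₀ i j′ b) ⟨
        col (bump ν₀ i j′) b + δ j b     ≡⟨ cong (_+ δ j b) (sum-cong-≗ (λ a → bump-drop ν i j′ ν>0 a b)) ⟩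
        col ν b + δ j b ∎
        where open ≡-Reasoning
    augment (grow i∉S i′∈S w′ μ>0 tree) (there i∈S) w ν supp agree =
      augment tree i∈S w ν supp (λ a a∈S → agree a (there a∈S))

    Closed : Matrix M → List (Fin M) → Set
    Closed μ S = ∀ i i′ j → i′ ∈ S → W i′ j → 0 < μ i j → i ∈ S

    -- Each `grow` moves a row from `rest` into `S`, so the length of `rest` bounds the number of
    -- steps; `fuel` makes this decrease structural.
    reached-closure : ∀ {μ l₀} fuel rest → length rest ≤ fuel → ∀ {S} → (∀ a → a ∈ S ⊎ a ∈ rest) → l₀ ∈ S →
                      Reached μ l₀ S → Σ (List (Fin M)) λ S′ → l₀ ∈ S′ × Reached μ l₀ S′ × Closed μ S′
    reached-closure {μ} fuel rest len {S} cover l₀∈S tree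
      with any? (λ i → ¬? (i ∈? S) ×-dec any? (λ i′ → (i′ ∈? S) ×-dec any? (λ j → W? i′ j ×-dec (0 <? μ i j))))
    ... | no none = S , l₀∈S , tree , closed
      where
      closed : Closed μ S
      closed i i′ j i′∈S w h with i ∈? S
      ... | yes i∈S = i∈S
      ... | no i∉S = contradiction (i , i∉S , i′ , i′∈S , j , w , h) none
    ... | yes (i , i∉S , i′ , i′∈S , j , w , h) with cover i
    ...   | inj₁ i∈S = contradiction i∈S i∉S
    ...   | inj₂ i∈rest with ∈-∃++ i∈rest
    reached-closure zero _ () _ _ _ | yes _ | inj₂ _ | [] , ys , refl
    reached-closure zero _ () _ _ _ | yes _ | inj₂ _ | _ ∷ _ , ys , refl
    reached-closure (suc fuel) _ len {S} cover l₀∈S tree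
      | yes (i , i∉S , i′ , i′∈S , j , w , h) | inj₂ i∈rest | xs , ys , refl =
        reached-closure fuel (xs ++ ys) len′ cover′ (there l₀∈S) (grow i∉S i′∈S w h tree)
      where
      len′ : length (xs ++ ys) ≤ fuel
      len′ = s≤s⁻¹ (subst (_≤ suc fuel) (trans (length-++ xs)
               (trans (+-suc (length xs) (length ys)) (cong suc (sym (length-++ xs))))) len)
      cover′ : ∀ a → a ∈ (i ∷ S) ⊎ a ∈ (xs ++ ys)
      cover′ a with cover a
      ... | inj₁ a∈S = inj₁ (there a∈S)
      ... | inj₂ a∈ with ∈-++⁻ xs a∈
      ...   | inj₁ a∈xs = inj₂ (∈-++⁺ˡ a∈xs)
      ...   | inj₂ (here refl) = inj₁ (here refl)
      ...   | inj₂ (there a∈ys) = inj₂ (∈-++⁺ʳ xs a∈ys)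

    -- x and y are proportional to the marginals of Λ, so the cut condition holds at every set of rows.
    module _ (n : ℕ) (Λ : Matrix M) (Λ-supp : Supported W Λ) (x y : Fin M → ℕ)
             (Λ-row : ∀ i → row Λ i ≡ suc n * x i) (Λ-col : ∀ j → col Λ j ≡ suc n * y j) where

      private
        sum-swap : ∀ (s : Fin M → ℕ) (μ : Matrix M) → sum (λ j → sum (λ i → s i * μ i j)) ≡ sum (λ i → s i * row μ i)
        sum-swap s μ = trans (∑-comm (λ j i → s i * μ i j)) (sum-cong-≗ (λ i → sym (*-distribˡ-sum (s i) (μ i))))

        sum-col : ∀ (r : Fin M → ℕ) (μ : Matrix M) → sum (λ j → sum (λ i → r j * μ i j)) ≡ sum (λ j → r j * col μ j)
        sum-col r μ = sum-cong-≗ (λ j → sym (*-distribˡ-sum (r j) (λ i → μ i j)))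

        sum-scale : ∀ (s z : Fin M → ℕ) → sum (λ i → s i * (suc n * z i)) ≡ suc n * sum (λ i → s i * z i)
        sum-scale s z = trans (sum-cong-≗ (λ i → comm (s i) (suc n) (z i))) (sym (*-distribˡ-sum (suc n) (λ i → s i * z i)))
          where
          comm : ∀ a b c → a * (b * c) ≡ b * (a * c)
          comm = solve-∀

      -- The cut argument at S, with indicator `s`, and its neighbourhood N(S), with indicator `r`.
      -- Since Λ is supported on W, x(S) ≤ y(N(S)). If every column of N(S) were full, y(N(S)) would
      -- be a sum of columns of μ; closedness of S puts all their entries into the rows of S, and
      -- there the deficient row l₀ keeps μ strictly below x(S).
      deficient-column : ∀ (μ : Matrix M) (dl dr : Fin M → ℕ) →
        (∀ i → x i ≡ row μ i + dl i) → (∀ j → y j ≡ col μ j + dr j) →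
        ∀ {l₀ S} → 0 < dl l₀ → l₀ ∈ S → Closed μ S →
        ∃ λ i → ∃ λ j → i ∈ S × W i j × 0 < dr j
      deficient-column μ dl dr xs ys {l₀} {S} dl>0 l₀∈S closed
        with any? (λ i → any? (λ j → (i ∈? S) ×-dec W? i j ×-dec (0 <? dr j)))
      ... | yes found = found
      ... | no none = contradiction chain (<-irrefl refl)
        where
        nbr? : ∀ j → Dec (∃ λ i → i ∈ S × W i j)
        nbr? j = any? (λ i → (i ∈? S) ×-dec W? i j)
        s r : Fin M → ℕ
        s i = ind (i ∈? S)
        r j = ind (nbr? j)
        r≤s : ∀ j i → r j * μ i j ≤ s i * μ i j
        r≤s j i with nbr? j | μ i j in eq
        ... | no _ | _ = z≤n
        ... | yes _ | zero = z≤n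
        ... | yes (i′ , i′∈S , w) | suc m =
          ≤-reflexive (cong (_* suc m) (sym (ind-yes (i ∈? S) (closed i i′ j i′∈S w (subst (0 <_) (sym eq) z<s)))))
        s≤r : ∀ j i → s i * Λ i j ≤ r j * Λ i j
        s≤r j i with i ∈? S | Λ i j in eq
        ... | no _ | _ = z≤n
        ... | yes _ | zero = z≤n
        ... | yes i∈S | suc m =
          ≤-reflexive (cong (_* suc m) (sym (ind-yes (nbr? j) (i , i∈S , Λ-supp i j (subst (0 <_) (sym eq) z<s)))))
        r*y : ∀ j → r j * y j ≡ r j * col μ j
        r*y j with nbr? j
        ... | no _ = refl
        ... | yes (i , i∈S , w) with dr j in eq
        ...   | zero = cong (1 *_) (trans (ys j) (trans (cong (col μ j +_) eq) (+-identityʳ _)))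
        ...   | suc _ = contradiction (i , j , i∈S , w , subst (0 <_) (sym eq) z<s) none
        s*x : sum (λ i → s i * row μ i) < sum (λ i → s i * x i)
        s*x = begin-strict
          sum (λ i → s i * row μ i)                            ≡⟨ +-identityʳ _ ⟨
          sum (λ i → s i * row μ i) + 0                        <⟨ +-monoʳ-< (sum (λ i → s i * row μ i)) pos ⟩
          sum (λ i → s i * row μ i) + sum (λ i → s i * dl i)   ≡⟨ ∑-distrib-+ (λ i → s i * row μ i) (λ i → s i * dl i) ⟨
          sum (λ i → s i * row μ i + s i * dl i)               ≡⟨ sum-cong-≗ (λ i → trans (cong (s i *_) (xs i)) (*-distribˡ-+ (s i) _ _)) ⟨
          sum (λ i → s i * x i)                                ∎
          where
          open ≤-Reasoning
          pos : 0 < sum (λ i → s i * dl i)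
          pos = <-≤-trans (subst (0 <_) (sym (trans (cong (_* dl l₀) (ind-yes (l₀ ∈? S) l₀∈S)) (*-identityˡ _))) dl>0)
                          (term≤sum (λ i → s i * dl i) l₀)
        chain : suc n * sum (λ i → s i * x i) < suc n * sum (λ i → s i * x i)
        chain = begin-strict
          suc n * sum (λ i → s i * x i)             ≡⟨ sum-scale s x ⟨
          sum (λ i → s i * (suc n * x i))           ≡⟨ sum-cong-≗ (λ i → cong (s i *_) (Λ-row i)) ⟨
          sum (λ i → s i * row Λ i)                 ≡⟨ sum-swap s Λ ⟨
          sum (λ j → sum (λ i → s i * Λ i j))       ≤⟨ sum-mono (λ j → sum-mono (s≤r j)) ⟩
          sum (λ j → sum (λ i → r j * Λ i j))       ≡⟨ sum-col r Λ ⟩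
          sum (λ j → r j * col Λ j)                 ≡⟨ sum-cong-≗ (λ j → cong (r j *_) (Λ-col j)) ⟩
          sum (λ j → r j * (suc n * y j))           ≡⟨ sum-scale r y ⟩
          suc n * sum (λ j → r j * y j)             ≡⟨ cong (suc n *_) (sum-cong-≗ r*y) ⟩
          suc n * sum (λ j → r j * col μ j)         ≡⟨ cong (suc n *_) (sum-col r μ) ⟨
          suc n * sum (λ j → sum (λ i → r j * μ i j)) ≤⟨ *-monoʳ-≤ (suc n) (sum-mono (λ j → sum-mono (r≤s j))) ⟩
          suc n * sum (λ j → sum (λ i → s i * μ i j)) ≡⟨ cong (suc n *_) (sum-swap s μ) ⟩
          suc n * sum (λ i → s i * row μ i)         <⟨ *-monoʳ-< (suc n) s*x ⟩
          suc n * sum (λ i → s i * x i)             ∎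
          where open ≤-Reasoning

      private
        sum-x≡sum-y : sum x ≡ sum y
        sum-x≡sum-y = *-cancelˡ-≡ _ _ (suc n) (begin
          suc n * sum x             ≡⟨ *-distribˡ-sum (suc n) x ⟩
          sum (λ i → suc n * x i)   ≡⟨ sum-cong-≗ Λ-row ⟨
          sum (row Λ)               ≡⟨ sum-row≡sum-col Λ ⟩
          sum (col Λ)               ≡⟨ sum-cong-≗ Λ-col ⟩
          sum (λ i → suc n * y i)   ≡⟨ *-distribˡ-sum (suc n) y ⟨
          suc n * sum y ∎)
          where open ≡-Reasoning

        -- Induction on the total row deficiency, which every augmentation lowers by one. When it
        -- vanishes, the columns are full as well, because x and y have the same total.
        complete : ∀ k (μ : Matrix M) (dl dr : Fin M → ℕ) → Supported W μ → sum dl ≡ k →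
          (∀ i → x i ≡ row μ i + dl i) → (∀ j → y j ≡ col μ j + dr j) →
          Σ (Matrix M) λ μ′ → Supported W μ′ × (∀ i → row μ′ i ≡ x i) × (∀ j → col μ′ j ≡ y j)
        complete k μ dl dr supp eq xs ys with k
        ... | zero = μ , supp , (λ i → sym (trans (xs i) (trans (cong (row μ i +_) (sum≡0⇒ dl eq i)) (+-identityʳ _))))
                   , (λ j → sym (trans (ys j) (trans (cong (col μ j +_) (sum≡0⇒ dr dr≡0 j)) (+-identityʳ _))))
          where
          dr≡0 : sum dr ≡ 0
          dr≡0 = +-cancelˡ-≡ (sum (col μ)) _ _ (begin
            sum (col μ) + sum dr            ≡⟨ ∑-distrib-+ (col μ) dr ⟨
            sum (λ j → col μ j + dr j)      ≡⟨ sum-cong-≗ ys ⟨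
            sum y                           ≡⟨ sum-x≡sum-y ⟨
            sum x                           ≡⟨ sum-cong-≗ xs ⟩
            sum (λ i → row μ i + dl i)      ≡⟨ ∑-distrib-+ (row μ) dl ⟩
            sum (row μ) + sum dl            ≡⟨ cong₂ _+_ (sum-row≡sum-col μ) eq ⟩
            sum (col μ) + 0 ∎)
            where open ≡-Reasoning
        ... | suc k with sum>0⇒ dl eq
        ...   | l₀ , dl>0 with reached-closure {μ} _ (allFin M) ≤-refl (λ a → inj₂ (∈-allFin a)) (here refl) (root {l₀ = l₀})
        ...     | S , l₀∈S , tree , closed with deficient-column μ dl dr xs ys dl>0 l₀∈S closed
        ...       | i , j , i∈S , w , dr>0 with augment tree i∈S w μ supp (λ _ _ _ → refl)
        ...         | μ′ , supp′ , rows , cols =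
          complete k μ′ (λ a → dl a ∸ δ l₀ a) (λ b → dr b ∸ δ j b) supp′ eq′
            (λ a → trans (xs a) (shift {dl} {row μ} {row μ′} rows dl>0 a)) (λ b → trans (ys b) (shift {dr} {col μ} {col μ′} cols dr>0 b))
          where
          δ≤ : ∀ {d : Fin M → ℕ} {c} → 0 < d c → ∀ a → δ c a ≤ d a
          δ≤ {d} {c} h a with c ≟ a
          ... | yes refl = h
          ... | no _ = z≤n
          shift : ∀ {d f f′ : Fin M → ℕ} {c} → (∀ a → f′ a ≡ f a + δ c a) → 0 < d c →
                  ∀ a → f a + d a ≡ f′ a + (d a ∸ δ c a)
          shift {d} {f} {f′} {c} h d>0 a = begin
            f a + d a                       ≡⟨ cong (f a +_) (m+[n∸m]≡n (δ≤ {d} d>0 a)) ⟨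
            f a + (δ c a + (d a ∸ δ c a))   ≡⟨ +-assoc (f a) _ _ ⟨
            f a + δ c a + (d a ∸ δ c a)     ≡⟨ cong (_+ (d a ∸ δ c a)) (h a) ⟨
            f′ a + (d a ∸ δ c a) ∎
            where open ≡-Reasoning
          eq′ : sum (λ a → dl a ∸ δ l₀ a) ≡ k
          eq′ = suc-injective (begin
            1 + sum (λ a → dl a ∸ δ l₀ a)               ≡⟨ cong (_+ sum (λ a → dl a ∸ δ l₀ a)) (sum-δ l₀) ⟨
            sum (δ l₀) + sum (λ a → dl a ∸ δ l₀ a)      ≡⟨ ∑-distrib-+ (δ l₀) (λ a → dl a ∸ δ l₀ a) ⟨
            sum (λ a → δ l₀ a + (dl a ∸ δ l₀ a))        ≡⟨ sum-cong-≗ (λ a → m+[n∸m]≡n (δ≤ {dl} dl>0 a)) ⟩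
            sum dl                                      ≡⟨ eq ⟩
            suc k ∎)
            where open ≡-Reasoning

      integral-flow : Σ (Matrix M) λ μ → Supported W μ × (∀ i → row μ i ≡ x i) × (∀ j → col μ j ≡ y j)
      integral-flow = complete (sum x) (λ _ _ → 0) x y (λ _ _ ()) refl
        (λ i → cong (_+ x i) (sym (sum-replicate-zero M))) (λ j → cong (_+ y j) (sym (sum-replicate-zero M)))

-- The graded semigroup generated by the edges, and its normality

module Cones where

  open import Data.Nat.Base as ℕ using (ℕ; zero; suc)
  import Data.Nat.Properties as ℕ
  open import Data.Integer.Base using (ℤ; +_; 0ℤ; 1ℤ; _+_; _-_; _*_; -_; ∣_∣)
  open import Data.Integer.Properties as ℤ using (pos-*; +-injective)
  open import Data.Integer.Tactic.RingSolver using (solve-∀)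
  import Data.Nat.Tactic.RingSolver as ℕ-Solver
  open import Data.Fin.Base using (Fin)
  open import Data.Product.Base using (Σ; ∃; _×_; _,_)
  open import Data.Sum.Base using (_⊎_; inj₁; inj₂)
  open import Relation.Binary.PropositionalEquality
  open import Relation.Binary.Definitions using (Decidable)
  open import Relation.Nullary using (contradiction)
  open import Algebra.Properties.AbelianGroup ℤ.+-0-abelianGroup using (∙-cancelʳ)
  open Flows

  -- (x , y) ∈ ℤ^M × ℤ^M as one function, x on the left summand and y on the right.
  Point : ℕ → Set
  Point M = Fin M ⊎ Fin M → ℤ

  infix 4 _≈_
  infixl 6 _⊕_ _⊖_
  infixr 7 _⊛_

  _≈_ : ∀ {M} → Point M → Point M → Set
  p ≈ q = ∀ c → p c ≡ q c

  _⊕_ _⊖_ : ∀ {M} → Point M → Point M → Point M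
  (p ⊕ q) c = p c + q c
  (p ⊖ q) c = p c - q c

  _⊛_ : ∀ {M} → ℕ → Point M → Point M
  (n ⊛ p) c = + n * p c

  𝟎 : ∀ {M} → Point M
  𝟎 c = 0ℤ

  e : ∀ {M} → Fin M → Fin M → Point M
  e i j (inj₁ a) = + δ i a
  e i j (inj₂ b) = + δ j b

  ≈-sym : ∀ {M} {p q : Point M} → p ≈ q → q ≈ p
  ≈-sym eq c = sym (eq c)

  ≈-trans : ∀ {M} {p q r : Point M} → p ≈ q → q ≈ r → p ≈ r
  ≈-trans eq eq′ c = trans (eq c) (eq′ c)

  ⊕-cong : ∀ {M} {p p′ q q′ : Point M} → p ≈ p′ → q ≈ q′ → p ⊕ q ≈ p′ ⊕ q′
  ⊕-cong eq eq′ c = cong₂ _+_ (eq c) (eq′ c)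

  ⊕-cancelʳ : ∀ {M} (r : Point M) {p q} → p ⊕ r ≈ q ⊕ r → p ≈ q
  ⊕-cancelʳ r eq c = ∙-cancelʳ (r c) _ _ (eq c)

  ⊖-⊕ : ∀ {M} (p q : Point M) → (p ⊖ q) ⊕ q ≈ p
  ⊖-⊕ p q c = lem (p c) (q c)
    where
    lem : ∀ a b → a - b + b ≡ a
    lem = solve-∀

  Edges : ℕ → Set₁
  Edges M = Fin M → Fin M → Set

  -- Level t of the semigroup generated by the edges. Points are functions, so both constructors
  -- accept any point that agrees with the required one coordinatewise; everything later respects
  -- `≈` instead of `≡`.
  data Cone {M} (W : Edges M) : ℕ → Point M → Set where
    nil : ∀ {p} → p ≈ 𝟎 → Cone W 0 p
    add : ∀ {t i j p q} → W i j → Cone W t q → p ≈ q ⊕ e i j → Cone W (suc t) p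

  module _ {M} {W : Edges M} where

    cone-cast : ∀ {s t p q} → s ≡ t → p ≈ q → Cone W s p → Cone W t q
    cone-cast refl eq (nil p≈0) = nil (≈-trans (≈-sym eq) p≈0)
    cone-cast refl eq (add w k p≈) = add w k (≈-trans (≈-sym eq) p≈)

    cone-resp : ∀ {t p q} → p ≈ q → Cone W t p → Cone W t q
    cone-resp = cone-cast refl

    cone-⊕ : ∀ {s t p q} → Cone W s p → Cone W t q → Cone W (s ℕ.+ t) (p ⊕ q)
    cone-⊕ {q = q} (nil p≈0) k = cone-resp (λ c → sym (trans (cong (_+ q c) (p≈0 c)) (ℤ.+-identityˡ (q c)))) k
    cone-⊕ {p = p} {q} (add {i = i} {j} {q = p′} w k p≈) k′ =
      add w (cone-⊕ k k′) (λ c → trans (cong (_+ q c) (p≈ c)) (lem (p′ c) (e i j c) (q c)))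
      where
      lem : ∀ a b c → a + b + c ≡ a + c + b
      lem = solve-∀

    cone-edge : ∀ {i j} → W i j → Cone W 1 (e i j)
    cone-edge w = add w (nil {p = 𝟎} (λ _ → refl)) (λ c → sym (ℤ.+-identityˡ _))

    cone-snoc : ∀ {t p i j} → Cone W t p → W i j → Cone W (suc t) (p ⊕ e i j)
    cone-snoc k w = add w k (λ _ → refl)

    cone-⊛ : ∀ {t p} n → Cone W t p → Cone W (n ℕ.* t) (n ⊛ p)
    cone-⊛ {p = p} zero k = nil (λ c → ℤ.*-zeroˡ (p c))
    cone-⊛ {p = p} (suc n) k = cone-resp (λ c → lem (p c) (+ n)) (cone-⊕ k (cone-⊛ n k))
      where
      lem : ∀ a b → a + b * a ≡ (1ℤ + b) * a
      lem = solve-∀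

    toMatrix : ∀ {t p} → Cone W t p → Σ (Matrix M) λ μ → Supported W μ ×
               (∀ i → p (inj₁ i) ≡ + row μ i) × (∀ j → p (inj₂ j) ≡ + col μ j) × sum (row μ) ≡ t
    toMatrix (nil p≈0) = (λ _ _ → 0) , (λ _ _ ()) ,
      (λ i → trans (p≈0 _) (cong +_ (sym (sum-replicate-zero M)))) ,
      (λ j → trans (p≈0 _) (cong +_ (sym (sum-replicate-zero M)))) ,
      trans (sum-cong-≗ {M} (λ _ → sum-replicate-zero M)) (sum-replicate-zero M)
    toMatrix (add {t} {i} {j} w k p≈) with toMatrix k
    ... | μ , supp , rows , cols , deg = bump μ i j , bump-supported w supp ,
      (λ a → trans (p≈ _) (trans (cong (_+ + δ i a) (rows a)) (cong +_ (sym (row-bump μ i j a))))) ,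
      (λ b → trans (p≈ _) (trans (cong (_+ + δ j b) (cols b)) (cong +_ (sym (col-bump μ i j b))))) ,
      (begin
        sum (row (bump μ i j))         ≡⟨ sum-cong-≗ (row-bump μ i j) ⟩
        sum (λ a → row μ a ℕ.+ δ i a)  ≡⟨ ∑-distrib-+ (row μ) (δ i) ⟩
        sum (row μ) ℕ.+ sum (δ i)      ≡⟨ cong₂ ℕ._+_ deg (sum-δ i) ⟩
        t ℕ.+ 1                        ≡⟨ ℕ.+-comm t 1 ⟩
        suc t ∎)
      where open ≡-Reasoning

    fromMatrix : ∀ t {p} (μ : Matrix M) → Supported W μ → sum (row μ) ≡ t →
                 (∀ i → p (inj₁ i) ≡ + row μ i) → (∀ j → p (inj₂ j) ≡ + col μ j) → Cone W t p
    fromMatrix zero {p} μ supp deg rows cols = nil λ where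
      (inj₁ i) → trans (rows i) (cong +_ (sum≡0⇒ (row μ) deg i))
      (inj₂ j) → trans (cols j) (cong +_ (sum≡0⇒ (col μ) (trans (sym (sum-row≡sum-col μ)) deg) j))
    fromMatrix (suc t) {p} μ supp deg rows cols with sum>0⇒ (row μ) deg
    ... | i , row>0 with row μ i in eq
    ...   | zero = contradiction row>0 (ℕ.<-irrefl refl)
    ...   | suc _ with sum>0⇒ (μ i) eq
    ...     | j , μ>0 = add (supp i j μ>0)
                (fromMatrix t {p ⊖ e i j} ν (drop-supported {i = i} {j} supp) deg′ rows′ cols′)
                (≈-sym (⊖-⊕ p (e i j)))
      where
      ν = drop μ i j
      row-ν : ∀ a → row μ a ≡ row ν a ℕ.+ δ i a
      row-ν a = trans (sum-cong-≗ (λ b → sym (bump-drop μ i j μ>0 a b))) (row-bump ν i j a)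
      col-ν : ∀ b → col μ b ≡ col ν b ℕ.+ δ j b
      col-ν b = trans (sum-cong-≗ (λ a → sym (bump-drop μ i j μ>0 a b))) (col-bump ν i j b)
      lem : ∀ a b → a + b - b ≡ a
      lem = solve-∀
      rows′ : ∀ a → p (inj₁ a) - + δ i a ≡ + row ν a
      rows′ a = trans (cong (_- + δ i a) (trans (rows a) (cong +_ (row-ν a)))) (lem (+ row ν a) (+ δ i a))
      cols′ : ∀ b → p (inj₂ b) - + δ j b ≡ + col ν b
      cols′ b = trans (cong (_- + δ j b) (trans (cols b) (cong +_ (col-ν b)))) (lem (+ col ν b) (+ δ j b))
      deg′ : sum (row ν) ≡ t
      deg′ = ℕ.+-cancelʳ-≡ 1 _ _ (begin
        sum (row ν) ℕ.+ 1              ≡⟨ cong (sum (row ν) ℕ.+_) (sum-δ i) ⟨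
        sum (row ν) ℕ.+ sum (δ i)      ≡⟨ ∑-distrib-+ (row ν) (δ i) ⟨
        sum (λ a → row ν a ℕ.+ δ i a)  ≡⟨ sum-cong-≗ row-ν ⟨
        sum (row μ)                    ≡⟨ deg ⟩
        suc t                          ≡⟨ ℕ.+-comm 1 t ⟩
        t ℕ.+ 1 ∎)
        where open ≡-Reasoning

    cone-nonneg : ∀ {t p} → Cone W t p → ∀ c → p c ≡ + ∣ p c ∣
    cone-nonneg k c with toMatrix k
    cone-nonneg k (inj₁ i) | μ , _ , rows , _ rewrite rows i = refl
    cone-nonneg k (inj₂ j) | μ , _ , _ , cols , _ rewrite cols j = refl

    module _ (W? : Decidable W) where

      -- Integrality in the form that serves two purposes: Λ comes either from a decomposition of a
      -- multiple of r, as in `normal`, or from rational weights with cleared denominators, as in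
      -- `dilate⇒cone`. The coordinates of r are nonnegative because a positive multiple of each is
      -- a row or column sum.
      saturated : ∀ n {t r} (Λ : Matrix M) → Supported W Λ → sum (row Λ) ≡ suc n ℕ.* t →
                  (∀ i → + suc n * r (inj₁ i) ≡ + row Λ i) → (∀ j → + suc n * r (inj₂ j) ≡ + col Λ j) → Cone W t r
      saturated n {t} {r} Λ supp deg rows cols =
        let μ , supp′ , rows′ , cols′ = integral-flow W? n Λ supp
              (λ i → ∣ r (inj₁ i) ∣) (λ j → ∣ r (inj₂ j) ∣) (λ i → scaled (inj₁ i) (rows i)) (λ j → scaled (inj₂ j) (cols j))
        in fromMatrix t μ supp′
             (ℕ.*-cancelˡ-≡ _ _ (suc n) (begin
               suc n ℕ.* sum (row μ)                          ≡⟨ cong (suc n ℕ.*_) (sum-cong-≗ rows′) ⟩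
               suc n ℕ.* sum (λ i → ∣ r (inj₁ i) ∣)           ≡⟨ *-distribˡ-sum (suc n) (λ i → ∣ r (inj₁ i) ∣) ⟩
               sum (λ i → suc n ℕ.* ∣ r (inj₁ i) ∣)           ≡⟨ sum-cong-≗ (λ i → scaled (inj₁ i) (rows i)) ⟨
               sum (row Λ)                                    ≡⟨ deg ⟩
               suc n ℕ.* t ∎))
             (λ i → trans (nonneg (r (inj₁ i)) (rows i)) (cong +_ (sym (rows′ i))))
             (λ j → trans (nonneg (r (inj₂ j)) (cols j)) (cong +_ (sym (cols′ j))))
        where
        open ≡-Reasoning
        nonneg : ∀ z {m} → + suc n * z ≡ + m → z ≡ + ∣ z ∣
        nonneg (+ _) _ = refl
        scaled : ∀ c {m} → + suc n * r c ≡ + m → m ≡ suc n ℕ.* ∣ r c ∣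
        scaled c eq = +-injective (trans (sym eq) (trans (cong (+ suc n *_) (nonneg (r c) eq)) (sym (pos-* (suc n) ∣ r c ∣))))

      normal : ∀ n {t r} → Cone W (suc n ℕ.* t) (suc n ⊛ r) → Cone W t r
      normal n {t} {r} k with toMatrix k
      ... | Λ , supp , rows , cols , deg = saturated n {t} {r} Λ supp deg rows cols

      -- (n + 1)(p + d) = (p + (n + 1) d) + n p lies in the semigroup, and normality divides it by n
      -- + 1. So a line in direction d has no gaps inside the semigroup, and a point after which it
      -- leaves is the last one. The degree g of d may be 0, which is the case for differences of
      -- edges.
      ray : ∀ g n {s p d} → Cone W s p → Cone W (suc n ℕ.* g ℕ.+ s) (p ⊕ suc n ⊛ d) → Cone W (g ℕ.+ s) (p ⊕ d)
      ray g n {s} {p} {d} k k′ = normal n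
        (cone-cast (lem n g s) (λ c → lem′ (+ n) (p c) (d c)) (cone-⊕ k′ (cone-⊛ n k)))
        where
        lem : ∀ n g s → suc n ℕ.* g ℕ.+ s ℕ.+ n ℕ.* s ≡ suc n ℕ.* (g ℕ.+ s)
        lem = ℕ-Solver.solve-∀
        lem′ : ∀ n a b → a + (1ℤ + n) * b + n * a ≡ (1ℤ + n) * (a + b)
        lem′ = solve-∀

  record Hom (M M′ : ℕ) : Set where
    field
      ⟦_⟧   : Point M → Point M′
      cong-≈ : ∀ {p q} → p ≈ q → ⟦ p ⟧ ≈ ⟦ q ⟧
      homo-𝟎 : ⟦ 𝟎 ⟧ ≈ 𝟎
      homo-⊕ : ∀ p q → ⟦ p ⊕ q ⟧ ≈ ⟦ p ⟧ ⊕ ⟦ q ⟧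

  module _ {M M′} (h : Hom M M′) {W : Edges M} {W′ : Edges M′} where

    open Hom h

    cone-image : (∀ {i j} → W i j → ∃ λ i′ → ∃ λ j′ → W′ i′ j′ × ⟦ e i j ⟧ ≈ e i′ j′) →
                 ∀ {t p} → Cone W t p → Cone W′ t ⟦ p ⟧
    cone-image edge (nil p≈0) = nil (≈-trans (cong-≈ p≈0) homo-𝟎)
    cone-image edge (add {i = i} {j} {p} {q} w k p≈) with edge w
    ... | i′ , j′ , w′ , eq =
      add w′ (cone-image edge k) (≈-trans (cong-≈ p≈) (≈-trans (homo-⊕ q (e i j)) (λ c → cong (_+_ (⟦ q ⟧ c)) (eq c))))

    cone-preimage : (∀ {i′ j′} → W′ i′ j′ → ∃ λ i → ∃ λ j → W i j × ⟦ e i j ⟧ ≈ e i′ j′) →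
                    ∀ {t q} → Cone W′ t q → ∃ λ p → Cone W t p × ⟦ p ⟧ ≈ q
    cone-preimage edge (nil q≈0) = 𝟎 , nil (λ _ → refl) , ≈-trans homo-𝟎 (≈-sym q≈0)
    cone-preimage edge (add {i = i′} {j′} w′ k q≈) with edge w′ | cone-preimage edge k
    ... | i , j , w , eq | p , k′ , eq′ =
      p ⊕ e i j , cone-snoc k′ w , ≈-trans (homo-⊕ p (e i j)) (≈-trans (⊕-cong eq′ eq) (≈-sym q≈))

  cone-mono : ∀ {M} {W W′ : Edges M} → (∀ {i j} → W i j → W′ i j) → ∀ {t p} → Cone W t p → Cone W′ t p
  cone-mono f (nil p≈0) = nil p≈0
  cone-mono f (add w k p≈) = add (f w) (cone-mono f k) p≈

-- Counting points up to pointwise equality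

module Counting where

  open import Data.Nat.Base as ℕ using (ℕ; zero; suc; _≤_)
  import Data.Nat.Properties as ℕ
  open import Data.Integer.Base using (+_; 1ℤ) renaming (_+_ to _ℤ+_; _*_ to _ℤ*_)
  import Data.Integer.Properties as ℤ
  open import Data.Integer.Tactic.RingSolver using (solve-∀)
  open import Data.Fin.Base using (Fin; zero; suc; splitAt; _↑ˡ_; _↑ʳ_)
  open import Data.Fin.Properties using (splitAt-↑ˡ; splitAt-↑ʳ; splitAt⁻¹-↑ˡ; splitAt⁻¹-↑ʳ; injective⇒≤; all?)
  open import Data.List.Base using (List; []; _∷_; filter; cartesianProduct; cartesianProductWith; allFin)
  open import Data.List.Membership.Propositional using (_∈_; find)
  open import Data.List.Membership.Propositional.Properties using (∈-filter⁺; ∈-filter⁻; ∈-cartesianProduct⁺; ∈-cartesianProductWith⁻; ∈-allFin)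
  open import Data.List.Relation.Unary.Any as Any using (Any; here; there; any?)
  open import Data.List.Relation.Unary.Any.Properties using (cartesianProductWith⁺)
  open import Data.Product.Base using (∃; _×_; _,_; proj₁; proj₂; uncurry)
  open import Data.Unit.Base using (⊤; tt)
  open import Data.Sum.Base using (_⊎_; inj₁; inj₂)
  open import Function.Base using (_∘_)
  open import Relation.Binary.PropositionalEquality
  open import Relation.Binary.Definitions using (Decidable)
  open import Relation.Nullary
  open import Relation.Nullary.Decidable using (map′)
  open Flows
  open Cones

  _≈?_ : ∀ {M} (p q : Point M) → Dec (p ≈ q)
  p ≈? q = map′ (λ (f , g) → λ where (inj₁ i) → f i ; (inj₂ j) → g j) (λ eq → eq ∘ inj₁ , eq ∘ inj₂)
    (all? (λ i → p (inj₁ i) ℤ.≟ q (inj₁ i)) ×-dec all? (λ j → p (inj₂ j) ℤ.≟ q (inj₂ j)))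

  -- An enumeration without repetition modulo `≈`. It avoids both equality of functions and equality
  -- of proofs of P, and still determines n (`card-unique`).
  record Card {M} (P : Point M → Set) (n : ℕ) : Set where
    field
      enum     : Fin n → Point M
      sound    : ∀ i → P (enum i)
      distinct : ∀ {i j} → enum i ≈ enum j → i ≡ j
      complete : ∀ {p} → P p → ∃ λ i → p ≈ enum i
  open Card public

  _∪_ : ∀ {M} → (Point M → Set) → (Point M → Set) → Point M → Set
  (P ∪ Q) p = P p ⊎ Q p

  Disjoint : ∀ {M} → (Point M → Set) → (Point M → Set) → Set
  Disjoint P Q = ∀ {p q} → P p → Q q → ¬ p ≈ q

  Image : ∀ {M M′} → (Point M → Point M′) → (Point M → Set) → Point M′ → Set
  Image f P q = ∃ λ p → P p × f p ≈ q

  card-⇔ : ∀ {M n} {P Q : Point M → Set} → (∀ {p} → P p → Q p) → (∀ {p} → Q p → P p) → Card P n → Card Q n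
  card-⇔ to from c .enum = enum c
  card-⇔ to from c .sound i = to (sound c i)
  card-⇔ to from c .distinct = distinct c
  card-⇔ to from c .complete q = complete c (from q)

  card-∅ : ∀ {M} {P : Point M → Set} → (∀ {p} → ¬ P p) → Card P 0
  card-∅ ¬P .enum ()
  card-∅ ¬P .sound ()
  card-∅ ¬P .distinct {()}
  card-∅ ¬P .complete p = contradiction p ¬P

  card-∪ : ∀ {M m n} {P Q : Point M → Set} → Disjoint P Q → Card P m → Card Q n → Card (P ∪ Q) (m ℕ.+ n)
  card-∪ {M} {m} {n} {P} {Q} disj c d = record { enum = enum′ ; sound = sound′ ; distinct = distinct′ ; complete = complete′ }
    where
    both : Fin m ⊎ Fin n → Point M
    both (inj₁ i) = enum c i
    both (inj₂ j) = enum d j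
    enum′ : Fin (m ℕ.+ n) → Point M
    enum′ = both ∘ splitAt m
    sound′ : ∀ k → (P ∪ Q) (enum′ k)
    sound′ k with splitAt m k
    ... | inj₁ i = inj₁ (sound c i)
    ... | inj₂ j = inj₂ (sound d j)
    distinct′ : ∀ {k l} → enum′ k ≈ enum′ l → k ≡ l
    distinct′ {k} {l} eq with splitAt m k in eqk | splitAt m l in eql
    ... | inj₁ i | inj₁ j = trans (sym (splitAt⁻¹-↑ˡ eqk)) (trans (cong (_↑ˡ n) (distinct c eq)) (splitAt⁻¹-↑ˡ eql))
    ... | inj₁ i | inj₂ j = contradiction eq (disj (sound c i) (sound d j))
    ... | inj₂ i | inj₁ j = contradiction (≈-sym eq) (disj (sound c j) (sound d i))
    ... | inj₂ i | inj₂ j = trans (sym (splitAt⁻¹-↑ʳ eqk)) (trans (cong (m ↑ʳ_) (distinct d eq)) (splitAt⁻¹-↑ʳ eql))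
    complete′ : ∀ {p} → (P ∪ Q) p → ∃ λ k → p ≈ enum′ k
    complete′ {p} (inj₁ x) with complete c x
    ... | i , eq = i ↑ˡ n , subst (λ z → p ≈ both z) (sym (splitAt-↑ˡ m i n)) eq
    complete′ {p} (inj₂ x) with complete d x
    ... | j , eq = m ↑ʳ j , subst (λ z → p ≈ both z) (sym (splitAt-↑ʳ m n j)) eq

  card-image : ∀ {M M′ n} {P : Point M → Set} (f : Point M → Point M′) → (∀ {p q} → p ≈ q → f p ≈ f q) →
               (∀ {p q} → P p → P q → f p ≈ f q → p ≈ q) → Card P n → Card (Image f P) n
  card-image f f-cong f-inj c .enum i = f (enum c i)
  card-image f f-cong f-inj c .sound i = enum c i , sound c i , λ _ → refl
  card-image f f-cong f-inj c .distinct {i} {j} eq = distinct c (f-inj (sound c i) (sound c j) eq)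
  card-image f f-cong f-inj c .complete (p , x , eq) with complete c x
  ... | i , eq′ = i , ≈-trans (≈-sym eq) (f-cong eq′)

  card-≤ : ∀ {M M′ m n} {P : Point M → Set} {Q : Point M′ → Set} (f : Point M → Point M′) → (∀ {p} → P p → Q (f p)) →
           (∀ {p q} → f p ≈ f q → p ≈ q) → Card P m → Card Q n → m ≤ n
  card-≤ f f-maps f-inj c d = injective⇒≤ {f = λ i → proj₁ (complete d (f-maps (sound c i)))} λ {i} {j} eq →
    distinct c (f-inj (≈-trans (proj₂ (complete d (f-maps (sound c i))))
      (≈-trans (λ x → cong (λ k → enum d k x) eq) (≈-sym (proj₂ (complete d (f-maps (sound c j))))))))

  card-unique : ∀ {M m n} {P : Point M → Set} → Card P m → Card P n → m ≡ n
  card-unique c d = ℕ.≤-antisym (card-≤ (λ p → p) (λ x → x) (λ eq → eq) c d) (card-≤ (λ p → p) (λ x → x) (λ eq → eq) d c)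

  -- The list may repeat points, since different choices of edges have the same sum; every point is
  -- counted at its last occurrence.
  card-list : ∀ {M} {Q : Point M → Set} (Q? : ∀ p → Dec (Q p)) (Q-resp : ∀ {p q} → p ≈ q → Q p → Q q)
              (L : List (Point M)) → ∃ λ n → Card (λ p → Q p × Any (p ≈_) L) n
  card-list Q? Q-resp [] = 0 , card-∅ λ { (_ , ()) }
  card-list {M} {Q} Q? Q-resp (x ∷ L) with card-list Q? Q-resp L | Q? x | any? (x ≈?_) L
  ... | n , c | no ¬Qx | _ = n , card-⇔ (λ (q , a) → q , there a)
          (λ { (q , here eq) → contradiction (Q-resp eq q) ¬Qx ; (q , there a) → q , a }) c
  ... | n , c | yes Qx | yes x∈L = n , card-⇔ (λ (q , a) → q , there a)
          (λ { (q , here eq) → q , Any.map (≈-trans eq) x∈L ; (q , there a) → q , a }) c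
  ... | n , c | yes Qx | no x∉L = suc n , card-⇔ to from (card-∪ disj single c)
    where
    single : Card (_≈ x) 1
    single .enum _ = x
    single .sound _ _ = refl
    single .distinct {zero} {zero} _ = refl
    single .complete eq = zero , eq
    disj : Disjoint (_≈ x) (λ p → Q p × Any (p ≈_) L)
    disj eq (_ , a) eq′ = x∉L (Any.map (≈-trans (≈-trans (≈-sym eq) eq′)) a)
    to : ∀ {p} → p ≈ x ⊎ (Q p × Any (p ≈_) L) → Q p × Any (p ≈_) (x ∷ L)
    to (inj₁ eq) = Q-resp (≈-sym eq) Qx , here eq
    to (inj₂ (q , a)) = q , there a
    from : ∀ {p} → Q p × Any (p ≈_) (x ∷ L) → p ≈ x ⊎ (Q p × Any (p ≈_) L)
    from (q , here eq) = inj₁ eq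
    from (q , there a) = inj₂ (q , a)

  module _ {M} {W : Edges M} (W? : Decidable W) where

    edges : List (Fin M × Fin M)
    edges = filter (uncurry W?) (cartesianProduct (allFin M) (allFin M))

    private
      extend : Point M → Fin M × Fin M → Point M
      extend q (i , j) = q ⊕ e i j

    members : ℕ → List (Point M)
    members zero = 𝟎 ∷ []
    members (suc t) = cartesianProductWith extend (members t) edges

    members-complete : ∀ {t p} → Cone W t p → Any (p ≈_) (members t)
    members-complete (nil p≈0) = here p≈0
    members-complete (add {i = i} {j} w k p≈) =
      cartesianProductWith⁺ extend
        (λ { eq refl → ≈-trans p≈ (⊕-cong eq (λ _ → refl)) }) (members-complete k)
        (∈-filter⁺ (uncurry W?) (∈-cartesianProduct⁺ (∈-allFin i) (∈-allFin j)) w)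

    members-sound : ∀ t {p} → p ∈ members t → Cone W t p
    members-sound zero (here refl) = nil (λ _ → refl)
    members-sound (suc t) p∈ with ∈-cartesianProductWith⁻ extend (members t) edges p∈
    ... | q , ij , q∈ , ij∈ , refl = cone-snoc (members-sound t q∈) (proj₂ (∈-filter⁻ (uncurry W?) {xs = cartesianProduct (allFin M) (allFin M)} ij∈))

    member⇒cone : ∀ t {p} → Any (p ≈_) (members t) → Cone W t p
    member⇒cone t a with find a
    ... | q , q∈ , eq = cone-resp (≈-sym eq) (members-sound t q∈)

    cone? : ∀ t p → Dec (Cone W t p)
    cone? t p = map′ (member⇒cone t) members-complete (any? (p ≈?_) (members t))

    card-within : ∀ t {Q : Point M → Set} → (∀ p → Dec (Q p)) → (∀ {p q} → p ≈ q → Q p → Q q) →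
                  ∃ λ n → Card (λ p → Q p × Cone W t p) n
    card-within t Q? Q-resp with card-list Q? Q-resp (members t)
    ... | n , c = n , card-⇔ (λ (q , a) → q , member⇒cone t a) (λ (q , k) → q , members-complete k) c

    size : ℕ → ℕ
    size t = proj₁ (card-within t {λ _ → ⊤} (λ _ → yes tt) (λ _ _ → tt))

    card-cone : ∀ t → Card (Cone W t) (size t)
    card-cone t = card-⇔ proj₂ (tt ,_) (proj₂ (card-within t {λ _ → ⊤} (λ _ → yes tt) (λ _ _ → tt)))

    -- The last points of the semigroup in direction d, where g is the degree of d. By `ray`, no
    -- later point of the same line belongs to the semigroup.
    Top : ℕ → Point M → ℕ → Point M → Set
    Top g d t p = ¬ Cone W (g ℕ.+ t) (p ⊕ d) × Cone W t p

    top? : ∀ g d t p → Dec (¬ Cone W (g ℕ.+ t) (p ⊕ d))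
    top? g d t p = ¬? (cone? (g ℕ.+ t) (p ⊕ d))

    top-resp : ∀ g d t {p q} → p ≈ q → ¬ Cone W (g ℕ.+ t) (p ⊕ d) → ¬ Cone W (g ℕ.+ t) (q ⊕ d)
    top-resp g d t eq ¬k k = ¬k (cone-resp (⊕-cong (≈-sym eq) (λ _ → refl)) k)

    top-size : ℕ → Point M → ℕ → ℕ
    top-size g d t = proj₁ (card-within t (top? g d t) (top-resp g d t))

    card-top : ∀ g d t → Card (Top g d t) (top-size g d t)
    card-top g d t = proj₂ (card-within t (top? g d t) (top-resp g d t))

  -- The points q + (j + 1) d with q in P at the level lower by (j + 1) g. Peeling off one d at a
  -- time shows level g + t as the translate of level t of P together with level t of `Beyond`; this
  -- is the recursion behind `card-beyond`.
  data Beyond {M} (g : ℕ) (d : Point M) (P : ℕ → Point M → Set) : ℕ → Point M → Set where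
    beyond : ∀ {s t p q} → t ≡ g ℕ.+ s → P s q ⊎ Beyond g d P s q → q ⊕ d ≈ p → Beyond g d P t p

  module _ {M} {g : ℕ} {d : Point M} {P : ℕ → Point M → Set} where

    beyond⇒ : ∀ {t p} → Beyond g d P t p → ∃ λ j → ∃ λ s → ∃ λ q → P s q × t ≡ suc j ℕ.* g ℕ.+ s × p ≈ q ⊕ suc j ⊛ d
    beyond⇒ (beyond {s} {q = q} refl (inj₁ x) eq) =
      0 , s , q , x , cong (ℕ._+ s) (sym (ℕ.*-identityˡ g)) , λ c → trans (sym (eq c)) (cong (q c ℤ+_) (sym (ℤ.*-identityˡ (d c))))
    beyond⇒ (beyond {q = q} refl (inj₂ y) eq) with beyond⇒ y
    ... | j , s , q′ , x , refl , eq′ =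
      suc j , s , q′ , x , sym (ℕ.+-assoc g (suc j ℕ.* g) s) ,
      λ c → trans (sym (eq c)) (trans (cong (_ℤ+ d c) (eq′ c)) (lem (q′ c) (d c) (+ j)))
      where
      lem : ∀ a b n → a ℤ+ (1ℤ ℤ+ n) ℤ* b ℤ+ b ≡ a ℤ+ (1ℤ ℤ+ (1ℤ ℤ+ n)) ℤ* b
      lem = solve-∀

    ⇒beyond : ∀ j {s p q} → P s q → p ≈ q ⊕ suc j ⊛ d → Beyond g d P (suc j ℕ.* g ℕ.+ s) p
    ⇒beyond zero {s} {p} {q} x eq = beyond (cong (ℕ._+ s) (ℕ.*-identityˡ g)) (inj₁ x)
      (λ c → sym (trans (eq c) (cong (q c ℤ+_) (ℤ.*-identityˡ (d c)))))
    ⇒beyond (suc j) {s} {p} {q} x eq = beyond (ℕ.+-assoc g (suc j ℕ.* g) s) (inj₂ (⇒beyond j {p = q ⊕ suc j ⊛ d} x (λ _ → refl)))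
      (λ c → trans (lem (q c) (d c) (+ j)) (sym (eq c)))
      where
      lem : ∀ a b n → a ℤ+ (1ℤ ℤ+ n) ℤ* b ℤ+ b ≡ a ℤ+ (1ℤ ℤ+ (1ℤ ℤ+ n)) ℤ* b
      lem = solve-∀

    card-beyond : ∀ {t m n} → Disjoint (P t) (Beyond g d P t) → Card (P t) m → Card (Beyond g d P t) n →
                  Card (Beyond g d P (g ℕ.+ t)) (m ℕ.+ n)
    card-beyond {t} disj c c′ = card-⇔
      (λ (q , x , eq) → beyond refl x eq)
      (λ { (beyond {s} eq x eq′) → lower (ℕ.+-cancelˡ-≡ g t s eq) x eq′ })
      (card-image (_⊕ d) (λ eq → ⊕-cong eq (λ _ → refl)) (λ _ _ → ⊕-cancelʳ d) (card-∪ disj c c′))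
      where
      lower : ∀ {s p q} → t ≡ s → P s q ⊎ Beyond g d P s q → q ⊕ d ≈ p → Image (_⊕ d) (P t ∪ Beyond g d P t) p
      lower refl x eq = _ , x , eq

    beyond-∅ : ∀ {t} → t ℕ.< g → ∀ {p} → ¬ Beyond g d P t p
    beyond-∅ t<g (beyond refl _ _) = ℕ.m+n≮m g _ t<g

-- Partial sums of sequences

module Sequences where

  open import Data.Nat.Base
  open import Data.Nat.Properties
  open import Relation.Binary.PropositionalEquality

  -- `before f t` is f(t - 1) + f(t - 2) + ... and counts `Beyond` in a direction of degree 1;
  -- `skip f t` is f(t - 2) + f(t - 4) + ... and belongs to directions of degree 2.
  before skip : (ℕ → ℕ) → ℕ → ℕ
  before f zero = 0
  before f (suc t) = f t + before f t
  skip f zero = 0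
  skip f (suc zero) = 0
  skip f (suc (suc t)) = f t + skip f t

  upto : (ℕ → ℕ) → ℕ → ℕ
  upto f t = before f (suc t)

  before-cong : ∀ {f g} → (∀ s → f s ≡ g s) → ∀ t → before f t ≡ before g t
  before-cong eq zero = refl
  before-cong eq (suc t) = cong₂ _+_ (eq t) (before-cong eq t)

  skip+skip : ∀ f t → skip f (suc t) + skip f t ≡ before f t
  skip+skip f zero = refl
  skip+skip f (suc t) = begin
    f t + skip f t + skip f (suc t)   ≡⟨ +-assoc (f t) _ _ ⟩
    f t + (skip f t + skip f (suc t)) ≡⟨ cong (f t +_) (+-comm (skip f t) _) ⟩
    f t + (skip f (suc t) + skip f t) ≡⟨ cong (f t +_) (skip+skip f t) ⟩
    f t + before f t ∎
    where open ≡-Reasoning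

-- Adding one edge, and attaching a left vertex to two right vertices

module Fans where

  open import Data.Nat.Base as ℕ using (ℕ; zero; suc)
  import Data.Nat.Properties as ℕ
  import Data.Nat.Tactic.RingSolver as ℕ-Solver
  open import Data.Integer.Base using (ℤ; +_; 0ℤ; 1ℤ; _+_; _-_; _*_; ∣_∣)
  open import Data.Integer.Properties as ℤ using (+-injective)
  open import Data.Integer.Tactic.RingSolver using (solve-∀)
  open import Algebra.Properties.AbelianGroup ℤ.+-0-abelianGroup using (∙-cancelʳ)
  open import Data.Fin.Base using (Fin)
  open import Data.Fin.Properties using (_≟_)
  open import Data.Product.Base using (∃; _×_; _,_; proj₁)
  open import Data.Sum.Base using (_⊎_; inj₁; inj₂)
  open import Function.Base using (_∘_)
  open import Relation.Binary.PropositionalEquality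
  open import Relation.Binary.Definitions using (Decidable)
  open import Relation.Nullary
  open Flows
  open Cones
  open Counting
  open Sequences

  infixl 5 _▸_

  _▸_ : ∀ {M} → Edges M → Fin M × Fin M → Edges M
  (W ▸ (a , b)) i j = W i j ⊎ (i ≡ a × j ≡ b)

  ▸? : ∀ {M} {W : Edges M} → Decidable W → ∀ a b → Decidable (W ▸ (a , b))
  ▸? W? a b i j = W? i j ⊎-dec (i ≟ a ×-dec j ≟ b)

  -- Linear reasoning in one step: the equation says l - r = x - y, a ring identity that is left to
  -- the solver.
  lin₁ : ∀ {x y l r} → x ≡ y → l + y ≡ r + x → l ≡ r
  lin₁ {x} refl eq = ∙-cancelʳ x _ _ eq

  +suc≢0 : ∀ {m n} → + m + + suc n ≢ 0ℤ
  +suc≢0 {m} {n} eq with trans (sym (ℕ.+-suc m n)) (+-injective eq)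
  ... | ()

  left-isolated : ∀ {M} {W : Edges M} {n} → (∀ j → ¬ W n j) → ∀ {t p} → Cone W t p → p (inj₁ n) ≡ 0ℤ
  left-isolated iso (nil p≈0) = p≈0 _
  left-isolated {n = n} iso (add {i = i} w k p≈) = trans (p≈ (inj₁ n))
    (cong₂ _+_ (left-isolated iso k) (cong +_ (ind-no (i ≟ n) λ { refl → iso _ w })))

  right-isolated : ∀ {M} {W : Edges M} {n} → (∀ i → ¬ W i n) → ∀ {t p} → Cone W t p → p (inj₂ n) ≡ 0ℤ
  right-isolated iso (nil p≈0) = p≈0 _
  right-isolated {n = n} iso (add {j = j} w k p≈) = trans (p≈ (inj₂ n))
    (cong₂ _+_ (right-isolated iso k) (cong +_ (ind-no (j ≟ n) λ { refl → iso _ w })))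

  size-cong : ∀ {M} {W W′ : Edges M} (W? : Decidable W) (W′? : Decidable W′) →
              (∀ {i j} → W i j → W′ i j) → (∀ {i j} → W′ i j → W i j) → ∀ t → size W? t ≡ size W′? t
  size-cong W? W′? to from t = card-unique (card-cone W? t) (card-⇔ (cone-mono from) (cone-mono to) (card-cone W′? t))

  module _ {M} {W : Edges M} (W? : Decidable W) where

    top-beyond-disjoint : ∀ g {d t p} → Cone W t p → ¬ Beyond g d (Top W? g d) t p
    top-beyond-disjoint g {d} k b with beyond⇒ b
    ... | j , s , q , (¬k , kq) , refl , eq = ¬k (ray W? g j kq (cone-resp eq k))

    -- Walk along the ray one d at a time. If some step leaves the semigroup, the point before it is
    -- a last point, and the end of the walk lies beyond it.
    climb : ∀ g {d} n {s p} → Cone W s p →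
            Cone W (n ℕ.* g ℕ.+ s) (p ⊕ n ⊛ d) ⊎ Beyond g d (Top W? g d) (n ℕ.* g ℕ.+ s) (p ⊕ n ⊛ d)
    climb g {d} zero {p = p} k = inj₁ (cone-resp (λ c → lem (p c) (d c)) k)
      where
      lem : ∀ a b → a ≡ a + 0ℤ * b
      lem = solve-∀
    climb g {d} (suc n) {s} {p} k with cone? W? (g ℕ.+ s) (p ⊕ d)
    ... | no ¬k = inj₂ (⇒beyond n (¬k , k) (λ _ → refl))
    ... | yes k′ with climb g n k′
    ...   | inj₁ k″ = inj₁ (cone-cast (deg n g s) (λ c → lem (p c) (d c) (+ n)) k″)
      where
      deg : ∀ n g s → n ℕ.* g ℕ.+ (g ℕ.+ s) ≡ suc n ℕ.* g ℕ.+ s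
      deg = ℕ-Solver.solve-∀
      lem : ∀ a b n → a + b + n * b ≡ a + (1ℤ + n) * b
      lem = solve-∀
    ...   | inj₂ (beyond h x eq) = inj₂ (beyond (trans (deg n g s) h) x (λ c → trans (eq c) (lem (p c) (d c) (+ n))))
      where
      deg : ∀ n g s → suc n ℕ.* g ℕ.+ s ≡ n ℕ.* g ℕ.+ (g ℕ.+ s)
      deg = ℕ-Solver.solve-∀
      lem : ∀ a b n → a + b + n * b ≡ a + (1ℤ + n) * b
      lem = solve-∀

    card-beyond-top₁ : ∀ d t → Card (Beyond 1 d (Top W? 1 d) t) (before (top-size W? 1 d) t)
    card-beyond-top₁ d zero = card-∅ (beyond-∅ (ℕ.s≤s ℕ.z≤n))
    card-beyond-top₁ d (suc t) = card-beyond
      (λ (_ , k) b eq → top-beyond-disjoint 1 (cone-resp eq k) b) (card-top W? 1 d t) (card-beyond-top₁ d t)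

    module _ (a b : Fin M) where

      private
        d = e a b

        split : ∀ {t p} → Cone (W ▸ (a , b)) t p → ∃ λ n → ∃ λ s → ∃ λ q → Cone W s q × t ≡ n ℕ.* 1 ℕ.+ s × p ≈ q ⊕ n ⊛ d
        split (nil {p} p≈0) = 0 , 0 , p , nil p≈0 , refl , λ c → lem (p c) (d c)
          where
          lem : ∀ a b → a ≡ a + 0ℤ * b
          lem = solve-∀
        split (add {i = i} {j} {q = r} (inj₁ w) k p≈) with split k
        ... | n , s , q , kq , refl , eq = n , suc s , q ⊕ e i j , cone-snoc kq w , sym (ℕ.+-suc (n ℕ.* 1) s) ,
          λ c → trans (p≈ c) (trans (cong (_+ e i j c) (eq c)) (lem (q c) (d c) (+ n) (e i j c)))
          where
          lem : ∀ a b n x → a + n * b + x ≡ a + x + n * b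
          lem = solve-∀
        split (add (inj₂ (refl , refl)) k p≈) with split k
        ... | n , s , q , kq , refl , eq = suc n , s , q , kq , refl ,
          λ c → trans (p≈ c) (trans (cong (_+ d c) (eq c)) (lem (q c) (d c) (+ n)))
          where
          lem : ∀ a b n → a + n * b + b ≡ a + (1ℤ + n) * b
          lem = solve-∀

      -- A point that needs the new edge lies on a line in direction e a b above exactly one last
      -- point of the old semigroup, at some lower level. Summation over that level gives `before`.
      size-▸ : ∀ t → size (▸? W? a b) t ≡ size W? t ℕ.+ before (top-size W? 1 d) t
      size-▸ t = card-unique (card-cone (▸? W? a b) t)
        (card-⇔ from to (card-∪ (λ k b eq → top-beyond-disjoint 1 (cone-resp eq k) b) (card-cone W? t) (card-beyond-top₁ d t)))
        where
        transport : ∀ {t p q} → q ≈ p → Cone W t p ⊎ Beyond 1 d (Top W? 1 d) t p → Cone W t q ⊎ Beyond 1 d (Top W? 1 d) t q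
        transport eq (inj₁ k) = inj₁ (cone-resp (≈-sym eq) k)
        transport eq (inj₂ (beyond h x eq′)) = inj₂ (beyond h x (≈-trans eq′ (≈-sym eq)))
        to : ∀ {p} → Cone (W ▸ (a , b)) t p → Cone W t p ⊎ Beyond 1 d (Top W? 1 d) t p
        to k with split k
        ... | n , s , q , kq , refl , eq = transport eq (climb 1 n kq)
        from : ∀ {t p} → Cone W t p ⊎ Beyond 1 d (Top W? 1 d) t p → Cone (W ▸ (a , b)) t p
        from (inj₁ k) = cone-mono inj₁ k
        from (inj₂ y) with beyond⇒ y
        ... | j , s , q , (_ , kq) , refl , eq =
          cone-cast (trans (ℕ.+-comm s _) (cong (ℕ._+ s) refl)) (≈-sym eq)
            (cone-⊕ (cone-mono inj₁ kq) (cone-⊛ (suc j) (cone-edge (inj₂ (refl , refl)))))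

  Fan : ∀ {M} → Edges M → Fin M → Fin M → Fin M → Edges M
  Fan D n p q = D ▸ (n , p) ▸ (n , q)

  fan? : ∀ {M} {D : Edges M} → Decidable D → ∀ n p q → Decidable (Fan D n p q)
  fan? D? n p q = ▸? (▸? D? n p) n q

  module FanSize {M} {D : Edges M} (D? : Decidable D) (n p q : Fin M) (iso : ∀ j → ¬ D n j) where

    -- It has degree 0: the left coordinates cancel, and one unit moves from the right vertex q to
    -- the right vertex p. Its last points are the bases that cannot trade np for nq.
    shift : Point M
    shift = e n p ⊖ e n q

    F : Edges M
    F = Fan D n p q

    private
      np = e n p
      nq = e n q

      at-n : ∀ j → e {M} n j (inj₁ n) ≡ 1ℤ
      at-n j = cong +_ (δ-refl n)

      B : ℕ → Point M → Set
      B = Beyond 1 np (Top D? 0 shift)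

      split : ∀ {t r} → Cone F t r → ∃ λ a → ∃ λ b → ∃ λ s → ∃ λ k →
              Cone D s k × t ≡ a ℕ.+ b ℕ.+ s × r ≈ k ⊕ a ⊛ np ⊕ b ⊛ nq
      split (nil {r} r≈0) = 0 , 0 , 0 , r , nil r≈0 , refl , λ c → lem (r c) (np c) (nq c)
        where
        lem : ∀ x y z → x ≡ x + 0ℤ * y + 0ℤ * z
        lem = solve-∀
      split (add {i = i} {j} (inj₁ (inj₁ w)) κ r≈) with split κ
      ... | a , b , s , k , kk , refl , eq = a , b , suc s , k ⊕ e i j , cone-snoc kk w , sym (ℕ.+-suc (a ℕ.+ b) s) ,
        λ c → trans (r≈ c) (trans (cong (_+ e i j c) (eq c)) (lem (k c) (np c) (nq c) (+ a) (+ b) (e i j c)))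
        where
        lem : ∀ x y z a b w → x + a * y + b * z + w ≡ x + w + a * y + b * z
        lem = solve-∀
      split (add (inj₁ (inj₂ (refl , refl))) κ r≈) with split κ
      ... | a , b , s , k , kk , refl , eq = suc a , b , s , k , kk , refl ,
        λ c → trans (r≈ c) (trans (cong (_+ np c) (eq c)) (lem (k c) (np c) (nq c) (+ a) (+ b)))
        where
        lem : ∀ x y z a b → x + a * y + b * z + y ≡ x + (1ℤ + a) * y + b * z
        lem = solve-∀
      split (add (inj₂ (refl , refl)) κ r≈) with split κ
      ... | a , b , s , k , kk , refl , eq = a , suc b , s , k , kk , cong (ℕ._+ s) (sym (ℕ.+-suc a b)) ,
        λ c → trans (r≈ c) (trans (cong (_+ nq c) (eq c)) (lem (k c) (np c) (nq c) (+ a) (+ b)))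
        where
        lem : ∀ x y z a b → x + a * y + b * z + z ≡ x + a * y + (1ℤ + b) * z
        lem = solve-∀

      unsplit : ∀ a b {s k} → Cone D s k → Cone F (a ℕ.+ b ℕ.+ s) (k ⊕ a ⊛ np ⊕ b ⊛ nq)
      unsplit a b {s} {k} kk = cone-cast (deg a b s) (λ _ → refl)
        (cone-⊕ (cone-⊕ (cone-mono (inj₁ ∘ inj₁) kk) (cone-⊛ a (cone-edge (inj₁ (inj₂ (refl , refl))))))
                (cone-⊛ b (cone-edge (inj₂ (refl , refl)))))
        where
        deg : ∀ a b s → s ℕ.+ a ℕ.* 1 ℕ.+ b ℕ.* 1 ≡ a ℕ.+ b ℕ.+ s
        deg = ℕ-Solver.solve-∀

      cone-at-n : ∀ {t k} → Cone D t k → k (inj₁ n) ≡ 0ℤ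
      cone-at-n = left-isolated iso

      beyond-at-n : ∀ {t r} → (b : B t r) → r (inj₁ n) ≡ + suc (proj₁ (beyond⇒ b))
      beyond-at-n b with beyond⇒ b
      ... | j , s , k , (_ , kk) , refl , eq = trans (eq (inj₁ n))
        (trans (cong₂ (λ x y → x + + suc j * y) (cone-at-n kk) (at-n p)) (trans (ℤ.+-identityˡ (+ suc j * 1ℤ)) (ℤ.*-identityʳ (+ suc j))))

      card-B : ∀ t → Card (B t) (before (top-size D? 0 shift) t)
      card-B zero = card-∅ (beyond-∅ (ℕ.s≤s ℕ.z≤n))
      card-B (suc t) = card-beyond disj (card-top D? 0 shift t) (card-B t)
        where
        disj : Disjoint (Top D? 0 shift t) (B t)
        disj (_ , k) b eq with trans (sym (cone-at-n k)) (trans (eq (inj₁ n)) (beyond-at-n b))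
        ... | ()

      image-not-cone : ∀ {t} → Disjoint (Image (_⊕ nq) (Cone F t)) (Cone D (suc t))
      image-not-cone (k , kk , eq) kd eq′ = +suc≢0 {∣ k (inj₁ n) ∣} {0} (begin
        + ∣ k (inj₁ n) ∣ + 1ℤ     ≡⟨ cong₂ _+_ (cone-nonneg kk (inj₁ n)) (at-n q) ⟨
        k (inj₁ n) + nq (inj₁ n)  ≡⟨ trans (eq (inj₁ n)) (eq′ (inj₁ n)) ⟩
        _                         ≡⟨ cone-at-n kd ⟩
        0ℤ ∎)
        where open ≡-Reasoning

      cone-not-beyond : ∀ {t} → Disjoint (Cone D t) (B t)
      cone-not-beyond k b eq with trans (sym (cone-at-n k)) (trans (eq (inj₁ n)) (beyond-at-n b))
      ... | ()

      -- The coordinate at the left vertex n forces a + b = j. What remains is k = k′ + (b + 1)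
      -- `shift`, and `ray` in degree 0 contradicts that k′ is last.
      image-not-beyond : ∀ {t} → Disjoint (Image (_⊕ nq) (Cone F t)) (B (suc t))
      image-not-beyond (r , κ , eq) y eq′ with split κ | beyond⇒ y
      ... | a , b , s , k , kk , refl , eqr | j , s′ , k′ , (¬k , kk′) , deg , eqk =
        ¬k (ray D? 0 b kk′ (cone-cast s≡ (λ c → k≈ c) kk))
        where
        total : ∀ c → k c + + a * np c + + b * nq c + nq c ≡ k′ c + + suc j * np c
        total c = trans (cong (_+ nq c) (sym (eqr c))) (trans (eq c) (trans (eq′ c) (eqk c)))
        j≡ : a ℕ.+ b ≡ j
        j≡ = ℕ.suc-injective (+-injective (eval (cone-at-n kk) (cone-at-n kk′) (at-n p) (at-n q) (total (inj₁ n))))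
          where
          lhs : ∀ a b → 1ℤ + (a + b) ≡ 0ℤ + a * 1ℤ + b * 1ℤ + 1ℤ
          lhs = solve-∀
          rhs : ∀ j → 0ℤ + j * 1ℤ ≡ j
          rhs = solve-∀
          eval : ∀ {x x′ y z} → x ≡ 0ℤ → x′ ≡ 0ℤ → y ≡ 1ℤ → z ≡ 1ℤ →
                 x + + a * y + + b * z + z ≡ x′ + + suc j * y → + suc (a ℕ.+ b) ≡ + suc j
          eval refl refl refl refl h = trans (lhs (+ a) (+ b)) (trans h (rhs (+ suc j)))
        s≡ : s ≡ suc b ℕ.* 0 ℕ.+ s′
        s≡ = trans (ℕ.+-cancelˡ-≡ (suc (a ℕ.+ b)) s s′ (trans deg (cong (ℕ._+ s′) (trans (ℕ.*-identityʳ (suc j)) (cong suc (sym j≡))))))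
                   (cong (ℕ._+ s′) (sym (ℕ.*-zeroʳ (suc b))))
        k≈ : ∀ c → k c ≡ k′ c + + suc b * (np c - nq c)
        k≈ c = lin₁ (trans (total c) (cong (λ m → k′ c + + suc m * np c) (sym j≡))) (lem (k c) (k′ c) (np c) (nq c) (+ a) (+ b))
          where
          lem : ∀ k k′ x y a b → k + (k′ + (1ℤ + (a + b)) * x) ≡ k′ + (1ℤ + b) * (x - y) + (k + a * x + b * y + y)
          lem = solve-∀

    -- A point of the fan either uses nq, or n only sees p; in the latter case np can be traded for nq unless the base is maximal.
    fan-suc : ∀ t → size (fan? D? n p q) (suc t) ≡
              size (fan? D? n p q) t ℕ.+ (size D? (suc t) ℕ.+ before (top-size D? 0 shift) (suc t))
    fan-suc t = card-unique (card-cone (fan? D? n p q) (suc t))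
      (card-⇔ from to (card-∪ disj (card-image (_⊕ nq) (λ eq → ⊕-cong eq (λ _ → refl)) (λ _ _ → ⊕-cancelʳ nq) (card-cone (fan? D? n p q) t))
                                   (card-∪ cone-not-beyond (card-cone D? (suc t)) (card-B (suc t)))))
      where
      disj : Disjoint (Image (_⊕ nq) (Cone F t)) (Cone D (suc t) ∪ B (suc t))
      disj x (inj₁ k) = image-not-cone x k
      disj x (inj₂ b) = image-not-beyond x b
      from : ∀ {r} → (Image (_⊕ nq) (Cone F t) ∪ (Cone D (suc t) ∪ B (suc t))) r → Cone F (suc t) r
      from (inj₁ (k , kk , eq)) = cone-resp eq (cone-snoc kk (inj₂ (refl , refl)))
      from (inj₂ (inj₁ k)) = cone-mono (inj₁ ∘ inj₁) k
      from (inj₂ (inj₂ b)) with beyond⇒ b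
      ... | j , s , k , (_ , kk) , deg , eq = cone-cast (sym (trans deg (cong (ℕ._+ s) (lem j))))
          (λ c → trans (lem′ (k c) (np c) (nq c) (+ suc j)) (sym (eq c))) (unsplit (suc j) 0 kk)
        where
        lem : ∀ j → suc j ℕ.* 1 ≡ suc j ℕ.+ 0
        lem = ℕ-Solver.solve-∀
        lem′ : ∀ k x y j → k + j * x + 0ℤ * y ≡ k + j * x
        lem′ = solve-∀
      to : ∀ {r} → Cone F (suc t) r → (Image (_⊕ nq) (Cone F t) ∪ (Cone D (suc t) ∪ B (suc t))) r
      to {r} κ with split κ
      ... | a , suc b , s , k , kk , deg , eq = inj₁ (k ⊕ a ⊛ np ⊕ b ⊛ nq ,
          cone-cast (sym (ℕ.suc-injective (trans deg (cong (ℕ._+ s) (ℕ.+-suc a b))))) (λ _ → refl) (unsplit a b kk) ,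
          λ c → trans (lem (k c) (np c) (nq c) (+ a) (+ b)) (sym (eq c)))
        where
        lem : ∀ k x y a b → k + a * x + b * y + y ≡ k + a * x + (1ℤ + b) * y
        lem = solve-∀
      ... | zero , zero , s , k , kk , refl , eq =
          inj₂ (inj₁ (cone-resp (λ c → trans (lem (k c) (np c) (nq c)) (sym (eq c))) kk))
        where
        lem : ∀ k x y → k ≡ k + 0ℤ * x + 0ℤ * y
        lem = solve-∀
      ... | suc a , zero , s , k , kk , deg , eq with cone? D? (0 ℕ.+ s) (k ⊕ shift)
      ...   | yes kk′ = inj₁ (k ⊕ shift ⊕ a ⊛ np ⊕ 0 ⊛ nq ,
          cone-cast (sym (ℕ.suc-injective deg)) (λ _ → refl) (unsplit a 0 kk′) ,
          λ c → trans (lem (k c) (np c) (nq c) (+ a)) (sym (eq c)))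
        where
        lem : ∀ k x y a → k + (x - y) + a * x + 0ℤ * y + y ≡ k + (1ℤ + a) * x + 0ℤ * y
        lem = solve-∀
      ...   | no ¬k = inj₂ (inj₂ (subst (λ t → B t r) (sym (trans deg (cong (ℕ._+ s) (lem a))))
          (⇒beyond a (¬k , kk) (λ c → trans (eq c) (lem′ (k c) (np c) (nq c) (+ suc a))))))
        where
        lem : ∀ a → suc a ℕ.+ 0 ≡ suc a ℕ.* 1
        lem = ℕ-Solver.solve-∀
        lem′ : ∀ k x y a → k + a * x + 0ℤ * y ≡ k + a * x
        lem′ = solve-∀

    fan-zero : size (fan? D? n p q) 0 ≡ size D? 0
    fan-zero = card-unique (card-cone (fan? D? n p q) 0) (card-⇔ (cone-mono (inj₁ ∘ inj₁)) (λ { (nil p≈0) → nil p≈0 }) (card-cone D? 0))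

-- Identification of two right vertices, and transposition

module Merging where

  open import Data.Nat.Base as ℕ using (ℕ; zero; suc)
  import Data.Nat.Properties as ℕ
  open import Data.Integer.Base using (+_; 0ℤ; 1ℤ; -1ℤ; _+_; _-_; _*_; ∣_∣)
  open import Data.Integer.Tactic.RingSolver using (solve-∀)
  open import Data.Fin.Base using (Fin)
  open import Data.Fin.Properties using (_≟_)
  open import Data.Product.Base using (∃; _×_; _,_; proj₂)
  open import Data.Sum.Base as Sum using (inj₁; inj₂)
  open import Data.Bool.Base using (if_then_else_)
  open import Function.Base using (_∘_)
  open import Relation.Binary.PropositionalEquality
  open import Relation.Binary.Definitions using (Decidable)
  open import Relation.Nullary
  open Flows
  open Cones
  open Counting
  open Sequences
  open Fans

  redirect : ∀ {M} → Fin M → Fin M → Fin M → Fin M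
  redirect p q j = if does (j ≟ p) then q else j

  redirect-self : ∀ {M} (p q : Fin M) → redirect p q p ≡ q
  redirect-self p q with p ≟ p
  ... | yes _ = refl
  ... | no p≢p = contradiction refl p≢p

  redirect-other : ∀ {M} (p q : Fin M) {j} → j ≢ p → redirect p q j ≡ j
  redirect-other p q {j} j≢p with j ≟ p
  ... | yes j≡p = contradiction j≡p j≢p
  ... | no _ = refl

  Merged : ∀ {M} → Edges M → Fin M → Fin M → Edges M
  Merged D p q i j = ∃ λ j′ → D i j′ × redirect p q j′ ≡ j

  module _ {M} (n p q : Fin M) (p≢q : p ≢ q) where

    open Hom

    private
      s : Point M
      s = e n p ⊖ e n q

    -- The left coordinates of `s` cancel, so subtracting r(p) times `s` transfers the whole weight
    -- of the right vertex p to q. As a linear map its fibres run in direction `s`.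
    merge : Hom M M
    merge .⟦_⟧ r c = r c - r (inj₂ p) * s c
    merge .cong-≈ eq c = cong₂ (λ x y → x - y * s c) (eq c) (eq (inj₂ p))
    merge .homo-𝟎 c = lem (s c)
      where
      lem : ∀ x → 0ℤ - 0ℤ * x ≡ 0ℤ
      lem = solve-∀
    merge .homo-⊕ r r′ c = lem (r c) (r′ c) (r (inj₂ p)) (r′ (inj₂ p)) (s c)
      where
      lem : ∀ a b x y z → a + b - (x + y) * z ≡ a - x * z + (b - y * z)
      lem = solve-∀

    merge-e : ∀ i j → ⟦ merge ⟧ (e i j) ≈ e i (redirect p q j)
    merge-e i j c with j ≟ p
    merge-e i j (inj₁ a) | no j≢p = lem (+ δ i a) (s (inj₁ a))
      where
      lem : ∀ x y → x - 0ℤ * y ≡ x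
      lem = solve-∀
    merge-e i j (inj₂ b) | no j≢p = lem (+ δ j b) (s (inj₂ b))
      where
      lem : ∀ x y → x - 0ℤ * y ≡ x
      lem = solve-∀
    merge-e i j (inj₁ a) | yes refl = lem (+ δ i a) (+ δ n a)
      where
      lem : ∀ x y → x - 1ℤ * (y - y) ≡ x
      lem = solve-∀
    merge-e i j (inj₂ b) | yes refl = lem (+ δ p b) (+ δ q b)
      where
      lem : ∀ x y → x - 1ℤ * (x - y) ≡ y
      lem = solve-∀

    module _ {D : Edges M} (D? : Decidable D) where

      private
        -- Every point has a last point in its fibre: each step by `s` keeps the image and lowers
        -- the coordinate at the right vertex q, which cannot become negative. Its value m bounds
        -- the walk.
        ascend : ∀ m {t r} → Cone D t r → r (inj₂ q) ≡ + m → ∃ λ r′ → Top D? 0 s t r′ × ⟦ merge ⟧ r′ ≈ ⟦ merge ⟧ r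
        ascend m {t} {r} k eq with cone? D? (0 ℕ.+ t) (r ⊕ s)
        ... | no ¬k = r , (¬k , k) , λ _ → refl
        ... | yes k′ = descend m eq
          where
          s-p : s (inj₂ p) ≡ 1ℤ
          s-p = cong₂ (λ x y → + x - + y) (δ-refl p) (ind-no (q ≟ p) (p≢q ∘ sym))
          s-q : s (inj₂ q) ≡ -1ℤ
          s-q = cong₂ (λ x y → + x - + y) (ind-no (p ≟ q) p≢q) (δ-refl q)
          descend : ∀ m → r (inj₂ q) ≡ + m → ∃ λ r′ → Top D? 0 s t r′ × ⟦ merge ⟧ r′ ≈ ⟦ merge ⟧ r
          descend zero eq with trans (sym (cong₂ _+_ eq s-q)) (cone-nonneg k′ (inj₂ q))
          ... | ()
          descend (suc m) eq with ascend m k′ (cong₂ _+_ eq s-q)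
          ... | r′ , top , eq′ = r′ , top , λ c → trans (eq′ c)
              (trans (cong (λ z → r c + s c - (r (inj₂ p) + z) * s c) s-p) (lem (r c) (s c) (r (inj₂ p))))
            where
            lem : ∀ a z x → a + z - (x + 1ℤ) * z ≡ a - x * z
            lem = solve-∀

        -- Points with the same image differ by a multiple of `s`, namely the difference k of their
        -- coordinates at p. For k > 0 the second point would lie further along the ray, against the
        -- first being last.
        level : ∀ {t r r′} → Top D? 0 s t r → Cone D t r′ → ⟦ merge ⟧ r ≈ ⟦ merge ⟧ r′ →
                ∀ {a} k → r (inj₂ p) ≡ + a → r′ (inj₂ p) ≡ + (k ℕ.+ a) → r ≈ r′
        level {t} {r} {r′} (¬k , k) k′ eq {a} m ra r′a = same m r′a
          where
          gap : ∀ m → r′ (inj₂ p) ≡ + m + + a → ∀ c → r′ c ≡ r c + + m * s c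
          gap m r′a c = lin₁ (sym (eq c)) (eval ra r′a)
            where
            lem : ∀ r r′ z m a → r′ + (r - a * z) ≡ r + m * z + (r′ - (m + a) * z)
            lem = solve-∀
            eval : ∀ {x y} → x ≡ + a → y ≡ + m + + a → r′ c + (r c - x * s c) ≡ r c + + m * s c + (r′ c - y * s c)
            eval refl refl = lem (r c) (r′ c) (s c) (+ m) (+ a)
          same : ∀ m → r′ (inj₂ p) ≡ + (m ℕ.+ a) → r ≈ r′
          same zero r′a c = trans (lem (r c) (s c)) (sym (gap zero r′a c))
            where
            lem : ∀ x z → x ≡ x + 0ℤ * z
            lem = solve-∀
          same (suc m) r′a = contradiction (ray D? 0 m k (cone-cast (cong (ℕ._+ t) (sym (ℕ.*-zeroʳ (suc m)))) (gap (suc m) r′a) k′)) ¬k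

        merge-top-injective : ∀ {t r r′} → Top D? 0 s t r → Top D? 0 s t r′ → ⟦ merge ⟧ r ≈ ⟦ merge ⟧ r′ → r ≈ r′
        merge-top-injective {r = r} {r′} top top′ eq with ℕ.≤-total ∣ r (inj₂ p) ∣ ∣ r′ (inj₂ p) ∣
        ... | inj₁ le = level top (proj₂ top′) eq (∣ r′ (inj₂ p) ∣ ℕ.∸ ∣ r (inj₂ p) ∣) (cone-nonneg (proj₂ top) (inj₂ p))
                          (trans (cone-nonneg (proj₂ top′) (inj₂ p)) (cong +_ (sym (ℕ.m∸n+n≡m le))))
        ... | inj₂ le = ≈-sym (level top′ (proj₂ top) (≈-sym eq) (∣ r (inj₂ p) ∣ ℕ.∸ ∣ r′ (inj₂ p) ∣) (cone-nonneg (proj₂ top′) (inj₂ p))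
                          (trans (cone-nonneg (proj₂ top) (inj₂ p)) (cong +_ (sym (ℕ.m∸n+n≡m le)))))

      -- Each fibre of `merge` inside the semigroup is a segment in direction `s` with exactly one
      -- last point. This expresses the number of last points as the count of another graph.
      card-merged : ∀ t → Card (Cone (Merged D p q) t) (top-size D? 0 s t)
      card-merged t = card-⇔ to from (card-image ⟦ merge ⟧ (cong-≈ merge) merge-top-injective (card-top D? 0 s t))
        where
        to : ∀ {r} → Image ⟦ merge ⟧ (Top D? 0 s t) r → Cone (Merged D p q) t r
        to (r , (_ , k) , eq) = cone-resp eq (cone-image merge (λ {i} {j} w → i , redirect p q j , (j , w , refl) , merge-e i j) k)
        from : ∀ {r} → Cone (Merged D p q) t r → Image ⟦ merge ⟧ (Top D? 0 s t) r
        from κ with cone-preimage merge (λ { {i} (j , w , refl) → i , j , w , merge-e i j }) κ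
        ... | r , k , eq with ascend ∣ r (inj₂ q) ∣ k (cone-nonneg k (inj₂ q))
        ...   | r′ , top , eq′ = r′ , top , ≈-trans eq′ eq

  transpose : ∀ {M} → Hom M M
  transpose .Hom.⟦_⟧ r = r ∘ Sum.swap
  transpose .Hom.cong-≈ eq = eq ∘ Sum.swap
  transpose .Hom.homo-𝟎 _ = refl
  transpose .Hom.homo-⊕ _ _ _ = refl

  swap-swap : ∀ {M} (r : Point M) → (r ∘ Sum.swap) ∘ Sum.swap ≈ r
  swap-swap r (inj₁ _) = refl
  swap-swap r (inj₂ _) = refl

  transpose-e : ∀ {M} (i j : Fin M) → e i j ∘ Sum.swap ≈ e j i
  transpose-e i j (inj₁ _) = refl
  transpose-e i j (inj₂ _) = refl

  cone-transpose : ∀ {M} {W W′ : Edges M} → (∀ {i j} → W i j → W′ j i) → ∀ {t r} → Cone W t r → Cone W′ t (r ∘ Sum.swap)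
  cone-transpose f = cone-image transpose (λ {i} {j} w → j , i , f w , transpose-e i j)

  size-transpose : ∀ {M} {W W′ : Edges M} (W? : Decidable W) (W′? : Decidable W′) →
                   (∀ {i j} → W i j → W′ j i) → (∀ {i j} → W′ i j → W j i) → ∀ t → size W? t ≡ size W′? t
  size-transpose W? W′? f g t = ℕ.≤-antisym
    (card-≤ (_∘ Sum.swap) (cone-transpose f) (λ {r} {r′} → inj {r} {r′}) (card-cone W? t) (card-cone W′? t))
    (card-≤ (_∘ Sum.swap) (cone-transpose g) (λ {r} {r′} → inj {r} {r′}) (card-cone W′? t) (card-cone W? t))
    where
    inj : ∀ {r r′ : Point _} → r ∘ Sum.swap ≈ r′ ∘ Sum.swap → r ≈ r′
    inj eq (inj₁ i) = eq (inj₂ i)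
    inj eq (inj₂ j) = eq (inj₁ j)

  module _ {M} {D : Edges M} (D? : Decidable D) (D-sym : ∀ {i j} → D i j → D j i) (n p q : Fin M)
           (iso : ∀ j → ¬ D n j) (n≢p : n ≢ p) (n≢q : n ≢ q) (p≢q : p ≢ q) (pp : D p p) (qq : D q q) where

    private
      D₁? = ▸? D? q p
      D₂? = ▸? D? p q

      iso₁ : ∀ j → ¬ (D ▸ (q , p)) n j
      iso₁ j (inj₁ w) = iso j w
      iso₁ j (inj₂ (n≡q , _)) = n≢q n≡q
      iso₂ : ∀ j → ¬ (D ▸ (p , q)) n j
      iso₂ j (inj₁ w) = iso j w
      iso₂ j (inj₂ (n≡p , _)) = n≢p n≡p

      base : ∀ t → size D₁? t ≡ size D₂? t
      base = size-transpose D₁? D₂?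
        (λ { (inj₁ w) → inj₁ (D-sym w) ; (inj₂ (a , b)) → inj₂ (b , a) })
        (λ { (inj₁ w) → inj₁ (D-sym w) ; (inj₂ (a , b)) → inj₂ (b , a) })

      -- After identifying p and q on the right, the extra edges coincide with qq and pp.
      tops : ∀ t → top-size D₁? 0 (e n p ⊖ e n q) t ≡ top-size D₂? 0 (e n p ⊖ e n q) t
      tops t = card-unique (card-merged n p q p≢q D₁? t) (card-⇔ (cone-mono to) (cone-mono from) (card-merged n p q p≢q D₂? t))
        where
        from : ∀ {i j} → Merged (D ▸ (q , p)) p q i j → Merged (D ▸ (p , q)) p q i j
        from (j′ , inj₁ w , eq) = j′ , inj₁ w , eq
        from (_ , inj₂ (refl , refl) , eq) = q , inj₁ qq , trans (redirect-other p q (p≢q ∘ sym)) (trans (sym (redirect-self p q)) eq)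
        to : ∀ {i j} → Merged (D ▸ (p , q)) p q i j → Merged (D ▸ (q , p)) p q i j
        to (j′ , inj₁ w , eq) = j′ , inj₁ w , eq
        to (_ , inj₂ (refl , refl) , eq) = p , inj₁ pp , trans (redirect-self p q) (trans (sym (redirect-other p q (p≢q ∘ sym))) eq)

    -- Transposition does not carry one fan to the other, since only the left copy of n is attached.
    -- But by `fan-suc` a fan count depends only on the counts of its base, which transposition does
    -- preserve, and on the last points of its base, which merging compares.
    fan-symmetric : ∀ t → size (fan? D₁? n p q) t ≡ size (fan? D₂? n p q) t
    fan-symmetric zero = trans (FanSize.fan-zero D₁? n p q iso₁) (trans (base 0) (sym (FanSize.fan-zero D₂? n p q iso₂)))
    fan-symmetric (suc t) = trans (FanSize.fan-suc D₁? n p q iso₁ t)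
      (trans (cong₂ ℕ._+_ (fan-symmetric t) (cong₂ ℕ._+_ (base (suc t)) (before-cong tops (suc t))))
             (sym (FanSize.fan-suc D₂? n p q iso₂ t)))

-- Extension of a graph by a vertex with two neighbours

module Extensions where

  open import Data.Nat.Base as ℕ using (ℕ; zero; suc)
  import Data.Nat.Properties as ℕ
  import Data.Nat.Tactic.RingSolver as ℕ-Solver
  open import Data.Integer.Base as ℤ using (ℤ; +_; 0ℤ; 1ℤ; _+_; _*_; ∣_∣)
  open import Data.Integer.Properties as ℤ using (+-injective)
  open import Data.Integer.Tactic.RingSolver using (solve-∀)
  open import Data.Fin.Base using (Fin)
  open import Data.Fin.Properties using (_≟_)
  open import Data.Product.Base using (∃; _×_; _,_; proj₁; proj₂)
  open import Data.Sum.Base as Sum using (_⊎_; inj₁; inj₂)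
  open import Function.Base using (_∘_)
  open import Relation.Binary.PropositionalEquality
  open import Relation.Binary.Definitions using (Decidable)
  open import Relation.Nullary
  open Flows
  open Cones
  open Counting
  open Sequences
  open Fans
  open Merging

  exchange : ∀ {M} (a b c d : Fin M) → e a b ⊕ e c d ≈ e a d ⊕ e c b
  exchange a b c d (inj₁ i) = refl
  exchange a b c d (inj₂ j) = ℤ.+-comm (+ δ b j) (+ δ d j)

  Ext : ∀ {M} → Edges M → Fin M → Fin M → Fin M → Edges M
  Ext D n p q = Fan D n p q ▸ (n , n) ▸ (p , n) ▸ (q , n)

  ext? : ∀ {M} {D : Edges M} → Decidable D → ∀ n p q → Decidable (Ext D n p q)
  ext? D? n p q = ▸? (▸? (▸? (fan? D? n p q) n n) p n) q n

  -- A sum of k with i copies of xy and j copies of yx may trade each pair xy + yx for xx + yy.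
  top-clash : ∀ {M} {W : Edges M} (W? : Decidable W) {x y : Fin M} → W x x → W y y →
              ∀ {s s′ k m} b i j → Cone W s k → Top W? 1 (e x y) s′ m → s ℕ.+ j ≡ suc b ℕ.+ s′ →
              ¬ k ⊕ i ⊛ e x y ⊕ j ⊛ e y x ≈ m ⊕ (suc b ℕ.+ i) ⊛ e x y
  top-clash W? {x} {y} xx yy {s} {s′} {k} {m} b i j kk (¬m , mm) deg eq =
    ¬m (ray W? 1 (b ℕ.+ j) mm (cone-cast deg′ eq′ (cone-⊕ kk (cone-⊛ j (cone-⊕ (cone-edge xx) (cone-edge yy))))))
    where
    lem : ∀ s j s′ b → s ℕ.+ j ≡ suc b ℕ.+ s′ → s ℕ.+ j ℕ.* 2 ≡ suc (b ℕ.+ j) ℕ.* 1 ℕ.+ s′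
    lem s j s′ b h = trans (l₁ s j) (trans (cong (ℕ._+ j) h) (l₂ b s′ j))
      where
      l₁ : ∀ s j → s ℕ.+ j ℕ.* 2 ≡ s ℕ.+ j ℕ.+ j
      l₁ = ℕ-Solver.solve-∀
      l₂ : ∀ b s′ j → suc b ℕ.+ s′ ℕ.+ j ≡ suc (b ℕ.+ j) ℕ.* 1 ℕ.+ s′
      l₂ = ℕ-Solver.solve-∀
    deg′ = lem s j s′ b deg
    eq′ : k ⊕ j ⊛ (e x x ⊕ e y y) ≈ m ⊕ suc (b ℕ.+ j) ⊛ e x y
    eq′ c = lin₁ (eq c) (trans (cong (λ z → k c + + j * z + (m c + (1ℤ + + b + + i) * e x y c)) (exchange x x y y c))
      (solved (k c) (m c) (e x y c) (e y x c) (+ b) (+ i) (+ j)))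
      where
      solved : ∀ k m x y b i j → k + j * (x + y) + (m + (1ℤ + b + i) * x) ≡ m + (1ℤ + (b + j)) * x + (k + i * x + j * y)
      solved = solve-∀

  module Extension {M} {D : Edges M} (D? : Decidable D) (D-sym : ∀ {i j} → D i j → D j i) (n p q : Fin M)
    (iso : ∀ j → ¬ D n j) (n≢p : n ≢ p) (n≢q : n ≢ q) (p≢q : p ≢ q) (pp : D p p) (qq : D q q) where

    F X : Edges M
    F = Fan D n p q
    X = Ext D n p q

    F? : Decidable F
    F? = fan? D? n p q
    X? : Decidable X
    X? = ext? D? n p q

    private
      -- A = qn + np and B = pn + nq, rewritten so that the right vertex n is fed by nn. The edges
      -- qp and pq in them are virtual: they need not belong to D.
      np nq nn A B : Point M
      np = e n p
      nq = e n q
      nn = e n n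
      A = e q p ⊕ nn
      B = e p q ⊕ nn

      F-np : F n p
      F-np = inj₁ (inj₂ (refl , refl))
      F-nq : F n q
      F-nq = inj₂ (refl , refl)
      F-pp : F p p
      F-pp = inj₁ (inj₁ pp)
      F-qq : F q q
      F-qq = inj₁ (inj₁ qq)
      X-F : ∀ {i j} → F i j → X i j
      X-F = inj₁ ∘ inj₁ ∘ inj₁
      X-nn : X n n
      X-nn = inj₁ (inj₁ (inj₂ (refl , refl)))
      X-pn : X p n
      X-pn = inj₁ (inj₂ (refl , refl))
      X-qn : X q n
      X-qn = inj₂ (refl , refl)

      X-sym : ∀ {i j} → X i j → X j i
      X-sym (inj₁ (inj₁ (inj₁ (inj₁ (inj₁ w))))) = X-F (inj₁ (inj₁ (D-sym w)))
      X-sym (inj₁ (inj₁ (inj₁ (inj₁ (inj₂ (refl , refl)))))) = X-pn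
      X-sym (inj₁ (inj₁ (inj₁ (inj₂ (refl , refl))))) = X-qn
      X-sym (inj₁ (inj₁ (inj₂ (refl , refl)))) = X-nn
      X-sym (inj₁ (inj₂ (refl , refl))) = X-F F-np
      X-sym (inj₂ (refl , refl)) = X-F F-nq

      nn₁ : nn (inj₁ n) ≡ 1ℤ
      nn₁ = cong +_ (δ-refl n)
      nn₂ : nn (inj₂ n) ≡ 1ℤ
      nn₂ = cong +_ (δ-refl n)
      A₁ : A (inj₁ n) ≡ 1ℤ
      A₁ = cong₂ _+_ (cong +_ (ind-no (q ≟ n) (n≢q ∘ sym))) nn₁
      A₂ : A (inj₂ n) ≡ 1ℤ
      A₂ = cong₂ _+_ (cong +_ (ind-no (p ≟ n) (n≢p ∘ sym))) nn₂
      B₁ : B (inj₁ n) ≡ 1ℤ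
      B₁ = cong₂ _+_ (cong +_ (ind-no (p ≟ n) (n≢p ∘ sym))) nn₁
      B₂ : B (inj₂ n) ≡ 1ℤ
      B₂ = cong₂ _+_ (cong +_ (ind-no (q ≟ n) (n≢q ∘ sym))) nn₂

      fan₂ : ∀ {t k} → Cone F t k → k (inj₂ n) ≡ 0ℤ
      fan₂ = right-isolated λ where
        i (inj₁ (inj₁ w)) → iso i (D-sym w)
        i (inj₁ (inj₂ (_ , n≡p))) → n≢p n≡p
        i (inj₂ (_ , n≡q)) → n≢q n≡q

      -- If the left vertex n is used at all, one of its edges can be moved to the end of the sum,
      -- where it is available for an exchange.
      data FanCases (t : ℕ) (k : Point M) : Set where
        off : Cone D t k → FanCases t k
        via : ∀ {s k′} j → j ≡ p ⊎ j ≡ q → t ≡ suc s → Cone F s k′ → k ≈ k′ ⊕ e n j → FanCases t k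

      fan-cases : ∀ {t k} → Cone F t k → FanCases t k
      fan-cases (nil k≈0) = off (nil k≈0)
      fan-cases (add (inj₂ (refl , refl)) κ eq) = via q (inj₂ refl) refl κ eq
      fan-cases (add (inj₁ (inj₂ (refl , refl))) κ eq) = via p (inj₁ refl) refl κ eq
      fan-cases (add {i = i} {j} (inj₁ (inj₁ w)) κ eq) with fan-cases κ
      ... | off k = off (add w k eq)
      ... | via {s} {k′} l h refl κ′ eq′ = via l h refl (cone-snoc κ′ (inj₁ (inj₁ w)))
              (λ c → trans (eq c) (trans (cong (_+ e i j c) (eq′ c)) (lem (k′ c) (e n l c) (e i j c))))
        where
        lem : ∀ a b c → a + b + c ≡ a + c + b
        lem = solve-∀

      -- Points of the extension with x_n ≥ y_n: the right vertex n is fed through nn only, at the price of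
      -- virtual edges qp and pq, each of which accompanies one copy of nn.
      data Z (t : ℕ) (r : Point M) : Set where
        mk : ∀ s b i j k → Cone F s k → t ≡ b ℕ.+ (i ℕ.* 2 ℕ.+ (j ℕ.* 2 ℕ.+ s)) →
             r ≈ k ⊕ b ⊛ nn ⊕ i ⊛ A ⊕ j ⊛ B → Z t r

      cone⇒Z : ∀ {t r} → Cone F t r → Z t r
      cone⇒Z {t} {r} κ = mk t 0 0 0 r κ refl (λ c → lem (r c) (nn c) (A c) (B c))
        where
        lem : ∀ r x y z → r ≡ r + 0ℤ * x + 0ℤ * y + 0ℤ * z
        lem = solve-∀

      Z-resp : ∀ {t r r′} → r ≈ r′ → Z t r → Z t r′
      Z-resp eq (mk s b i j k κ deg eq′) = mk s b i j k κ deg (≈-trans (≈-sym eq) eq′)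

      z₂ : ∀ {r} b i j {s k} → Cone F s k → r ≈ k ⊕ b ⊛ nn ⊕ i ⊛ A ⊕ j ⊛ B → r (inj₂ n) ≡ + (b ℕ.+ i ℕ.+ j)
      z₂ b i j κ eq = trans (eq (inj₂ n)) (eval (fan₂ κ) nn₂ A₂ B₂)
        where
        lem : ∀ b i j → 0ℤ + b * 1ℤ + i * 1ℤ + j * 1ℤ ≡ b + i + j
        lem = solve-∀
        eval : ∀ {x y z w} → x ≡ 0ℤ → y ≡ 1ℤ → z ≡ 1ℤ → w ≡ 1ℤ → x + + b * y + + i * z + + j * w ≡ + (b ℕ.+ i ℕ.+ j)
        eval refl refl refl refl = lem (+ b) (+ i) (+ j)

      z₁ : ∀ {r} b i j {s k} → Cone F s k → r ≈ k ⊕ b ⊛ nn ⊕ i ⊛ A ⊕ j ⊛ B →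
           r (inj₁ n) ≡ + ∣ k (inj₁ n) ∣ + + (b ℕ.+ i ℕ.+ j)
      z₁ b i j κ eq = trans (eq (inj₁ n)) (eval (cone-nonneg κ (inj₁ n)) nn₁ A₁ B₁)
        where
        lem : ∀ x b i j → x + b * 1ℤ + i * 1ℤ + j * 1ℤ ≡ x + (b + i + j)
        lem = solve-∀
        eval : ∀ {x x′ y z w} → x ≡ x′ → y ≡ 1ℤ → z ≡ 1ℤ → w ≡ 1ℤ → x + + b * y + + i * z + + j * w ≡ x′ + + (b ℕ.+ i ℕ.+ j)
        eval {x} refl refl refl refl = lem x (+ b) (+ i) (+ j)

      coneA : Cone X 2 A
      coneA = cone-resp (exchange q n n p) (cone-⊕ (cone-edge X-qn) (cone-edge (X-F F-np)))
      coneB : Cone X 2 B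
      coneB = cone-resp (exchange p n n q) (cone-⊕ (cone-edge X-pn) (cone-edge (X-F F-nq)))

      Half : ℕ → Point M → Set
      Half t r = r (inj₂ n) ℤ.≤ r (inj₁ n) × Cone X t r

      Z⇒Half : ∀ {t r} → Z t r → Half t r
      Z⇒Half (mk s b i j k κ deg eq) = subst₂ ℤ._≤_ (sym (z₂ b i j κ eq)) (sym (z₁ b i j κ eq)) (ℤ.+≤+ (ℕ.m≤n+m (b ℕ.+ i ℕ.+ j) ∣ k (inj₁ n) ∣)) ,
        cone-cast (trans (lem s b i j) (sym deg)) (≈-sym eq)
          (cone-⊕ (cone-⊕ (cone-⊕ (cone-mono X-F κ) (cone-⊛ b (cone-edge X-nn))) (cone-⊛ i coneA)) (cone-⊛ j coneB))
        where
        lem : ∀ s b i j → s ℕ.+ b ℕ.* 1 ℕ.+ i ℕ.* 2 ℕ.+ j ℕ.* 2 ≡ b ℕ.+ (i ℕ.* 2 ℕ.+ (j ℕ.* 2 ℕ.+ s))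
        lem = ℕ-Solver.solve-∀

      -- When the base does not touch n, the coordinates at the left and the right vertex n agree.
      -- Transposition then only interchanges A and B, since D and nn are symmetric.
      balanced-swap : ∀ {t r} b i j {s k} → Cone D s k → t ≡ b ℕ.+ (i ℕ.* 2 ℕ.+ (j ℕ.* 2 ℕ.+ s)) →
                      r ≈ k ⊕ b ⊛ nn ⊕ i ⊛ A ⊕ j ⊛ B → Z t (r ∘ Sum.swap)
      balanced-swap {r = r} b i j {s} {k} κ deg eq = mk s b j i (k ∘ Sum.swap) (cone-mono (inj₁ ∘ inj₁) (cone-transpose D-sym κ))
        (trans deg (lem s b i j))
        (λ c → trans (eq (Sum.swap c)) (eval c (transpose-e n n c) (transpose-e q p c) (transpose-e p q c)))
        where
        lem : ∀ s b i j → b ℕ.+ (i ℕ.* 2 ℕ.+ (j ℕ.* 2 ℕ.+ s)) ≡ b ℕ.+ (j ℕ.* 2 ℕ.+ (i ℕ.* 2 ℕ.+ s))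
        lem = ℕ-Solver.solve-∀
        lem′ : ∀ k b x i y j z → k + b * x + i * (y + x) + j * (z + x) ≡ k + b * x + j * (z + x) + i * (y + x)
        lem′ = solve-∀
        eval : ∀ c {x y z} → x ≡ nn c → y ≡ e p q c → z ≡ e q p c →
               k (Sum.swap c) + + b * x + + i * (y + x) + + j * (z + x) ≡ k (Sum.swap c) + + b * nn c + + j * A c + + i * B c
        eval c refl refl refl = lem′ (k (Sum.swap c)) (+ b) (nn c) (+ i) (e p q c) (+ j) (e q p c)

      Z-edge : ∀ {t r a c} → F a c → Z t r → Z (suc t) (r ⊕ e a c)
      Z-edge {r = r} {a} {c} w (mk s b i j k κ refl eq) = mk (suc s) b i j (k ⊕ e a c) (cone-snoc κ w) (deg b i j s)
        (λ x → trans (cong (_+ e a c x) (eq x)) (lem (k x) (e a c x) (+ b * nn x) (+ i * A x) (+ j * B x)))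
        where
        deg : ∀ b i j s → suc (b ℕ.+ (i ℕ.* 2 ℕ.+ (j ℕ.* 2 ℕ.+ s))) ≡ b ℕ.+ (i ℕ.* 2 ℕ.+ (j ℕ.* 2 ℕ.+ suc s))
        deg = ℕ-Solver.solve-∀
        lem : ∀ k y u v w → k + u + v + w + y ≡ k + y + u + v + w
        lem = solve-∀

      Z-nn : ∀ {t r} → Z t r → Z (suc t) (r ⊕ nn)
      Z-nn (mk s b i j k κ refl eq) = mk s (suc b) i j k κ refl
        (λ x → trans (cong (_+ nn x) (eq x)) (lem (k x) (nn x) (+ b) (+ i * A x) (+ j * B x)))
        where
        lem : ∀ k y b v w → k + b * y + v + w + y ≡ k + (1ℤ + b) * y + v + w
        lem = solve-∀

      Z-A : ∀ {t r} → Z t r → Z (suc (suc t)) (r ⊕ A)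
      Z-A (mk s b i j k κ refl eq) = mk s b (suc i) j k κ (deg b i j s)
        (λ x → trans (cong (_+ A x) (eq x)) (lem (k x) (+ b * nn x) (A x) (+ i) (+ j * B x)))
        where
        deg : ∀ b i j s → suc (suc (b ℕ.+ (i ℕ.* 2 ℕ.+ (j ℕ.* 2 ℕ.+ s)))) ≡ b ℕ.+ (suc i ℕ.* 2 ℕ.+ (j ℕ.* 2 ℕ.+ s))
        deg = ℕ-Solver.solve-∀
        lem : ∀ k u y i w → k + u + i * y + w + y ≡ k + u + (1ℤ + i) * y + w
        lem = solve-∀

      Z-B : ∀ {t r} → Z t r → Z (suc (suc t)) (r ⊕ B)
      Z-B (mk s b i j k κ refl eq) = mk s b i (suc j) k κ (deg b i j s)
        (λ x → trans (cong (_+ B x) (eq x)) (lem (k x) (+ b * nn x) (+ i * A x) (+ j) (B x)))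
        where
        deg : ∀ b i j s → suc (suc (b ℕ.+ (i ℕ.* 2 ℕ.+ (j ℕ.* 2 ℕ.+ s)))) ≡ b ℕ.+ (i ℕ.* 2 ℕ.+ (suc j ℕ.* 2 ℕ.+ s))
        deg = ℕ-Solver.solve-∀
        lem : ∀ k u v j y → k + u + v + j * y + y ≡ k + u + v + (1ℤ + j) * y
        lem = solve-∀

      Z-cast : ∀ {t t′ r} → t ≡ t′ → Z t r → Z t′ r
      Z-cast refl z = z

      -- An edge into the right vertex n is exchanged against an edge out of the left vertex n.
      Z-in : ∀ {t r a} → (Z t (r ∘ Sum.swap) → Z (suc t) ((r ⊕ e a n) ∘ Sum.swap)) →
             (∀ {t r} → Z t r → Z (suc (suc t)) (r ⊕ (e a p ⊕ nn))) →
             (∀ {t r} → Z t r → Z (suc (suc t)) (r ⊕ (e a q ⊕ nn))) →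
             Z t r → Z (suc t) (r ⊕ e a n) ⊎ Z (suc t) ((r ⊕ e a n) ∘ Sum.swap)
      Z-in {r = r} {a} flip addp addq (mk s b i j k κ refl eq) with fan-cases κ
      ... | off κ′ = inj₂ (flip (balanced-swap b i j κ′ refl eq))
      ... | via {s′} {k′} l l≡ refl κ′ eq′ = inj₁ (Z-resp resum (Z-cast (deg b i j s′) (add-any l≡ (mk s′ b i j k′ κ′ refl (λ _ → refl)))))
        where
        add-any : l ≡ p ⊎ l ≡ q → ∀ {t r} → Z t r → Z (suc (suc t)) (r ⊕ (e a l ⊕ nn))
        add-any (inj₁ refl) = addp
        add-any (inj₂ refl) = addq
        deg : ∀ b i j s → suc (suc (b ℕ.+ (i ℕ.* 2 ℕ.+ (j ℕ.* 2 ℕ.+ s)))) ≡ suc (b ℕ.+ (i ℕ.* 2 ℕ.+ (j ℕ.* 2 ℕ.+ suc s)))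
        deg = ℕ-Solver.solve-∀
        resum : k′ ⊕ b ⊛ nn ⊕ i ⊛ A ⊕ j ⊛ B ⊕ (e a l ⊕ nn) ≈ r ⊕ e a n
        resum c = lin₁ (exchange a l n n c) (begin
          k′ c + u + v + w + (e a l c + nn c) + (e a n c + e n l c)                ≡⟨ solved (k′ c) u v w (e a l c + nn c) (e a n c) (e n l c) ⟩
          k′ c + e n l c + u + v + w + e a n c + (e a l c + nn c)                  ≡⟨ cong (λ z → z + u + v + w + e a n c + (e a l c + nn c)) (eq′ c) ⟨
          k c + u + v + w + e a n c + (e a l c + nn c)                             ≡⟨ cong (λ z → z + e a n c + (e a l c + nn c)) (eq c) ⟨
          r c + e a n c + (e a l c + nn c) ∎)
          where
          open ≡-Reasoning
          u = + b * nn c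
          v = + i * A c
          w = + j * B c
          solved : ∀ k u v w y x z → k + u + v + w + y + (x + z) ≡ k + z + u + v + w + x + y
          solved = solve-∀

      reflect : ∀ {t r} a c → Z t ((r ∘ Sum.swap) ⊕ e c a) → Z t ((r ⊕ e a c) ∘ Sum.swap)
      reflect {r = r} a c = Z-resp (λ x → cong (_+_ (r (Sum.swap x))) (sym (transpose-e a c x)))

      Z-loop : ∀ {a} → D a a → ∀ {t r} → Z t r → Z (suc (suc t)) (r ⊕ (e a a ⊕ nn))
      Z-loop {a} aa {r = r} z = Z-resp (λ c → ℤ.+-assoc (r c) (e a a c) (nn c)) (Z-nn (Z-edge (inj₁ (inj₁ aa)) z))

      Z-add : ∀ {t r a c} → X a c → Z t r → Z (suc t) (r ⊕ e a c) ⊎ Z (suc t) ((r ⊕ e a c) ∘ Sum.swap)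
      Z-add (inj₁ (inj₁ (inj₁ w))) z = inj₁ (Z-edge w z)
      Z-add (inj₁ (inj₁ (inj₂ (refl , refl)))) z = inj₁ (Z-nn z)
      Z-add {r = r} (inj₁ (inj₂ (refl , refl))) z = Z-in (reflect {r = r} p n ∘ Z-edge F-np) (Z-loop pp) Z-B z
      Z-add {r = r} (inj₂ (refl , refl)) z = Z-in (reflect {r = r} q n ∘ Z-edge F-nq) Z-A (Z-loop qq) z

      -- Induction over the edges of the sum. An edge into the right vertex n that finds no partner
      -- occurs only over a balanced point, which may be transposed first; the edge then leaves the
      -- left vertex n. Hence the claim is about r or its transpose.
      X⇒Z : ∀ {t r} → Cone X t r → Z t r ⊎ Z t (r ∘ Sum.swap)
      X⇒Z (nil r≈0) = inj₁ (cone⇒Z (nil r≈0))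
      X⇒Z (add {i = i} {j} {r} {r′} w κ eq) with X⇒Z κ
      ... | inj₁ z = Sum.map (Z-resp (≈-sym eq)) (Z-resp (≈-sym eq ∘ Sum.swap)) (Z-add w z)
      ... | inj₂ z with Z-add (X-sym w) z
      ...   | inj₁ z′ = inj₂ (Z-resp (≈-sym eq ∘ Sum.swap) (reflect {r = r′} i j z′))
      ...   | inj₂ z′ = inj₁ (Z-resp back z′)
        where
        back : ((r′ ∘ Sum.swap) ⊕ e j i) ∘ Sum.swap ≈ r
        back c = trans (cong₂ _+_ (swap-swap r′ c) (transpose-e j i c)) (sym (eq c))

      -- Suppose that only the transpose of r is in the form `Z`. If it is balanced, it can be
      -- swapped back; otherwise its base uses the left vertex n, so that r has x_n < y_n.
      Half⇒Z : ∀ {t r} → Half t r → Z t r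
      Half⇒Z {t} {r} (le , κ) with X⇒Z κ
      ... | inj₁ z = z
      ... | inj₂ (mk s b i j k κ′ deg eq) with fan-cases κ′
      ...   | off κ″ = Z-resp (swap-swap r) (balanced-swap b i j κ″ deg eq)
      ...   | via {k′ = k′} l _ _ κ″ eq′ = contradiction le (ℤ.<⇒≱ strict)
        where
        k-n : k (inj₁ n) ≡ + suc ∣ k′ (inj₁ n) ∣
        k-n = trans (eq′ (inj₁ n)) (trans (cong₂ _+_ (cone-nonneg κ″ (inj₁ n)) (cong +_ (δ-refl n))) (cong +_ (ℕ.+-comm ∣ k′ (inj₁ n) ∣ 1)))
        strict : r (inj₁ n) ℤ.< r (inj₂ n)
        strict = subst₂ ℤ._<_ (sym (z₂ b i j κ′ eq)) (sym (trans (z₁ b i j κ′ eq) (cong (λ z → + ∣ z ∣ + + (b ℕ.+ i ℕ.+ j)) k-n)))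
                   (ℤ.+<+ (ℕ.s≤s (ℕ.m≤n+m (b ℕ.+ i ℕ.+ j) ∣ k′ (inj₁ n) ∣)))

      beyond₂ : ∀ {d P} → (∀ {t k} → P t k → k (inj₂ n) ≡ 0ℤ) → d (inj₂ n) ≡ 1ℤ →
                ∀ {t r} (y : Beyond 2 d P t r) → r (inj₂ n) ≡ + suc (proj₁ (beyond⇒ y))
      beyond₂ P₂ d₂ y with beyond⇒ y
      ... | m , s , k , x , _ , eq = trans (eq (inj₂ n)) (trans (cong₂ (λ u v → u + + suc m * v) (P₂ x) d₂)
                                       (trans (ℤ.+-identityˡ (+ suc m * 1ℤ)) (ℤ.*-identityʳ (+ suc m))))

      -- Positive multiples of xy + nn over a base k for which k + xy is no point of the fan. If it
      -- were one, xy could be absorbed into the base and a copy of nn would be set free.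
      Excess : Fin M → Fin M → ℕ → Point M → Set
      Excess x y = Beyond 2 (e x y ⊕ nn) (Top F? 1 (e x y))

      fan-not-excess : ∀ {x y} → (e x y ⊕ nn) (inj₂ n) ≡ 1ℤ → ∀ {t} → Disjoint (Cone F t) (Excess x y t)
      fan-not-excess d₂ κ y eq with trans (sym (fan₂ κ)) (trans (eq (inj₂ n)) (beyond₂ (fan₂ ∘ proj₂) d₂ y))
      ... | ()

      card-excess : ∀ x y → (e x y ⊕ nn) (inj₂ n) ≡ 1ℤ → ∀ t → Card (Excess x y t) (skip (top-size F? 1 (e x y)) t)
      card-excess x y d₂ zero = card-∅ (beyond-∅ (ℕ.s≤s ℕ.z≤n))
      card-excess x y d₂ (suc zero) = card-∅ (beyond-∅ (ℕ.s≤s (ℕ.s≤s ℕ.z≤n)))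
      card-excess x y d₂ (suc (suc t)) = card-beyond (λ (_ , κ) → fan-not-excess d₂ κ) (card-top F? 1 (e x y) t) (card-excess x y d₂ t)

      Shifted : ℕ → Point M → Set
      Shifted t = Image (_⊕ nn) (Half t)

      shifted₂ : ∀ {t r} → Shifted t r → r (inj₂ n) ≢ 0ℤ
      shifted₂ (k , (_ , κ) , eq) r≡0 = +suc≢0 {∣ k (inj₂ n) ∣} {0}
        (trans (cong₂ _+_ (sym (cone-nonneg κ (inj₂ n))) (sym nn₂)) (trans (eq (inj₂ n)) r≡0))

      -- `decompose` presents the normal form with A and B in the order given by x and y, so that
      -- one argument serves both. The coordinate at the right vertex n fixes the number of copies
      -- of nn; once these are cancelled, `top-clash` applies.
      shifted-not-excess : ∀ {x y} → (F x x) → (F y y) → (e x y ⊕ nn) (inj₂ n) ≡ 1ℤ →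
        (∀ {t r} → Z t r → ∃ λ b → ∃ λ i → ∃ λ j → ∃ λ s → ∃ λ k → Cone F s k × t ≡ b ℕ.+ (i ℕ.* 2 ℕ.+ (j ℕ.* 2 ℕ.+ s)) ×
          r (inj₂ n) ≡ + (b ℕ.+ i ℕ.+ j) × r ≈ k ⊕ b ⊛ nn ⊕ i ⊛ (e x y ⊕ nn) ⊕ j ⊛ (e y x ⊕ nn)) →
        ∀ {t} → Disjoint (Shifted t) (Excess x y (suc t))
      shifted-not-excess {x} {y} xx yy d₂ decompose (r , h , eq) ex eq′ with decompose (Half⇒Z h) | beyond⇒ ex | beyond₂ (fan₂ ∘ proj₂) d₂ ex
      ... | b , i , j , s , k , κ , refl , r₂ , eqr | m , s′ , k′ , top , deg , eqk | ex₂ =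
        top-clash F? xx yy (b ℕ.+ j) i j κ top deg′ total
        where
        m≡ : b ℕ.+ i ℕ.+ j ≡ m
        m≡ = ℕ.suc-injective (trans (ℕ.+-comm 1 _) (+-injective (trans (sym (cong₂ _+_ r₂ nn₂)) (trans (eq (inj₂ n)) (trans (eq′ (inj₂ n)) ex₂)))))
        deg′ : s ℕ.+ j ≡ suc (b ℕ.+ j) ℕ.+ s′
        deg′ = ℕ.+-cancelˡ-≡ (suc (b ℕ.+ i ℕ.* 2 ℕ.+ j)) _ _ (trans (l₁ b i j s) (trans deg (trans (cong (λ z → suc z ℕ.* 2 ℕ.+ s′) (sym m≡)) (l₂ b i j s′))))
          where
          l₁ : ∀ b i j s → suc (b ℕ.+ i ℕ.* 2 ℕ.+ j) ℕ.+ (s ℕ.+ j) ≡ suc (b ℕ.+ (i ℕ.* 2 ℕ.+ (j ℕ.* 2 ℕ.+ s)))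
          l₁ = ℕ-Solver.solve-∀
          l₂ : ∀ b i j s → suc (b ℕ.+ i ℕ.+ j) ℕ.* 2 ℕ.+ s ≡ suc (b ℕ.+ i ℕ.* 2 ℕ.+ j) ℕ.+ (suc (b ℕ.+ j) ℕ.+ s)
          l₂ = ℕ-Solver.solve-∀
        total : k ⊕ i ⊛ e x y ⊕ j ⊛ e y x ≈ k′ ⊕ (suc (b ℕ.+ j) ℕ.+ i) ⊛ e x y
        total c = lin₁ (trans (cong (_+ nn c) (sym (eqr c))) (trans (eq c) (trans (eq′ c) (trans (eqk c) (cong (λ z → k′ c + + suc z * (e x y c + nn c)) (sym m≡))))))
          (solved (k c) (k′ c) (e x y c) (e y x c) (nn c) (+ b) (+ i) (+ j))
          where
          solved : ∀ k k′ x y z b i j → k + i * x + j * y + (k′ + (1ℤ + (b + i + j)) * (x + z)) ≡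
                   k′ + (1ℤ + (b + j) + i) * x + (k + b * z + i * (x + z) + j * (y + z) + z)
          solved = solve-∀

      shifted-not-A : ∀ {t} → Disjoint (Shifted t) (Excess q p (suc t))
      shifted-not-A = shifted-not-excess F-qq F-pp A₂ λ where
        (mk s b i j k κ deg eq) → b , i , j , s , k , κ , deg , z₂ b i j κ eq , eq

      shifted-not-B : ∀ {t} → Disjoint (Shifted t) (Excess p q (suc t))
      shifted-not-B = shifted-not-excess F-pp F-qq B₂ λ where
          (mk s b i j k κ deg eq) → b , j , i , s , k , κ , trans deg (l₁ b i j s) , trans (z₂ b i j κ eq) (cong +_ (l₂ b i j)) ,
            λ c → trans (eq c) (l₃ (k c) (+ b * nn c) (+ i * A c) (+ j * B c))
        where
        l₁ : ∀ b i j s → b ℕ.+ (i ℕ.* 2 ℕ.+ (j ℕ.* 2 ℕ.+ s)) ≡ b ℕ.+ (j ℕ.* 2 ℕ.+ (i ℕ.* 2 ℕ.+ s))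
        l₁ = ℕ-Solver.solve-∀
        l₂ : ∀ b i j → b ℕ.+ i ℕ.+ j ≡ b ℕ.+ j ℕ.+ i
        l₂ = ℕ-Solver.solve-∀
        l₃ : ∀ k x y z → k + x + y + z ≡ k + x + z + y
        l₃ = solve-∀

      A-not-B : ∀ {t} → Disjoint (Excess q p t) (Excess p q t)
      A-not-B ya yb eq with beyond⇒ ya | beyond⇒ yb | beyond₂ (fan₂ ∘ proj₂) A₂ ya | beyond₂ (fan₂ ∘ proj₂) B₂ yb
      ... | m , s , k , top , refl , eqa | m′ , s′ , k′ , (_ , κ′) , deg , eqb | a₂ | b₂ =
        top-clash F? F-qq F-pp m 0 (suc m) κ′ top deg′ total
        where
        m≡ : m′ ≡ m
        m≡ = ℕ.suc-injective (+-injective (trans (sym b₂) (trans (sym (eq (inj₂ n))) a₂)))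
        deg′ : s′ ℕ.+ suc m ≡ suc m ℕ.+ s
        deg′ = trans (ℕ.+-comm s′ (suc m)) (cong (suc m ℕ.+_) (sym (ℕ.+-cancelˡ-≡ (suc m ℕ.* 2) s s′ (trans deg (cong (λ z → suc z ℕ.* 2 ℕ.+ s′) m≡)))))
        total : k′ ⊕ 0 ⊛ e q p ⊕ suc m ⊛ e p q ≈ k ⊕ (suc m ℕ.+ 0) ⊛ e q p
        total c = lin₁ (trans (sym (eqb c)) (trans (sym (eq c)) (eqa c)))
          (trans (solved (k c) (k′ c) (e q p c) (e p q c) (nn c) (+ m)) (cong (λ z → k c + (+ suc m + 0ℤ) * e q p c + (k′ c + + suc z * B c)) (sym m≡)))
          where
          solved : ∀ k k′ x y z m → k′ + 0ℤ * x + (1ℤ + m) * y + (k + (1ℤ + m) * (x + z)) ≡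
                   k + (1ℤ + m + 0ℤ) * x + (k′ + (1ℤ + m) * (y + z))
          solved = solve-∀

      half? : ∀ (r : Point M) → Dec (r (inj₂ n) ℤ.≤ r (inj₁ n))
      half? r = r (inj₂ n) ℤ.≤? r (inj₁ n)
      half-resp : ∀ {r r′ : Point M} → r ≈ r′ → r (inj₂ n) ℤ.≤ r (inj₁ n) → r′ (inj₂ n) ℤ.≤ r′ (inj₁ n)
      half-resp eq = subst₂ ℤ._≤_ (eq (inj₂ n)) (eq (inj₁ n))
      above? : ∀ (r : Point M) → Dec (r (inj₂ n) ℤ.< r (inj₁ n))
      above? r = r (inj₂ n) ℤ.<? r (inj₁ n)
      above-resp : ∀ {r r′ : Point M} → r ≈ r′ → r (inj₂ n) ℤ.< r (inj₁ n) → r′ (inj₂ n) ℤ.< r′ (inj₁ n)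
      above-resp eq = subst₂ ℤ._<_ (eq (inj₂ n)) (eq (inj₁ n))

    half above : ℕ → ℕ
    half t = proj₁ (card-within X? t half? half-resp)
    above t = proj₁ (card-within X? t above? above-resp)

    private
      card-half : ∀ t → Card (Half t) (half t)
      card-half t = proj₂ (card-within X? t half? half-resp)

      Above : ℕ → Point M → Set
      Above t r = r (inj₂ n) ℤ.< r (inj₁ n) × Cone X t r

      card-above : ∀ t → Card (Above t) (above t)
      card-above t = proj₂ (card-within X? t above? above-resp)

    half-zero : half 0 ≡ size F? 0
    half-zero = card-unique (card-half 0) (card-⇔ (λ κ → Z⇒Half (cone⇒Z κ)) (λ { (_ , nil r≈0) → nil r≈0 }) (card-cone F? 0))

    -- Split off a copy of nn whenever possible, which leaves a point of the half at level t. It is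
    -- impossible just for points of the fan and for multiples of A alone or of B alone over a base
    -- that is last in direction qp or pq. As A and B have degree 2, these are counted by `skip`.
    half-suc : ∀ t → half (suc t) ≡ half t ℕ.+ (size F? (suc t) ℕ.+
               (skip (top-size F? 1 (e q p)) (suc t) ℕ.+ skip (top-size F? 1 (e p q)) (suc t)))
    half-suc t = card-unique (card-half (suc t)) (card-⇔ (Z⇒Half ∘ from) (to ∘ Half⇒Z)
      (card-∪ disj (card-image (_⊕ nn) (λ eq → ⊕-cong eq (λ _ → refl)) (λ _ _ → ⊕-cancelʳ nn) (card-half t))
        (card-∪ disj′ (card-cone F? (suc t)) (card-∪ A-not-B (card-excess q p A₂ (suc t)) (card-excess p q B₂ (suc t))))))
      where
      disj′ : Disjoint (Cone F (suc t)) (Excess q p (suc t) ∪ Excess p q (suc t))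
      disj′ κ (inj₁ y) = fan-not-excess A₂ κ y
      disj′ κ (inj₂ y) = fan-not-excess B₂ κ y
      Parts : Point M → Set
      Parts = Shifted t ∪ (Cone F (suc t) ∪ (Excess q p (suc t) ∪ Excess p q (suc t)))
      disj : Disjoint (Shifted t) (Cone F (suc t) ∪ (Excess q p (suc t) ∪ Excess p q (suc t)))
      disj x (inj₁ κ) eq = shifted₂ x (trans (eq (inj₂ n)) (fan₂ κ))
      disj x (inj₂ (inj₁ y)) eq = shifted-not-A x y eq
      disj x (inj₂ (inj₂ y)) eq = shifted-not-B x y eq
      from : ∀ {r} → Parts r → Z (suc t) r
      from (inj₁ (k , h , eq)) = Z-resp eq (Z-nn (Half⇒Z h))
      from (inj₂ (inj₁ κ)) = cone⇒Z κ
      from {r} (inj₂ (inj₂ (inj₁ y))) with beyond⇒ y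
      ... | m , s , k , (_ , κ) , deg , eq = mk s 0 (suc m) 0 k κ deg (λ c → trans (eq c) (lem (k c) (nn c) (+ suc m * A c) (B c)))
        where
        lem : ∀ k x y z → k + y ≡ k + 0ℤ * x + y + 0ℤ * z
        lem = solve-∀
      from {r} (inj₂ (inj₂ (inj₂ y))) with beyond⇒ y
      ... | m , s , k , (_ , κ) , deg , eq = mk s 0 0 (suc m) k κ deg (λ c → trans (eq c) (lem (k c) (nn c) (A c) (+ suc m * B c)))
        where
        lem : ∀ k x y z → k + z ≡ k + 0ℤ * x + 0ℤ * y + z
        lem = solve-∀
      shifted : ∀ {r s} b i j {k} → Cone F s k → t ≡ b ℕ.+ (i ℕ.* 2 ℕ.+ (j ℕ.* 2 ℕ.+ s)) →
                r ≈ k ⊕ b ⊛ nn ⊕ i ⊛ A ⊕ j ⊛ B ⊕ nn → Parts r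
      shifted b i j κ deg eq = inj₁ (_ , Z⇒Half (mk _ b i j _ κ deg (λ _ → refl)) , ≈-sym eq)
      to : ∀ {r} → Z (suc t) r → Parts r
      to (mk s (suc b) i j k κ deg eq) = shifted b i j κ (ℕ.suc-injective deg)
          (λ c → trans (eq c) (lem (k c) (nn c) (+ b) (+ i * A c) (+ j * B c)))
        where
        lem : ∀ k x b y z → k + (1ℤ + b) * x + y + z ≡ k + b * x + y + z + x
        lem = solve-∀
      -- A + B = qq + pp + 2 nn: one copy of nn is split off, the other one stays, whence the 1.
      to (mk s zero (suc i) (suc j) k κ deg eq) = shifted 1 i j (cone-snoc (cone-snoc κ F-pp) F-qq)
          (ℕ.suc-injective (trans deg (lem i j s)))
          (λ c → trans (eq c) (lin₁ (exchange q p p q c) (lem′ (k c) (nn c) (+ i) (+ j) (e q p c) (e p q c) (e p p c) (e q q c))))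
        where
        lem : ∀ i j s → suc i ℕ.* 2 ℕ.+ (suc j ℕ.* 2 ℕ.+ s) ≡ suc (1 ℕ.+ (i ℕ.* 2 ℕ.+ (j ℕ.* 2 ℕ.+ suc (suc s))))
        lem = ℕ-Solver.solve-∀
        lem′ : ∀ k x i j y z u w → k + 0ℤ * x + (1ℤ + i) * (y + x) + (1ℤ + j) * (z + x) + (w + u) ≡
               k + u + w + 1ℤ * x + i * (y + x) + j * (z + x) + x + (y + z)
        lem′ = solve-∀
      to (mk s zero zero zero k κ deg eq) = inj₂ (inj₁ (cone-cast (sym deg) (λ c → trans (lem (k c) (nn c) (A c) (B c)) (sym (eq c))) κ))
        where
        lem : ∀ r x y z → r ≡ r + 0ℤ * x + 0ℤ * y + 0ℤ * z
        lem = solve-∀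
      to {r} (mk s zero (suc i) zero k κ deg eq) with cone? F? (1 ℕ.+ s) (k ⊕ e q p)
      ... | yes κ′ = shifted 0 i 0 κ′ (ℕ.suc-injective (trans deg (lem i s)))
          (λ c → trans (eq c) (lem′ (k c) (nn c) (+ i) (e q p c) (B c)))
        where
        lem : ∀ i s → suc i ℕ.* 2 ℕ.+ s ≡ suc (i ℕ.* 2 ℕ.+ suc s)
        lem = ℕ-Solver.solve-∀
        lem′ : ∀ k x i y z → k + 0ℤ * x + (1ℤ + i) * (y + x) + 0ℤ * z ≡ k + y + 0ℤ * x + i * (y + x) + 0ℤ * z + x
        lem′ = solve-∀
      ... | no ¬κ = inj₂ (inj₂ (inj₁ (subst (λ t → Excess q p t r) (sym deg)
          (⇒beyond i (¬κ , κ) (λ c → trans (eq c) (lem (k c) (nn c) (+ suc i * A c) (B c)))))))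
        where
        lem : ∀ k x y z → k + 0ℤ * x + y + 0ℤ * z ≡ k + y
        lem = solve-∀
      to {r} (mk s zero zero (suc j) k κ deg eq) with cone? F? (1 ℕ.+ s) (k ⊕ e p q)
      ... | yes κ′ = shifted 0 0 j κ′ (ℕ.suc-injective (trans deg (lem j s)))
          (λ c → trans (eq c) (lem′ (k c) (nn c) (+ j) (A c) (e p q c)))
        where
        lem : ∀ j s → suc j ℕ.* 2 ℕ.+ s ≡ suc (j ℕ.* 2 ℕ.+ suc s)
        lem = ℕ-Solver.solve-∀
        lem′ : ∀ k x j z y → k + 0ℤ * x + 0ℤ * z + (1ℤ + j) * (y + x) ≡ k + y + 0ℤ * x + 0ℤ * z + j * (y + x) + x
        lem′ = solve-∀
      ... | no ¬κ = inj₂ (inj₂ (inj₂ (subst (λ t → Excess p q t r) (sym deg)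
          (⇒beyond j (¬κ , κ) (λ c → trans (eq c) (lem (k c) (nn c) (A c) (+ suc j * B c)))))))
        where
        lem : ∀ k x y z → k + 0ℤ * x + 0ℤ * y + z ≡ k + z
        lem = solve-∀

    half+above : ∀ t → size X? t ≡ half t ℕ.+ above t
    half+above t = card-unique (card-cone X? t) (card-⇔ from to (card-∪ disj (card-half t)
      (card-image (_∘ Sum.swap) (λ eq → eq ∘ Sum.swap) (λ _ _ → unswap) (card-above t))))
      where
      unswap : ∀ {r r′ : Point M} → r ∘ Sum.swap ≈ r′ ∘ Sum.swap → r ≈ r′
      unswap eq (inj₁ i) = eq (inj₂ i)
      unswap eq (inj₂ j) = eq (inj₁ j)
      disj : Disjoint (Half t) (Image (_∘ Sum.swap) (Above t))
      disj (le , _) (k , (lt , _) , eq) eq′ = ℤ.<⇒≱ lt (subst₂ ℤ._≤_ (trans (eq′ (inj₂ n)) (sym (eq (inj₂ n)))) (trans (eq′ (inj₁ n)) (sym (eq (inj₁ n)))) le)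
      from : ∀ {r} → Half t r ⊎ Image (_∘ Sum.swap) (Above t) r → Cone X t r
      from (inj₁ (_ , κ)) = κ
      from (inj₂ (k , (_ , κ) , eq)) = cone-resp eq (cone-transpose X-sym κ)
      to : ∀ {r} → Cone X t r → Half t r ⊎ Image (_∘ Sum.swap) (Above t) r
      to {r} κ with r (inj₂ n) ℤ.≤? r (inj₁ n)
      ... | yes le = inj₁ (le , κ)
      ... | no ¬le = inj₂ (r ∘ Sum.swap , (ℤ.≰⇒> ¬le , cone-transpose X-sym κ) , swap-swap r)

    above≤half : ∀ t → above t ℕ.≤ half t
    above≤half t = card-≤ (λ r → r) (λ (lt , κ) → ℤ.<⇒≤ lt , κ) (λ eq → eq) (card-above t) (card-half t)

    -- Adding np raises x_n and leaves y_n alone, so a weak inequality becomes strict at the cost of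
    -- one level.
    half≤above : ∀ t → half t ℕ.≤ above (suc t)
    half≤above t = card-≤ (_⊕ np) (λ { {r} (le , κ) → lift r le , cone-snoc κ (X-F F-np) }) (⊕-cancelʳ np) (card-half t) (card-above (suc t))
      where
      lift : ∀ r → r (inj₂ n) ℤ.≤ r (inj₁ n) → r (inj₂ n) + np (inj₂ n) ℤ.< r (inj₁ n) + np (inj₁ n)
      lift r le = subst₂ (λ x y → r (inj₂ n) + x ℤ.< r (inj₁ n) + y) (sym (cong +_ (ind-no (p ≟ n) (n≢p ∘ sym)))) (sym nn₁)
        (ℤ.+-mono-≤-< le (ℤ.+<+ (ℕ.s≤s ℕ.z≤n)))

    size-mono : ∀ t → size X? t ℕ.≤ size X? (suc t)
    size-mono t = card-≤ (_⊕ nn) (λ κ → cone-snoc κ X-nn) (⊕-cancelʳ nn) (card-cone X? t) (card-cone X? (suc t))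

-- Binomial coefficients as growth rates

module Binomials where

  open import Data.Nat.Base
  open import Data.Nat.Properties
  open import Data.Nat.Tactic.RingSolver using (solve-∀)
  open import Relation.Binary.PropositionalEquality
  open Sequences

  -- binom d t = C(t + d, d)
  binom : ℕ → ℕ → ℕ
  binom zero t = 1
  binom (suc d) t = upto (binom d) t

  -- The two recursions of binomial coefficients without division, proved together: `binom-step`
  -- climbs in d with the help of `binom-absorb`, and `binom-absorb` climbs in t with the help of
  -- `binom-step`.
  binom-step : ∀ d t → suc t * binom d (suc t) ≡ (t + suc d) * binom d t
  binom-absorb : ∀ d t → suc d * binom (suc d) t ≡ (t + suc d) * binom d t

  binom-step zero t = lem t
    where
    lem : ∀ t → suc t * 1 ≡ (t + 1) * 1
    lem = solve-∀
  binom-step (suc d) t = begin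
    suc t * (binom d (suc t) + binom (suc d) t)            ≡⟨ *-distribˡ-+ (suc t) (binom d (suc t)) _ ⟩
    suc t * binom d (suc t) + suc t * binom (suc d) t      ≡⟨ cong (_+ suc t * binom (suc d) t) (trans (binom-step d t) (sym (binom-absorb d t))) ⟩
    suc d * binom (suc d) t + suc t * binom (suc d) t      ≡⟨ lem d t (binom (suc d) t) ⟩
    (t + suc (suc d)) * binom (suc d) t ∎
    where
    open ≡-Reasoning
    lem : ∀ d t x → suc d * x + suc t * x ≡ (t + suc (suc d)) * x
    lem = solve-∀

  binom-zero : ∀ d → binom d 0 ≡ 1
  binom-zero zero = refl
  binom-zero (suc d) = trans (+-identityʳ _) (binom-zero d)

  binom-absorb d zero = cong (suc d *_) (trans (+-identityʳ _) refl)
  binom-absorb d (suc t) = begin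
    suc d * (binom d (suc t) + binom (suc d) t)              ≡⟨ *-distribˡ-+ (suc d) (binom d (suc t)) _ ⟩
    suc d * binom d (suc t) + suc d * binom (suc d) t        ≡⟨ cong (suc d * binom d (suc t) +_) (trans (binom-absorb d t) (sym (binom-step d t))) ⟩
    suc d * binom d (suc t) + suc t * binom d (suc t)        ≡⟨ lem d t (binom d (suc t)) ⟩
    (suc t + suc d) * binom d (suc t) ∎
    where
    open ≡-Reasoning
    lem : ∀ d t x → suc d * x + suc t * x ≡ (suc t + suc d) * x
    lem = solve-∀

  binom>0 : ∀ d t → 1 ≤ binom d t
  binom>0 zero t = ≤-refl
  binom>0 (suc d) t = ≤-trans (binom>0 d t) (m≤m+n _ _)

  binom-mono-suc : ∀ d t → binom d t ≤ binom d (suc t)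
  binom-mono-suc zero t = ≤-refl
  binom-mono-suc (suc d) t = m≤n+m (binom (suc d) t) (binom d (suc t))

  binom-mono : ∀ d t h → binom d t ≤ binom d (h + t)
  binom-mono d t zero = ≤-refl
  binom-mono d t (suc h) = ≤-trans (binom-mono d t h) (binom-mono-suc d (h + t))

  binom-unbounded : ∀ d t → t ≤ binom (suc d) t
  binom-unbounded d zero = z≤n
  binom-unbounded d (suc t) = +-mono-≤ (binom>0 d (suc t)) (binom-unbounded d t)

  binom-absorb-≤ : ∀ d t → d ≤ t → binom (suc d) t ≤ 2 * suc t * binom d t
  binom-absorb-≤ d t d≤t = begin
    binom (suc d) t              ≤⟨ m≤m+n _ _ ⟩
    suc d * binom (suc d) t      ≡⟨ binom-absorb d t ⟩
    (t + suc d) * binom d t      ≤⟨ *-monoˡ-≤ (binom d t) (+-mono-≤ (n≤1+n t) (s≤s d≤t)) ⟩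
    (suc t + suc t) * binom d t  ≡⟨ cong (λ z → (suc t + z) * binom d t) (+-identityʳ (suc t)) ⟨
    2 * suc t * binom d t ∎
    where open ≤-Reasoning

  -- (1 + 1/m)^d ≤ 1 + slope d / m
  slope : ℕ → ℕ
  slope zero = 0
  slope (suc d) = suc (slope d + slope d)

  private
    slope-step : ∀ m c → (2 + m) * (suc m + c) ≤ suc m * (suc m + suc (c + c))
    slope-step m c = begin
      (2 + m) * (suc m + c)                    ≤⟨ m≤m+n _ (m * c) ⟩
      (2 + m) * (suc m + c) + m * c            ≡⟨ lem m c ⟩
      suc m * (suc m + suc (c + c)) ∎
      where
      open ≤-Reasoning
      lem : ∀ m c → (2 + m) * (suc m + c) + m * c ≡ suc m * (suc m + suc (c + c))
      lem = solve-∀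

    -- One factor of the product passes from y to z, growing by at most 1 + 1/m.
    growth-step : ∀ m c {y z p q} → suc m * z ≤ (2 + m) * y → suc m * q ≤ (suc m + c) * p →
                  suc m * (z * q) ≤ (suc m + suc (c + c)) * (y * p)
    growth-step m c {y} {z} {p} {q} h h′ = *-cancelˡ-≤ (suc m) (begin
      suc m * (suc m * (z * q))                   ≡⟨ l₁ (suc m) z q ⟩
      suc m * z * (suc m * q)                     ≤⟨ *-mono-≤ h h′ ⟩
      (2 + m) * y * ((suc m + c) * p)             ≡⟨ l₂ (2 + m) y (suc m + c) p ⟩
      (2 + m) * (suc m + c) * (y * p)             ≤⟨ *-monoˡ-≤ (y * p) (slope-step m c) ⟩
      suc m * (suc m + suc (c + c)) * (y * p)     ≡⟨ *-assoc (suc m) (suc m + suc (c + c)) (y * p) ⟩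
      suc m * ((suc m + suc (c + c)) * (y * p)) ∎)
      where
      open ≤-Reasoning
      l₁ : ∀ a z q → a * (a * (z * q)) ≡ a * z * (a * q)
      l₁ = solve-∀
      l₂ : ∀ a y b p → a * y * (b * p) ≡ a * b * (y * p)
      l₂ = solve-∀

  -- A shift by h ≤ (t + 1)/(m + 1) enlarges each of the d linear factors of the binomial
  -- coefficient by at most 1 + 1/(m + 1), and `slope` bounds the product of these factors.
  binom-growth : ∀ d m t h → h * suc m ≤ suc t → suc m * binom d (h + t) ≤ (suc m + slope d) * binom d t
  binom-growth zero m t h _ = ≤-reflexive (cong (_* 1) (sym (+-identityʳ (suc m))))
  binom-growth (suc d) m t h hm≤ = *-cancelˡ-≤ (suc d) (begin
    suc d * (suc m * binom (suc d) (h + t))            ≡⟨ l₁ (suc d) (suc m) _ ⟩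
    suc m * (suc d * binom (suc d) (h + t))            ≡⟨ cong (suc m *_) (binom-absorb d (h + t)) ⟩
    suc m * ((h + t + suc d) * binom d (h + t))        ≤⟨ growth-step m (slope d) {t + suc d} {h + t + suc d} factor (binom-growth d m t h hm≤) ⟩
    (suc m + slope (suc d)) * ((t + suc d) * binom d t) ≡⟨ cong ((suc m + slope (suc d)) *_) (binom-absorb d t) ⟨
    (suc m + slope (suc d)) * (suc d * binom (suc d) t) ≡⟨ l₁ (suc m + slope (suc d)) (suc d) _ ⟩
    suc d * ((suc m + slope (suc d)) * binom (suc d) t) ∎)
    where
    open ≤-Reasoning
    l₁ : ∀ a b c → a * (b * c) ≡ b * (a * c)
    l₁ = solve-∀
    factor : suc m * (h + t + suc d) ≤ (2 + m) * (t + suc d)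
    factor = begin
      suc m * (h + t + suc d)             ≡⟨ l₂ m h t d ⟩
      h * suc m + suc m * (t + suc d)     ≤⟨ +-monoˡ-≤ (suc m * (t + suc d)) hm≤ ⟩
      suc t + suc m * (t + suc d)         ≤⟨ +-monoˡ-≤ (suc m * (t + suc d)) (subst (suc t ≤_) (sym (+-suc t d)) (s≤s (m≤m+n t d))) ⟩
      (2 + m) * (t + suc d) ∎
      where
      l₂ : ∀ m h t d → suc m * (h + t + suc d) ≡ h * suc m + suc m * (t + suc d)
      l₂ = solve-∀

  -- With `binom≤power` it gives that t^d and d! C(t + d, d) are asymptotically equal. The volume is
  -- defined by powers, but binomial coefficients have partial sums that are again binomial
  -- coefficients.
  power≤binom : ∀ d t → t ^ d ≤ d ! * binom d t
  power≤binom zero t = ≤-refl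
  power≤binom (suc d) t = begin
    t * t ^ d                              ≤⟨ *-mono-≤ (m≤m+n t (suc d)) (power≤binom d t) ⟩
    (t + suc d) * (d ! * binom d t)        ≡⟨ lem (t + suc d) (d !) (binom d t) ⟩
    d ! * ((t + suc d) * binom d t)        ≡⟨ cong (d ! *_) (binom-absorb d t) ⟨
    d ! * (suc d * binom (suc d) t)        ≡⟨ lem′ (d !) (suc d) _ ⟩
    suc d * d ! * binom (suc d) t ∎
    where
    open ≤-Reasoning
    lem : ∀ a b c → a * (b * c) ≡ b * (a * c)
    lem = solve-∀
    lem′ : ∀ a b c → a * (b * c) ≡ b * a * c
    lem′ = solve-∀

  binom≤power : ∀ d m t → suc m * d ≤ t → suc m * (d ! * binom d t) ≤ (suc m + slope d) * t ^ d
  binom≤power zero m t _ = ≤-reflexive (cong (_* 1) (sym (+-identityʳ (suc m))))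
  binom≤power (suc d) m t md≤ = begin
    suc m * (suc d * d ! * binom (suc d) t)           ≡⟨ cong (suc m *_) (lem (suc d) (d !) _) ⟩
    suc m * (d ! * (suc d * binom (suc d) t))         ≡⟨ cong (λ z → suc m * (d ! * z)) (binom-absorb d t) ⟩
    suc m * (d ! * ((t + suc d) * binom d t))         ≡⟨ cong (suc m *_) (lem′ (d !) (t + suc d) _) ⟩
    suc m * ((t + suc d) * (d ! * binom d t))         ≤⟨ growth-step m (slope d) {t} {t + suc d} factor (binom≤power d m t (≤-trans (*-monoʳ-≤ (suc m) (n≤1+n d)) md≤)) ⟩
    (suc m + slope (suc d)) * (t * t ^ d) ∎
    where
    open ≤-Reasoning
    lem : ∀ a b c → a * b * c ≡ b * (a * c)
    lem = solve-∀
    lem′ : ∀ a b c → a * (b * c) ≡ b * (a * c)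
    lem′ = solve-∀
    factor : suc m * (t + suc d) ≤ (2 + m) * t
    factor = begin
      suc m * (t + suc d)           ≡⟨ *-distribˡ-+ (suc m) t (suc d) ⟩
      suc m * t + suc m * suc d     ≤⟨ +-monoʳ-≤ (suc m * t) md≤ ⟩
      suc m * t + t                 ≡⟨ +-comm (suc m * t) t ⟩
      (2 + m) * t ∎

-- One-sided limits relative to a growth rate

module Asymptotics where

  open import Data.Nat.Base as ℕ using (ℕ; zero; suc; s≤s; z≤n; _⊔_; _∸_; _^_; _!)
  import Data.Nat.Properties as ℕ
  import Data.Nat.Tactic.RingSolver as ℕ-Solver
  open import Data.Integer.Base hiding (suc; _⊔_; _/_; _^_)
  open import Data.Integer.Properties hiding (suc-pred)
  open import Data.Integer.Tactic.RingSolver using (solve-∀)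
  open import Data.Product.Base using (∃; _×_; _,_; proj₁; proj₂)
  open import Function.Base using (_∘_)
  open import Relation.Binary.PropositionalEquality
  open Sequences
  open Binomials

  -- The equation says r - l = y - x and is a ring identity for the solver. Most estimates below are
  -- instances of this or of `lin≤₂`, which adds two inequalities.
  lin≤ : ∀ {x y l r} → x ≤ y → l + y ≡ r + x → l ≤ r
  lin≤ {x} {y} {l} {r} h eq = 0≤i-j⇒j≤i (subst (0ℤ ≤_) (sub eq) (i≤j⇒0≤j-i h))
    where
    lem : ∀ x y l → y - x ≡ l + y - x - l
    lem = solve-∀
    lem′ : ∀ x l r → r + x - x - l ≡ r - l
    lem′ = solve-∀
    sub : l + y ≡ r + x → y - x ≡ r - l
    sub eq = trans (lem x y l) (trans (cong (λ z → z - x - l) eq) (lem′ x l r))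

  lin≤₂ : ∀ {x y x′ y′ l r} → x ≤ y → x′ ≤ y′ → l + y + y′ ≡ r + x + x′ → l ≤ r
  lin≤₂ {x} {y} {x′} {y′} {l} {r} h h′ eq = lin≤ (+-mono-≤ h h′) (trans (sym (+-assoc l y y′)) (trans eq (+-assoc r x x′)))

  scale : ∀ k {x y} → x ≤ y → + k * x ≤ + k * y
  scale k = *-monoˡ-≤-nonNeg (+ k)

  cancel : ∀ k {x y} → + suc k * x ≤ + suc k * y → x ≤ y
  cancel k = *-cancelˡ-≤-pos _ _ (+ suc k)

  cast≤ : ∀ a b c d → a ℕ.* b ℕ.≤ c ℕ.* d → + a * + b ≤ + c * + d
  cast≤ a b c d h = subst₂ _≤_ (pos-* a b) (pos-* c d) (+≤+ h)

  -- For every ε = 1/(m+1), eventually f t ≤ (a + ε) φ t.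
  record Below (φ : ℕ → ℕ) (f : ℕ → ℤ) (a : ℤ) : Set where
    constructor mkBelow
    field
      bound : ∀ m → ∃ λ T → ∀ t → T ℕ.≤ t → + suc m * f t ≤ (+ suc m * a + 1ℤ) * + φ t
  open Below public

  -- The lower bound is the upper bound for the negatives, so the lemmas on limits need to treat one
  -- side only.
  Tends : (ℕ → ℕ) → (ℕ → ℤ) → ℤ → Set
  Tends φ f a = Below φ f a × Below φ (-_ ∘ f) (- a)

  -- φ / ψ tends to 1. The two inequalities are those needed to replace z φ by z ψ + ψ in an upper
  -- bound, for an integer z = K and z = -K respectively.
  Near : (ℕ → ℕ) → (ℕ → ℕ) → Set
  Near φ ψ = ∀ K → ∃ λ T → ∀ t → T ℕ.≤ t →
    K ℕ.* φ t ℕ.≤ suc K ℕ.* ψ t × K ℕ.* ψ t ℕ.≤ K ℕ.* φ t ℕ.+ ψ t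

  -- A bound taken at the doubled precision 2(m + 1) leaves room for one further error term b.
  halve : ∀ m {a} {x b : ℤ} → (+ suc m + + suc m) * x ≤ ((+ suc m + + suc m) * a + 1ℤ) * b + b → + suc m * x ≤ (+ suc m * a + 1ℤ) * b
  halve m {a} {x} {b} h = cancel 1 (lin≤ h (lem (+ suc m) a x b))
    where
    lem : ∀ n a x b → (1ℤ + 1ℤ) * (n * x) + (((n + n) * a + 1ℤ) * b + b) ≡ (1ℤ + 1ℤ) * ((n * a + 1ℤ) * b) + (n + n) * x
    lem = solve-∀

  below-gauge : ∀ {φ ψ f a} → Near φ ψ → Below φ f a → Below ψ f a
  below-gauge {φ} {ψ} {f} {a} near below .bound m with bound below (m ℕ.+ suc m) | near ∣ (+ suc m + + suc m) * a + 1ℤ ∣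
  ... | T₁ , h₁ | T₂ , h₂ = T₁ ⊔ T₂ , λ t T≤t →
    halve m {a} {f t} {+ ψ t} (≤-trans (h₁ t (ℕ.m⊔n≤o⇒m≤o T₁ T₂ T≤t)) (change ((+ suc m + + suc m) * a + 1ℤ) (h₂ t (ℕ.m⊔n≤o⇒n≤o T₁ T₂ T≤t))))
    where
    change : ∀ z {p q} → ∣ z ∣ ℕ.* p ℕ.≤ suc ∣ z ∣ ℕ.* q × ∣ z ∣ ℕ.* q ℕ.≤ ∣ z ∣ ℕ.* p ℕ.+ q → z * + p ≤ z * + q + + q
    change (+ k) {p} {q} (h , _) = ≤-trans (cast≤ k p (suc k) q h) (≤-reflexive (lem (+ k) (+ q)))
      where
      lem : ∀ k q → (1ℤ + k) * q ≡ k * q + q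
      lem = solve-∀
    change -[1+ k ] {p} {q} (_ , h) = lin≤ (subst₂ _≤_ (pos-* (suc k) q) (cong (_+ + q) (pos-* (suc k) p)) (+≤+ h)) (lem (+ suc k) (+ p) (+ q))
      where
      lem : ∀ k p q → - k * p + (k * p + q) ≡ - k * q + q + k * q
      lem = solve-∀

  near-pair : ∀ {φ ψ} c → (∀ t → φ t ℕ.≤ ψ t) →
              (∀ m → ∃ λ T → ∀ t → T ℕ.≤ t → suc m ℕ.* ψ t ℕ.≤ (suc m ℕ.+ c) ℕ.* φ t) → Near φ ψ × Near ψ φ
  near-pair {φ} {ψ} c le slow = (λ K → proj₁ (close K) , λ t T≤t →
      ℕ.≤-trans (ℕ.*-monoʳ-≤ K (le t)) (ℕ.*-monoˡ-≤ (ψ t) (ℕ.n≤1+n K)) ,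
      ℕ.≤-trans (proj₂ (close K) t T≤t) (ℕ.≤-trans (ℕ.≤-reflexive (ℕ.+-comm (φ t) _)) (ℕ.+-monoʳ-≤ (K ℕ.* φ t) (le t)))) ,
    (λ K → proj₁ (close K) , λ t T≤t → proj₂ (close K) t T≤t ,
      ℕ.≤-trans (ℕ.*-monoʳ-≤ K (le t)) (ℕ.m≤m+n _ _))
    where
    close : ∀ K → ∃ λ T → ∀ t → T ℕ.≤ t → K ℕ.* ψ t ℕ.≤ suc K ℕ.* φ t
    close zero = 0 , λ _ _ → z≤n
    -- This is m with m + 1 = (K + 1)(c + 1), so that the relative error c/(m + 1) is less than 1/(K
    -- + 1).
    close (suc K) with slow (c ℕ.+ K ℕ.* suc c)
    ... | T , h = T , λ t T≤t → ℕ.*-cancelˡ-≤ (suc c) (begin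
        suc c ℕ.* (suc K ℕ.* ψ t)                       ≡⟨ l₁ c K (ψ t) ⟩
        suc K ℕ.* suc c ℕ.* ψ t                         ≤⟨ h t T≤t ⟩
        (suc K ℕ.* suc c ℕ.+ c) ℕ.* φ t                 ≤⟨ ℕ.*-monoˡ-≤ (φ t) (ℕ.+-monoʳ-≤ (suc K ℕ.* suc c) (ℕ.n≤1+n c)) ⟩
        (suc K ℕ.* suc c ℕ.+ suc c) ℕ.* φ t             ≡⟨ l₂ c K (φ t) ⟩
        suc c ℕ.* (suc (suc K) ℕ.* φ t) ∎)
      where
      open ℕ.≤-Reasoning
      l₁ : ∀ c K x → suc c ℕ.* (suc K ℕ.* x) ≡ suc K ℕ.* suc c ℕ.* x
      l₁ = ℕ-Solver.solve-∀
      l₂ : ∀ c K x → (suc K ℕ.* suc c ℕ.+ suc c) ℕ.* x ≡ suc c ℕ.* (suc (suc K) ℕ.* x)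
      l₂ = ℕ-Solver.solve-∀

  -- A shift of the index by one is invisible in the limit. Applied twice, it makes up for the shift
  -- by 2 in the lower bound for G △ e.
  near-suc : ∀ d → Near (binom d) (binom d ∘ suc) × Near (binom d ∘ suc) (binom d)
  near-suc d = near-pair (slope d) (binom-mono-suc d) λ m → m , λ t m≤t →
    binom-growth d m t 1 (subst (ℕ._≤ suc t) (sym (ℕ.+-identityʳ (suc m))) (s≤s m≤t))

  near-power : ∀ d → Near (_^ d) (λ t → d ! ℕ.* binom d t) × Near (λ t → d ! ℕ.* binom d t) (_^ d)
  near-power d = near-pair (slope d) (power≤binom d) λ m → suc m ℕ.* d , λ t → binom≤power d m t

  below-suc : ∀ d {f a} → Below (binom d) f a → Below (binom d) (f ∘ suc) a
  below-suc d below = below-gauge (proj₂ (near-suc d)) (mkBelow λ m → proj₁ (bound below m) , λ t T≤t → proj₂ (bound below m) (suc t) (ℕ.m≤n⇒m≤1+n T≤t))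

  below-pred : ∀ d {f a} → Below (binom d) (f ∘ suc) a → Below (binom d) f a
  below-pred d {f} {a} below .bound m with bound (below-gauge (proj₁ (near-suc d)) below) m
  ... | T , h = suc T , λ { (suc t) (s≤s T≤t) → h t T≤t }

  total : (ℕ → ℤ) → ℕ → ℤ
  total f zero = f 0
  total f (suc t) = f (suc t) + total f t

  -- From T on the bound is summed term by term. The initial segment contributes a constant K, which
  -- the spare half of the tolerance absorbs because `binom (suc d)` is unbounded.
  below-total : ∀ d {f a} → Below (binom d) f a → Below (binom (suc d)) (total f) a
  below-total d {f} {a} below .bound m with bound below (m ℕ.+ suc m)
  ... | T , h = T ⊔ ∣ K ∣ , λ t T≤t → halve m {a} {total f t} {+ binom (suc d) t} (lin≤₂ (sums t (ℕ.m⊔n≤o⇒m≤o T _ T≤t))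
        (≤-trans (i≤∣i∣ K) (+≤+ (ℕ.≤-trans (ℕ.m⊔n≤o⇒n≤o T _ T≤t) (binom-unbounded d t))))
        (lem (N * total f t) (z * + binom (suc d) t) K (+ binom (suc d) t)))
    where
    N = + suc m + + suc m
    z = N * a + 1ℤ
    K = N * total f T - z * + binom (suc d) T
    i≤∣i∣ : ∀ i → i ≤ + ∣ i ∣
    i≤∣i∣ (+ _) = ≤-refl
    i≤∣i∣ -[1+ _ ] = -≤+
    lem : ∀ x y K b → x + (y + K) + b ≡ y + b + x + K
    lem = solve-∀
    partial : ∀ i → N * total f (i ℕ.+ T) ≤ z * + binom (suc d) (i ℕ.+ T) + K
    partial zero = ≤-reflexive (l₁ (N * total f T) (z * + binom (suc d) T))
      where
      l₁ : ∀ x y → x ≡ y + (x - y)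
      l₁ = solve-∀
    partial (suc i) = lin≤₂ (partial i) (h (suc i ℕ.+ T) (ℕ.m≤n+m T (suc i)))
      (l₂ N z K (f (suc i ℕ.+ T)) (total f (i ℕ.+ T)) (+ binom d (suc i ℕ.+ T)) (+ binom (suc d) (i ℕ.+ T)))
      where
      l₂ : ∀ N z K x y p q → N * (x + y) + (z * q + K) + z * p ≡ z * (p + q) + K + N * y + N * x
      l₂ = solve-∀
    sums : ∀ t → T ℕ.≤ t → N * total f t ≤ z * + binom (suc d) t + K
    sums t T≤t = subst (λ t → N * total f t ≤ z * + binom (suc d) t + K) (ℕ.m∸n+n≡m T≤t) (partial (t ∸ T))

  total-neg : ∀ f t → total (-_ ∘ f) t ≡ - total f t
  total-neg f zero = refl
  total-neg f (suc t) = trans (cong (_+_ (- f (suc t))) (total-neg f t)) (sym (neg-distrib-+ (f (suc t)) (total f t)))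

  below-≤ : ∀ {φ f g a} → (∀ t → g t ≤ f t) → Below φ f a → Below φ g a
  below-≤ le below .bound m with bound below m
  ... | T , h = T , λ t T≤t → ≤-trans (scale (suc m) (le t)) (h t T≤t)

  tends-total : ∀ d {f a} → Tends (binom d) f a → Tends (binom (suc d)) (total f) a
  tends-total d {f} (up , down) = below-total d up , below-≤ (λ t → ≤-reflexive (sym (total-neg f t))) (below-total d down)

-- From partial sums back to the terms of a monotone sequence

module Tauberian where

  open import Data.Nat.Base as ℕ using (ℕ; zero; suc; s≤s; z≤n; _⊔_; _∸_; _/_)
  import Data.Nat.Properties as ℕ
  import Data.Nat.DivMod as ℕ
  import Data.Nat.Tactic.RingSolver as ℕ-Solver
  open import Data.Integer.Base hiding (suc; _⊔_; _/_; _^_)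
  open import Data.Integer.Properties hiding (suc-pred)
  open import Data.Integer.Tactic.RingSolver using (solve-∀)
  open import Data.Product.Base using (∃; _×_; _,_; proj₁; proj₂)
  open import Function.Base using (_∘_)
  open import Relation.Binary.PropositionalEquality
  open import Relation.Nullary using (contradiction)
  open Sequences
  open Binomials
  open Asymptotics

  binom-increment : ∀ d t h → h ℕ.* binom d t ℕ.+ binom (suc d) t ℕ.≤ binom (suc d) (h ℕ.+ t) ×
                              binom (suc d) (h ℕ.+ t) ℕ.≤ h ℕ.* binom d (h ℕ.+ t) ℕ.+ binom (suc d) t
  binom-increment d t zero = ℕ.≤-refl , ℕ.≤-refl
  binom-increment d t (suc h) with binom-increment d t h
  ... | lower , upper =
    ℕ.≤-trans (ℕ.≤-reflexive (ℕ.+-assoc (binom d t) _ _)) (ℕ.+-mono-≤ (binom-mono d t (suc h)) lower) ,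
    ℕ.≤-trans (ℕ.+-monoʳ-≤ (binom d (suc h ℕ.+ t)) (ℕ.≤-trans upper (ℕ.+-monoˡ-≤ (binom (suc d) t) (ℕ.*-monoʳ-≤ h (binom-mono-suc d (h ℕ.+ t))))))
              (ℕ.≤-reflexive (sym (ℕ.+-assoc (binom d (suc h ℕ.+ t)) _ _)))

  module _ {f : ℕ → ℤ} (mono : ∀ t → f t ≤ f (suc t)) where

    mono-+ : ∀ t h → f t ≤ f (h ℕ.+ t)
    mono-+ t zero = ≤-refl
    mono-+ t (suc h) = ≤-trans (mono-+ t h) (mono (h ℕ.+ t))

    total-increment : ∀ t h → + h * f t + total f t ≤ total f (h ℕ.+ t) × total f (h ℕ.+ t) ≤ + h * f (h ℕ.+ t) + total f t
    total-increment t zero = ≤-reflexive (lem (f t) (total f t)) , ≤-reflexive (sym (lem (f t) (total f t)))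
      where
      lem : ∀ x y → 0ℤ * x + y ≡ y
      lem = solve-∀
    total-increment t (suc h) with total-increment t h
    ... | lower , upper =
      lin≤₂ lower (mono-+ t (suc h)) (l₁ (f t) (total f t) (+ h) (total f (h ℕ.+ t)) (f (suc h ℕ.+ t))) ,
      lin≤₂ upper (scale h (mono (h ℕ.+ t))) (l₂ (total f t) (+ h) (total f (h ℕ.+ t)) (f (suc h ℕ.+ t)) (f (h ℕ.+ t)))
      where
      l₁ : ∀ x y h z w → (1ℤ + h) * x + y + z + w ≡ w + z + (h * x + y) + x
      l₁ = solve-∀
      l₂ : ∀ y h z w v → w + z + (h * v + y) + h * w ≡ (1ℤ + h) * w + y + z + h * v
      l₂ = solve-∀

  private
    -- The limit a may have either sign, so Δ cannot simply be replaced by one end of its interval.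
    -- Replacing it by either end costs at most |a| times the width.
    tilt : ∀ a {lo Δ hi} → lo ≤ Δ → Δ ≤ hi →
           a * Δ ≤ a * lo + + ∣ a ∣ * (hi - lo) × a * Δ ≤ a * hi + + ∣ a ∣ * (hi - lo)
    tilt (+ k) {lo} {Δ} {hi} lo≤ ≤hi =
      lin≤ (scale k ≤hi) (l₁ (+ k) lo Δ hi) , lin≤₂ (scale k ≤hi) (scale k (≤-trans lo≤ ≤hi)) (l₂ (+ k) lo Δ hi)
      where
      l₁ : ∀ k lo Δ hi → k * Δ + k * hi ≡ k * lo + k * (hi - lo) + k * Δ
      l₁ = solve-∀
      l₂ : ∀ k lo Δ hi → k * Δ + k * hi + k * hi ≡ k * hi + k * (hi - lo) + k * Δ + k * lo
      l₂ = solve-∀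
    tilt -[1+ k ] {lo} {Δ} {hi} lo≤ ≤hi =
      lin≤₂ (scale (suc k) lo≤) (scale (suc k) (≤-trans lo≤ ≤hi)) (l₁ (+ suc k) lo Δ hi) , lin≤ (scale (suc k) lo≤) (l₂ (+ suc k) lo Δ hi)
      where
      l₁ : ∀ k lo Δ hi → - k * Δ + k * Δ + k * hi ≡ - k * lo + k * (hi - lo) + k * lo + k * lo
      l₁ = solve-∀
      l₂ : ∀ k lo Δ hi → - k * Δ + k * Δ ≡ - k * hi + k * (hi - lo) + k * lo
      l₂ = solve-∀

  -- The window [t , h + t] is short (h is about t/M) yet so long that the error of the sums,
  -- below 1/N of their size, remains small after division by h.
  module _ (d m α : ℕ) where

    private
      n = suc m
      c = slope d
      M-1 = 2 ℕ.* n ℕ.* α ℕ.* c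
      M = suc M-1
      L = 4 ℕ.* M
      N-1 = 8 ℕ.* n ℕ.* L ℕ.* suc c
      N = suc N-1

      -- The relative error is α c/M + 4 L (c + 1)/N. The first part stems from the growth of
      -- `binom d` over the window, the second from the error 1/N of the two sums, measured against
      -- h. The choices of M - 1 and N - 1 make each part at most 1/(2n), which is what `budget`
      -- checks.
      settle : ∀ {a x} β → + M * (+ N * x) ≤ + M * (+ N * a) * + β + + (N ℕ.* α ℕ.* c ℕ.+ 4 ℕ.* M ℕ.* L ℕ.* suc c) * + β →
               + n * x ≤ (+ n * a + 1ℤ) * + β
      settle {a} {x} β h = cancel 1 (cancel M-1 (cancel N-1 (lin≤₂ (scale (2 ℕ.* n) h) (cast≤ (2 ℕ.* n ℕ.* E) β (2 ℕ.* M ℕ.* N) β (ℕ.*-monoˡ-≤ β budget))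
          (trans (cong₂ (λ u v → + N * (+ M * (+ 2 * (+ n * x))) + u + v * + β)
                    (cong (λ w → w * (+ M * (+ N * a) * + β + + E * + β)) (pos-* 2 n))
                    (trans (pos-* (2 ℕ.* M) N) (cong (_* + N) (pos-* 2 M))))
          (trans (lem (+ N) (+ M) (+ n) x (+ β) a (+ E))
            (cong₂ (λ u v → + N * (+ M * (+ 2 * ((+ n * a + 1ℤ) * + β))) + u + v * + β)
                    (cong (_* (+ M * (+ N * x))) (sym (pos-* 2 n)))
                    (sym (trans (pos-* (2 ℕ.* n) E) (cong (_* + E) (pos-* 2 n))))))))))
        where
        E = N ℕ.* α ℕ.* c ℕ.+ 4 ℕ.* M ℕ.* L ℕ.* suc c
        lem : ∀ N M n x β a E → N * (M * (+ 2 * (n * x))) + + 2 * n * (M * (N * a) * β + E * β) + + 2 * M * N * β ≡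
              N * (M * (+ 2 * ((n * a + 1ℤ) * β))) + + 2 * n * (M * (N * x)) + + 2 * n * E * β
        lem = solve-∀
        budget : 2 ℕ.* n ℕ.* E ℕ.≤ 2 ℕ.* M ℕ.* N
        budget = begin
          2 ℕ.* n ℕ.* E                      ≡⟨ l₁ n N α c M L ⟩
          N ℕ.* M-1 ℕ.+ M ℕ.* N-1            ≤⟨ ℕ.+-mono-≤ (ℕ.*-monoʳ-≤ N (ℕ.n≤1+n M-1)) (ℕ.*-monoʳ-≤ M (ℕ.n≤1+n N-1)) ⟩
          N ℕ.* M ℕ.+ M ℕ.* N                ≡⟨ l₂ N M ⟩
          2 ℕ.* M ℕ.* N ∎
          where
          open ℕ.≤-Reasoning
          l₁ : ∀ n N α c M L → 2 ℕ.* n ℕ.* (N ℕ.* α ℕ.* c ℕ.+ 4 ℕ.* M ℕ.* L ℕ.* suc c) ≡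
               N ℕ.* (2 ℕ.* n ℕ.* α ℕ.* c) ℕ.+ M ℕ.* (8 ℕ.* n ℕ.* L ℕ.* suc c)
          l₁ = ℕ-Solver.solve-∀
          l₂ : ∀ N M → N ℕ.* M ℕ.+ M ℕ.* N ≡ 2 ℕ.* M ℕ.* N
          l₂ = ℕ-Solver.solve-∀

      module Window (t h-1 : ℕ) (short : suc h-1 ℕ.* M ℕ.≤ suc t) (long : suc (suc h-1 ℕ.+ t) ℕ.≤ L ℕ.* suc h-1) (d≤ : d ℕ.≤ suc h-1 ℕ.+ t) where

        h : ℕ
        h = suc h-1

        b b⁺ P P⁺ : ℕ
        b = binom d t
        b⁺ = binom d (h ℕ.+ t)
        P = binom (suc d) t
        P⁺ = binom (suc d) (h ℕ.+ t)

        Δ-lower : + h * + b ≤ + P⁺ - + P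
        Δ-lower = lin≤ (subst (_≤ + P⁺) (cong (_+ + P) (pos-* h b)) (+≤+ (proj₁ (binom-increment d t h)))) (lem (+ h * + b) (+ P) (+ P⁺))
          where
          lem : ∀ x p q → x + q ≡ q - p + (x + p)
          lem = solve-∀
        Δ-upper : + P⁺ - + P ≤ + h * + b⁺
        Δ-upper = lin≤ (subst (+ P⁺ ≤_) (cong (_+ + P) (pos-* h b⁺)) (+≤+ (proj₂ (binom-increment d t h)))) (lem (+ h * + b⁺) (+ P) (+ P⁺))
          where
          lem : ∀ x p q → q - p + (x + p) ≡ x + q
          lem = solve-∀

        P-bound : + P⁺ + + P ≤ + h * (+ (4 ℕ.* L) * + b⁺)
        P-bound = subst (+ P⁺ + + P ≤_) (trans (pos-* h _) (cong (_*_ (+ h)) (pos-* (4 ℕ.* L) b⁺))) (+≤+ (begin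
          P⁺ ℕ.+ P                                       ≤⟨ ℕ.+-monoʳ-≤ P⁺ (binom-mono (suc d) t h) ⟩
          P⁺ ℕ.+ P⁺                                      ≤⟨ ℕ.+-mono-≤ P⁺≤ P⁺≤ ⟩
          2 ℕ.* (L ℕ.* h) ℕ.* b⁺ ℕ.+ 2 ℕ.* (L ℕ.* h) ℕ.* b⁺ ≡⟨ lem L h b⁺ ⟩
          h ℕ.* (4 ℕ.* L ℕ.* b⁺) ∎))
          where
          open ℕ.≤-Reasoning
          P⁺≤ : P⁺ ℕ.≤ 2 ℕ.* (L ℕ.* h) ℕ.* b⁺
          P⁺≤ = ℕ.≤-trans (binom-absorb-≤ d (h ℕ.+ t) d≤) (ℕ.*-monoˡ-≤ b⁺ (ℕ.*-monoʳ-≤ 2 long))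
          lem : ∀ L h b → 2 ℕ.* (L ℕ.* h) ℕ.* b ℕ.+ 2 ℕ.* (L ℕ.* h) ℕ.* b ≡ h ℕ.* (4 ℕ.* L ℕ.* b)
          lem = ℕ-Solver.solve-∀

        growth : + M * + b⁺ ≤ (+ M + + c) * + b
        growth = cast≤ M b⁺ (M ℕ.+ c) b (binom-growth d M-1 t h short)

        -- `β` is `b` in the upper estimate, where f is taken at the left end of the window, and
        -- `b⁺` in the lower one, where -f is taken at the right end. The value at that end, times
        -- h, is at most the increment of the sum of f or of -f.
        finish : ∀ {a x} β → ∣ a ∣ ≡ α → b ℕ.≤ β → a * (+ P⁺ - + P) ≤ a * (+ h * + β) + + ∣ a ∣ * (+ h * + b⁺ - + h * + b) →
                 + N * (+ h * x) ≤ + N * (a * (+ P⁺ - + P)) + (+ P⁺ + + P) → + n * x ≤ (+ n * a + 1ℤ) * + β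
        finish {a} {x} β refl b≤β tilted summed = settle {a} {x} β (≤-trans
          (lin≤₂ (scale M local) (scale (N ℕ.* α ℕ.+ 4 ℕ.* L) growth)
            (trans (cong (λ z → + M * (+ N * x) + + M * (+ N * (a * + β + + α * (+ b⁺ - + b)) + + (4 ℕ.* L) * + b⁺) + (z + + (4 ℕ.* L)) * ((+ M + + c) * + b)) (pos-* N α))
            (trans (lem′ (+ M) (+ N) x a (+ β) (+ α) (+ b⁺) (+ b) (+ (4 ℕ.* L)) (+ c))
              (cong₂ (λ y z → + M * (+ N * a) * + β + y * + b + + M * (+ N * x) + (z + + (4 ℕ.* L)) * (+ M * + b⁺))
                (sym (cong₂ _+_ (trans (pos-* (N ℕ.* α) c) (cong (_* + c) (pos-* N α))) (pos-* (4 ℕ.* L) (M ℕ.+ c)))) (sym (pos-* N α))))))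
          (+-monoʳ-≤ (+ M * (+ N * a) * + β) (cast≤ Q b E β (ℕ.*-mono-≤ Q≤E b≤β))))
          where
          local : + N * x ≤ + N * (a * + β + + α * (+ b⁺ - + b)) + + (4 ℕ.* L) * + b⁺
          local = cancel h-1 (lin≤₂ (≤-trans summed (+-monoʳ-≤ (+ N * (a * (+ P⁺ - + P))) P-bound)) (scale N tilted)
            (lem (+ N) (+ h) x a (+ β) (+ α) (+ b⁺) (+ b) (+ P⁺ - + P) (+ (4 ℕ.* L))))
            where
            lem : ∀ N h x a β α u v Δ L → h * (N * x) + (N * (a * Δ) + h * (L * u)) + N * (a * (h * β) + α * (h * u - h * v)) ≡
                  h * (N * (a * β + α * (u - v)) + L * u) + N * (h * x) + N * (a * Δ)
            lem = solve-∀
          Q = N ℕ.* α ℕ.* c ℕ.+ 4 ℕ.* L ℕ.* (M ℕ.+ c)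
          E = N ℕ.* α ℕ.* c ℕ.+ 4 ℕ.* M ℕ.* L ℕ.* suc c
          Q≤E : Q ℕ.≤ E
          Q≤E = ℕ.+-monoʳ-≤ (N ℕ.* α ℕ.* c) (ℕ.≤-trans (ℕ.m≤m+n _ (4 ℕ.* L ℕ.* (M-1 ℕ.* c))) (ℕ.≤-reflexive (l L M-1 c)))
            where
            l : ∀ L M c → 4 ℕ.* L ℕ.* (suc M ℕ.+ c) ℕ.+ 4 ℕ.* L ℕ.* (M ℕ.* c) ≡ 4 ℕ.* suc M ℕ.* L ℕ.* suc c
            l = ℕ-Solver.solve-∀
          lem′ : ∀ M N x a β α u v L c → M * (N * x) + M * (N * (a * β + α * (u - v)) + L * u) + (N * α + L) * ((M + c) * v) ≡
                 M * (N * a) * β + (N * α * c + L * (M + c)) * v + M * (N * x) + (N * α + L) * (M * u)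
          lem′ = solve-∀

    private
      upper-window : ∀ t → M ℕ.≤ suc t → ∃ λ h-1 → suc h-1 ℕ.* M ℕ.≤ suc t × suc (suc h-1 ℕ.+ t) ℕ.≤ L ℕ.* suc h-1
      upper-window t M≤ with suc t / M in eq
      ... | zero = contradiction (subst (0 ℕ.<_) eq (ℕ.m≥n⇒m/n>0 M≤)) λ ()
      ... | suc h-1 = h-1 , subst (λ h → h ℕ.* M ℕ.≤ suc t) eq (ℕ.m/n*n≤m (suc t) M) , (begin
        suc (suc h-1 ℕ.+ t)                                  ≡⟨ cong suc (ℕ.+-suc h-1 t) ⟨
        suc (h-1 ℕ.+ suc t)                                  ≤⟨ ℕ.+-monoʳ-≤ (suc h-1) near ⟩
        suc h-1 ℕ.+ (M ℕ.+ suc h-1 ℕ.* M)                    ≤⟨ ℕ.m≤m+n _ (M-1 ℕ.* suc h-1 ℕ.+ h-1 ℕ.* M ℕ.+ M ℕ.* suc h-1) ⟩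
        _                                                    ≡⟨ lem h-1 M-1 ⟩
        L ℕ.* suc h-1 ∎)
        where
        open ℕ.≤-Reasoning
        near : suc t ℕ.≤ M ℕ.+ suc h-1 ℕ.* M
        near = ℕ.≤-trans (ℕ.≤-reflexive (trans (ℕ.m≡m%n+[m/n]*n (suc t) M) (cong (λ h → suc t ℕ.% M ℕ.+ h ℕ.* M) eq)))
                 (ℕ.+-monoˡ-≤ (suc h-1 ℕ.* M) (ℕ.<⇒≤ (ℕ.m%n<n (suc t) M)))
        lem : ∀ h M → suc h ℕ.+ (suc M ℕ.+ suc h ℕ.* suc M) ℕ.+ (M ℕ.* suc h ℕ.+ h ℕ.* suc M ℕ.+ suc M ℕ.* suc h) ≡ 4 ℕ.* suc M ℕ.* suc h
        lem = ℕ-Solver.solve-∀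

      -- Here t is the right end. Division by M + 1 instead of M leaves h M ≤ t₀ + 1 after h has
      -- been subtracted; and since M + 1 ≥ 2, the window takes up at most about half of t, so that
      -- t₀ still exceeds T.
      lower-window : ∀ T t → M ℕ.+ (T ℕ.+ T) ℕ.≤ t → ∃ λ h-1 → ∃ λ t₀ → t ≡ suc h-1 ℕ.+ t₀ × T ℕ.≤ t₀ ×
                     suc h-1 ℕ.* M ℕ.≤ suc t₀ × suc (suc h-1 ℕ.+ t₀) ℕ.≤ L ℕ.* suc h-1
      lower-window T t T≤ with suc t / suc M in eq
      ... | zero = contradiction (subst (0 ℕ.<_) eq (ℕ.m≥n⇒m/n>0 (s≤s (ℕ.m+n≤o⇒m≤o M T≤)))) λ ()
      ... | suc h-1 = h-1 , t₀ , sym (ℕ.m+[n∸m]≡n h≤t) , T≤t₀ , short , long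
        where
        open ℕ.≤-Reasoning
        h = suc h-1
        t₀ = t ∸ h
        fits : h ℕ.* suc M ℕ.≤ suc t
        fits = subst (λ h → h ℕ.* suc M ℕ.≤ suc t) eq (ℕ.m/n*n≤m (suc t) (suc M))
        2h≤ : h ℕ.+ h ℕ.≤ suc t
        2h≤ = ℕ.≤-trans (ℕ.m≤m+n _ (h ℕ.* M-1)) (ℕ.≤-trans (ℕ.≤-reflexive (lem h M-1)) fits)
          where
          lem : ∀ h M → h ℕ.+ h ℕ.+ h ℕ.* M ≡ h ℕ.* suc (suc M)
          lem = ℕ-Solver.solve-∀
        h≤t : h ℕ.≤ t
        h≤t = ℕ.≤-trans (ℕ.m≤n+m h h-1) (ℕ.s≤s⁻¹ 2h≤)
        t≡ : h ℕ.+ t₀ ≡ t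
        t≡ = ℕ.m+[n∸m]≡n h≤t
        T≤t₀ : T ℕ.≤ t₀
        T≤t₀ = ℕ.*-cancelˡ-≤ 2 (ℕ.+-cancelˡ-≤ (h ℕ.+ h) _ _ (begin
          h ℕ.+ h ℕ.+ 2 ℕ.* T         ≤⟨ ℕ.+-monoˡ-≤ (2 ℕ.* T) 2h≤ ⟩
          suc t ℕ.+ 2 ℕ.* T           ≤⟨ ℕ.≤-trans (ℕ.≤-reflexive (l₁ t T)) (ℕ.+-monoʳ-≤ t (ℕ.+-monoˡ-≤ (T ℕ.+ T) (s≤s (z≤n {M-1})))) ⟩
          t ℕ.+ (M ℕ.+ (T ℕ.+ T))     ≤⟨ ℕ.+-monoʳ-≤ t T≤ ⟩
          t ℕ.+ t                     ≡⟨ cong₂ ℕ._+_ t≡ t≡ ⟨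
          h ℕ.+ t₀ ℕ.+ (h ℕ.+ t₀)     ≡⟨ l₂ h t₀ ⟩
          h ℕ.+ h ℕ.+ 2 ℕ.* t₀ ∎))
          where
          l₁ : ∀ t T → suc t ℕ.+ 2 ℕ.* T ≡ t ℕ.+ (1 ℕ.+ (T ℕ.+ T))
          l₁ = ℕ-Solver.solve-∀
          l₂ : ∀ h t → h ℕ.+ t ℕ.+ (h ℕ.+ t) ≡ h ℕ.+ h ℕ.+ 2 ℕ.* t
          l₂ = ℕ-Solver.solve-∀
        short : h ℕ.* M ℕ.≤ suc t₀
        short = ℕ.+-cancelˡ-≤ h _ _ (begin
          h ℕ.+ h ℕ.* M       ≡⟨ ℕ.*-suc h M ⟨
          h ℕ.* suc M         ≤⟨ fits ⟩
          suc t               ≡⟨ cong suc t≡ ⟨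
          suc (h ℕ.+ t₀)      ≡⟨ ℕ.+-suc h t₀ ⟨
          h ℕ.+ suc t₀ ∎)
        long : suc (h ℕ.+ t₀) ℕ.≤ L ℕ.* h
        long = begin
          suc (h ℕ.+ t₀)                        ≡⟨ cong suc t≡ ⟩
          suc t                                 ≡⟨ ℕ.m≡m%n+[m/n]*n (suc t) (suc M) ⟩
          suc t ℕ.% suc M ℕ.+ suc t / suc M ℕ.* suc M ≡⟨ cong (λ h → suc t ℕ.% suc M ℕ.+ h ℕ.* suc M) eq ⟩
          suc t ℕ.% suc M ℕ.+ h ℕ.* suc M       ≤⟨ ℕ.+-monoˡ-≤ (h ℕ.* suc M) (ℕ.<⇒≤ (ℕ.m%n<n (suc t) (suc M))) ⟩
          suc M ℕ.+ h ℕ.* suc M                 ≤⟨ ℕ.m≤m+n _ (h-1 ℕ.* suc M ℕ.+ 2 ℕ.* M-1 ℕ.* h) ⟩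
          suc M ℕ.+ h ℕ.* suc M ℕ.+ (h-1 ℕ.* suc M ℕ.+ 2 ℕ.* M-1 ℕ.* h) ≡⟨ lem h-1 M-1 ⟩
          L ℕ.* h ∎
          where
          lem : ∀ h M → suc (suc M) ℕ.+ suc h ℕ.* suc (suc M) ℕ.+ (h ℕ.* suc (suc M) ℕ.+ 2 ℕ.* M ℕ.* suc h) ≡ 4 ℕ.* suc M ℕ.* suc h
          lem = ℕ-Solver.solve-∀

    module _ {f : ℕ → ℤ} (mono : ∀ t → f t ≤ f (suc t)) {a : ℤ} (α≡ : ∣ a ∣ ≡ α)
             (up : Below (binom (suc d)) (total f) a) (down : Below (binom (suc d)) (-_ ∘ total f) (- a)) where

      private
        -- `d` is included because the bound of the sums by h times `b⁺` rests on `binom-absorb-≤`.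
        T = d ⊔ (proj₁ (bound up N-1) ⊔ proj₁ (bound down N-1))

        up-T : ∀ t → T ℕ.≤ t → + N * total f t ≤ (+ N * a + 1ℤ) * + binom (suc d) t
        up-T t T≤ = proj₂ (bound up N-1) t (ℕ.m⊔n≤o⇒m≤o (proj₁ (bound up N-1)) _ (ℕ.m⊔n≤o⇒n≤o d _ T≤))
        down-T : ∀ t → T ℕ.≤ t → + N * - total f t ≤ (+ N * - a + 1ℤ) * + binom (suc d) t
        down-T t T≤ = proj₂ (bound down N-1) t (ℕ.m⊔n≤o⇒n≤o (proj₁ (bound up N-1)) _ (ℕ.m⊔n≤o⇒n≤o d _ T≤))

      tauber-upper : ∃ λ T → ∀ t → T ℕ.≤ t → + n * f t ≤ (+ n * a + 1ℤ) * + binom d t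
      tauber-upper = T ℕ.+ M , λ t T≤ → let h-1 , short , long = upper-window t (ℕ.m≤n⇒m≤1+n (ℕ.m+n≤o⇒n≤o T T≤)) in
        estimate t h-1 (ℕ.m+n≤o⇒m≤o T T≤) short long
        where
        estimate : ∀ t h-1 → T ℕ.≤ t → suc h-1 ℕ.* M ℕ.≤ suc t → suc (suc h-1 ℕ.+ t) ℕ.≤ L ℕ.* suc h-1 →
                   + n * f t ≤ (+ n * a + 1ℤ) * + binom d t
        estimate t h-1 T≤t short long = W.finish {a} {f t} W.b α≡ ℕ.≤-refl (proj₁ (tilt a W.Δ-lower W.Δ-upper))
          (lin≤₂ (scale N (proj₁ (total-increment mono t h))) (+-mono-≤ (up-T (h ℕ.+ t) T≤h+t) (down-T t T≤t))
            (lem (+ N) (+ h) (f t) (total f t) (total f (h ℕ.+ t)) a (+ W.P) (+ W.P⁺)))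
          where
          h = suc h-1
          T≤h+t = ℕ.≤-trans T≤t (ℕ.m≤n+m t h)
          module W = Window t h-1 short long (ℕ.≤-trans (ℕ.m⊔n≤o⇒m≤o d _ T≤t) (ℕ.m≤n+m t h))
          lem : ∀ N h x F G a P Q → N * (h * x) + N * G + ((N * a + 1ℤ) * Q + (N * - a + 1ℤ) * P) ≡
                N * (a * (Q - P)) + (Q + P) + N * (h * x + F) + (N * G + N * - F)
          lem = solve-∀

      tauber-lower : ∃ λ T → ∀ t → T ℕ.≤ t → + n * - f t ≤ (+ n * - a + 1ℤ) * + binom d t
      tauber-lower = M ℕ.+ (T ℕ.+ T) , λ t T≤ → let h-1 , t₀ , t≡ , T≤t₀ , short , long = lower-window T t T≤ in
        subst (λ t → + n * - f t ≤ (+ n * - a + 1ℤ) * + binom d t) (sym t≡) (estimate t₀ h-1 T≤t₀ short long)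
        where
        estimate : ∀ t h-1 → T ℕ.≤ t → suc h-1 ℕ.* M ℕ.≤ suc t → suc (suc h-1 ℕ.+ t) ℕ.≤ L ℕ.* suc h-1 →
                   + n * - f (suc h-1 ℕ.+ t) ≤ (+ n * - a + 1ℤ) * + binom d (suc h-1 ℕ.+ t)
        estimate t h-1 T≤t short long = W.finish { - a} { - f (h ℕ.+ t)} W.b⁺ (trans (∣-i∣≡∣i∣ a) α≡) (binom-mono d t h) (proj₂ (tilt (- a) W.Δ-lower W.Δ-upper))
          (lin≤₂ (scale N (proj₂ (total-increment mono t h))) (+-mono-≤ (up-T t T≤t) (down-T (h ℕ.+ t) T≤h+t))
            (lem (+ N) (+ h) (f (h ℕ.+ t)) (total f t) (total f (h ℕ.+ t)) a (+ W.P) (+ W.P⁺)))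
          where
          h = suc h-1
          T≤h+t = ℕ.≤-trans T≤t (ℕ.m≤n+m t h)
          module W = Window t h-1 short long (ℕ.≤-trans (ℕ.m⊔n≤o⇒m≤o d _ T≤t) (ℕ.m≤n+m t h))
          lem : ∀ N h x F G a P Q → N * (h * - x) + N * (h * x + F) + ((N * a + 1ℤ) * P + (N * - a + 1ℤ) * Q) ≡
                N * (- a * (Q - P)) + (Q + P) + N * G + (N * F + N * - G)
          lem = solve-∀

  tends-untotal : ∀ d {f a} → (∀ t → f t ≤ f (suc t)) → Tends (binom (suc d)) (total f) a → Tends (binom d) f a
  tends-untotal d {a = a} mono (up , down) =
    mkBelow (λ m → tauber-upper d m ∣ a ∣ mono refl up down) , mkBelow (λ m → tauber-lower d m ∣ a ∣ mono refl up down)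

-- Integers inside ℚ, and common denominators

module Rationals where

  open import Data.Nat.Base as ℕ using (ℕ; zero; suc)
  open import Data.Nat.Coprimality as Coprimality using (1-coprimeTo)
  open import Data.Integer.Base as ℤ using (ℤ; +_; -[1+_]; 1ℤ)
  import Data.Integer.Properties as ℤ
  open import Data.Rational.Base
  open import Data.Rational.Properties
  open import Data.Rational.Unnormalised.Base as ℚᵘ using (*≡*)
  import Data.Rational.Unnormalised.Properties as ℚᵘ
  open import Data.Fin.Base using (Fin; zero; suc; combine; remQuot)
  open import Data.Fin.Properties using (remQuot-combine)
  open import Data.Product.Base using (Σ; ∃; _,_; proj₁; proj₂)
  open import Function.Base using (_∘_)
  open import Relation.Binary.PropositionalEquality
  open Flows using (sum)
  open import Defs using (∑; ℤ→ℚ; ℕ→ℚ)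

  -- `z / 1` is normalised by a gcd and does not compute for a variable z. In this canonical form
  -- the arithmetic and order of ℚ reduce to those of ℤ.
  integral : ∀ z → ℤ→ℚ z ≡ mkℚ z 0 (Coprimality.sym (1-coprimeTo ℤ.∣ z ∣))
  integral z = ↥p/↧p≡p (mkℚ z 0 (Coprimality.sym (1-coprimeTo ℤ.∣ z ∣)))

  ℤ→ℚ-+ : ∀ y z → ℤ→ℚ (y ℤ.+ z) ≡ ℤ→ℚ y + ℤ→ℚ z
  ℤ→ℚ-+ y z = trans (cong (_/ 1) (sym (cong₂ ℤ._+_ (ℤ.*-identityʳ y) (ℤ.*-identityʳ z)))) (sym (cong₂ _+_ (integral y) (integral z)))

  ℤ→ℚ-* : ∀ y z → ℤ→ℚ (y ℤ.* z) ≡ ℤ→ℚ y * ℤ→ℚ z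
  ℤ→ℚ-* y z = sym (cong₂ _*_ (integral y) (integral z))

  ℤ→ℚ-neg : ∀ z → ℤ→ℚ (ℤ.- z) ≡ - ℤ→ℚ z
  ℤ→ℚ-neg z = trans (integral (ℤ.- z)) (trans (lem z) (cong -_ (sym (integral z))))
    where
    lem : ∀ z → mkℚ (ℤ.- z) 0 (Coprimality.sym (1-coprimeTo ℤ.∣ ℤ.- z ∣)) ≡ - mkℚ z 0 (Coprimality.sym (1-coprimeTo ℤ.∣ z ∣))
    lem (+ zero) = refl
    lem (+ suc n) = refl
    lem -[1+ n ] = refl

  ℤ→ℚ-injective : ∀ {y z} → ℤ→ℚ y ≡ ℤ→ℚ z → y ≡ z
  ℤ→ℚ-injective {y} {z} eq = cong ↥_ (trans (sym (integral y)) (trans eq (integral z)))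

  ℤ→ℚ-mono-≤ : ∀ {y z} → y ℤ.≤ z → ℤ→ℚ y ≤ ℤ→ℚ z
  ℤ→ℚ-mono-≤ {y} {z} h = subst₂ _≤_ (sym (integral y)) (sym (integral z)) (*≤* (ℤ.*-monoʳ-≤-nonNeg 1ℤ h))

  ℤ→ℚ-mono-< : ∀ {y z} → y ℤ.< z → ℤ→ℚ y < ℤ→ℚ z
  ℤ→ℚ-mono-< {y} {z} h = subst₂ _<_ (sym (integral y)) (sym (integral z)) (*<* (ℤ.*-monoʳ-<-pos 1ℤ h))

  ℤ→ℚ-cancel-≤ : ∀ {y z} → ℤ→ℚ y ≤ ℤ→ℚ z → y ℤ.≤ z
  ℤ→ℚ-cancel-≤ {y} {z} h with subst₂ _≤_ (integral y) (integral z) h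
  ... | *≤* le = subst₂ ℤ._≤_ (ℤ.*-identityʳ y) (ℤ.*-identityʳ z) le

  *-denominator : ∀ q → q * ℤ→ℚ (↧ q) ≡ ℤ→ℚ (↥ q)
  *-denominator q@(mkℚ n d-1 _) = toℚᵘ-injective (ℚᵘ.≃-trans (toℚᵘ-homo-* q (ℤ→ℚ (↧ q)))
    (ℚᵘ.≃-trans (ℚᵘ.*-cong (ℚᵘ.≃-refl {toℚᵘ q}) (ℚᵘ.≃-reflexive (cong toℚᵘ (integral (↧ q)))))
    (ℚᵘ.≃-trans (*≡* (lem n (↧ q))) (ℚᵘ.≃-reflexive (cong toℚᵘ (sym (integral n)))))))
    where
    lem : ∀ n d → n ℤ.* d ℤ.* 1ℤ ≡ n ℤ.* (d ℤ.* 1ℤ)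
    lem n d = ℤ.*-assoc n d 1ℤ

  ∑-ℕ→ℚ : ∀ {n} (f : Fin n → ℚ) (g : Fin n → ℕ) x → (∀ i → f i * x ≡ ℕ→ℚ (g i)) → ∑ f * x ≡ ℕ→ℚ (sum g)
  ∑-ℕ→ℚ {zero} f g x eq = *-zeroˡ x
  ∑-ℕ→ℚ {suc n} f g x eq = begin
    (f zero + ∑ (f ∘ suc)) * x                ≡⟨ *-distribʳ-+ x (f zero) (∑ (f ∘ suc)) ⟩
    f zero * x + ∑ (f ∘ suc) * x              ≡⟨ cong₂ _+_ (eq zero) (∑-ℕ→ℚ (f ∘ suc) (g ∘ suc) x (eq ∘ suc)) ⟩
    ℕ→ℚ (g zero) + ℕ→ℚ (sum (g ∘ suc))        ≡⟨ ℤ→ℚ-+ (+ g zero) (+ sum (g ∘ suc)) ⟨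
    ℕ→ℚ (sum g) ∎
    where open ≡-Reasoning

  numerator-nonneg : ∀ q → 0ℚ ≤ q → ↥ q ≡ + ℤ.∣ ↥ q ∣
  numerator-nonneg (mkℚ (+ _) _ _) _ = refl
  numerator-nonneg (mkℚ -[1+ _ ] _ _) (*≤* ())

  common-denominator : ∀ {n} (f : Fin n → ℚ) → (∀ i → 0ℚ ≤ f i) →
                       ∃ λ D-1 → Σ (Fin n → ℕ) λ g → ∀ i → f i * ℕ→ℚ (suc D-1) ≡ ℕ→ℚ (g i)
  common-denominator {zero} f nonneg = 0 , (λ ()) , λ ()
  common-denominator {suc n} f nonneg with common-denominator (f ∘ suc) (nonneg ∘ suc)
  ... | D-1 , g , eq = D-1 ℕ.+ d-1 ℕ.* suc D-1 , g′ , eq′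
    where
    open ≡-Reasoning
    q = f zero
    d-1 = ℚ.denominator-1 q
    g′ : Fin (suc n) → ℕ
    g′ zero = ℤ.∣ ↥ q ∣ ℕ.* suc D-1
    g′ (suc i) = g i ℕ.* suc d-1
    split : ℕ→ℚ (suc d-1 ℕ.* suc D-1) ≡ ℤ→ℚ (+ suc d-1) * ℤ→ℚ (+ suc D-1)
    split = trans (cong ℤ→ℚ (ℤ.pos-* (suc d-1) (suc D-1))) (ℤ→ℚ-* (+ suc d-1) (+ suc D-1))
    eq′ : ∀ i → f i * ℕ→ℚ (suc d-1 ℕ.* suc D-1) ≡ ℕ→ℚ (g′ i)
    eq′ zero = begin
      q * ℕ→ℚ (suc d-1 ℕ.* suc D-1)                ≡⟨ cong (q *_) split ⟩
      q * (ℤ→ℚ (+ suc d-1) * ℤ→ℚ (+ suc D-1))      ≡⟨ *-assoc q _ _ ⟨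
      q * ℤ→ℚ (↧ q) * ℤ→ℚ (+ suc D-1)              ≡⟨ cong (_* ℤ→ℚ (+ suc D-1)) (trans (*-denominator q) (cong ℤ→ℚ (numerator-nonneg q (nonneg zero)))) ⟩
      ℤ→ℚ (+ ℤ.∣ ↥ q ∣) * ℤ→ℚ (+ suc D-1)          ≡⟨ ℤ→ℚ-* (+ ℤ.∣ ↥ q ∣) (+ suc D-1) ⟨
      ℤ→ℚ (+ ℤ.∣ ↥ q ∣ ℤ.* + suc D-1)              ≡⟨ cong ℤ→ℚ (ℤ.pos-* ℤ.∣ ↥ q ∣ (suc D-1)) ⟨
      ℕ→ℚ (g′ zero) ∎
    eq′ (suc i) = begin
      f (suc i) * ℕ→ℚ (suc d-1 ℕ.* suc D-1)            ≡⟨ cong (f (suc i) *_) (trans split (*-comm (ℤ→ℚ (+ suc d-1)) _)) ⟩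
      f (suc i) * (ℤ→ℚ (+ suc D-1) * ℤ→ℚ (+ suc d-1))  ≡⟨ *-assoc (f (suc i)) _ _ ⟨
      f (suc i) * ℤ→ℚ (+ suc D-1) * ℤ→ℚ (+ suc d-1)    ≡⟨ cong (_* ℤ→ℚ (+ suc d-1)) (eq i) ⟩
      ℕ→ℚ (g i) * ℤ→ℚ (+ suc d-1)                      ≡⟨ ℤ→ℚ-* (+ g i) (+ suc d-1) ⟨
      ℤ→ℚ (+ g i ℤ.* + suc d-1)                        ≡⟨ cong ℤ→ℚ (ℤ.pos-* (g i) (suc d-1)) ⟨
      ℕ→ℚ (g i ℕ.* suc d-1) ∎

  common-denominator₂ : ∀ {n} (f : Fin n → Fin n → ℚ) → (∀ i j → 0ℚ ≤ f i j) →
                        ∃ λ D-1 → Σ (Fin n → Fin n → ℕ) λ g → ∀ i j → f i j * ℕ→ℚ (suc D-1) ≡ ℕ→ℚ (g i j)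
  common-denominator₂ {n} f nonneg
    with common-denominator {n ℕ.* n} (λ k → f (proj₁ (remQuot {n} n k)) (proj₂ (remQuot {n} n k))) (λ k → nonneg _ _)
  ... | D-1 , g , eq = D-1 , (λ i j → g (combine i j)) , λ i j →
    subst (λ (i′ , j′) → f i′ j′ * ℕ→ℚ (suc D-1) ≡ ℕ→ℚ (g (combine i j))) (remQuot-combine {n} i j) (eq (combine i j))

-- Lattice points of the dilates

module LatticePoints where

  open import Data.Nat.Base as ℕ using (ℕ; zero; suc)
  open import Data.Integer.Base as ℤ using (ℤ; +_)
  import Data.Integer.Properties as ℤ
  open import Data.Rational.Base using (ℚ; 0ℚ; 1ℚ; _*_)
  import Data.Rational.Properties as ℚ
  open import Data.Bool.Base using (true)
  import Data.Bool.Properties as Bool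
  open import Data.Fin.Base using (Fin; zero; suc)
  open import Data.Fin.Properties using (_≟_)
  open import Data.Vec.Base as Vec using (Vec)
  open import Data.Vec.Properties using (lookup∘tabulate; tabulate∘lookup; tabulate-cong)
  open import Data.List.Base as List using (List; _∷_; length)
  open import Data.List.Properties using (length-tabulate)
  open import Data.List.Membership.Propositional using (_∈_)
  open import Data.List.Membership.Propositional.Properties using (∈-tabulate⁺; ∈-tabulate⁻; ∈-lookup)
  open import Data.List.Relation.Unary.Any using (index)
  open import Data.List.Relation.Unary.Any.Properties using (lookup-index)
  open import Data.List.Relation.Unary.All as All using (All)
  open import Data.List.Relation.Unary.AllPairs using (_∷_)
  open import Data.List.Relation.Unary.Unique.Propositional using (Unique)
  open import Data.List.Relation.Unary.Unique.Propositional.Properties using (tabulate⁺)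
  open import Data.Product.Base using (Σ; _×_; _,_)
  open import Data.Sum.Base using (inj₁; inj₂)
  open import Function.Base using (_∘_)
  open import Function.Bundles using (_⇔_; mk⇔; Equivalence)
  open import Relation.Binary.PropositionalEquality
  open import Relation.Binary.Definitions using (Decidable)
  open import Relation.Nullary
  open Flows
  open Cones
  open Counting
  open Rationals
  open import Defs using (SimpleGraph; adj; Allowed; ∑; ℤ→ℚ; ℕ→ℚ; InDilate; LatticeCount)

  point : ∀ {N} → Vec ℤ N × Vec ℤ N → Point N
  point (x , y) (inj₁ i) = Vec.lookup x i
  point (x , y) (inj₂ j) = Vec.lookup y j

  unpoint : ∀ {N} → Point N → Vec ℤ N × Vec ℤ N
  unpoint p = Vec.tabulate (p ∘ inj₁) , Vec.tabulate (p ∘ inj₂)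

  point-unpoint : ∀ {N} (p : Point N) → point (unpoint p) ≈ p
  point-unpoint p (inj₁ i) = lookup∘tabulate (p ∘ inj₁) i
  point-unpoint p (inj₂ j) = lookup∘tabulate (p ∘ inj₂) j

  unpoint-cong : ∀ {N} {p q : Point N} → p ≈ q → unpoint p ≡ unpoint q
  unpoint-cong eq = cong₂ _,_ (tabulate-cong (eq ∘ inj₁)) (tabulate-cong (eq ∘ inj₂))

  unpoint-point : ∀ {N} (v : Vec ℤ N × Vec ℤ N) → unpoint (point v) ≡ v
  unpoint-point (x , y) = cong₂ _,_ (tabulate∘lookup x) (tabulate∘lookup y)

  lookup-injective : ∀ {A : Set} {L : List A} → Unique L → ∀ {i j} → List.lookup L i ≡ List.lookup L j → i ≡ j
  lookup-injective {L = _ ∷ _} u {zero} {zero} eq = refl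
  lookup-injective {L = _ ∷ L} (x∉ ∷ u) {zero} {suc j} eq = contradiction eq (All.lookup x∉ (∈-lookup j))
  lookup-injective {L = _ ∷ L} (x∉ ∷ u) {suc i} {zero} eq = contradiction (sym eq) (All.lookup x∉ (∈-lookup i))
  lookup-injective {L = _ ∷ L} (_ ∷ u) {suc i} {suc j} eq = cong suc (lookup-injective u eq)

  module _ {N} {P : Point N → Set} {I : Vec ℤ N × Vec ℤ N → Set} (P-resp : ∀ {p q} → p ≈ q → P p → P q)
           (to : ∀ v → P (point v) → I v) (from : ∀ v → I v → P (point v)) where

    card⇒list : ∀ {c} → Card P c → Σ (List (Vec ℤ N × Vec ℤ N)) λ L → Unique L × (∀ v → v ∈ L ⇔ I v) × length L ≡ c
    card⇒list card = List.tabulate vecs , tabulate⁺ inj , (λ v → mk⇔ (into v) (onto v)) , length-tabulate vecs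
      where
      vecs : Fin _ → Vec ℤ N × Vec ℤ N
      vecs i = unpoint (enum card i)
      inj : ∀ {i j} → vecs i ≡ vecs j → i ≡ j
      inj {i} {j} eq = distinct card (≈-trans (≈-sym (point-unpoint (enum card i))) (≈-trans (λ c → cong (λ v → point v c) eq) (point-unpoint (enum card j))))
      into : ∀ v → v ∈ List.tabulate vecs → I v
      into v v∈ with ∈-tabulate⁻ v∈
      ... | i , refl = to (vecs i) (P-resp (≈-sym (point-unpoint (enum card i))) (sound card i))
      onto : ∀ v → I v → v ∈ List.tabulate vecs
      onto v d with complete card (from v d)
      ... | i , eq = subst (_∈ List.tabulate vecs) (trans (sym (unpoint-cong eq)) (unpoint-point v)) (∈-tabulate⁺ i)

    list⇒card : (L : List (Vec ℤ N × Vec ℤ N)) → Unique L → (∀ v → v ∈ L ⇔ I v) → Card P (length L)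
    list⇒card L uniq mem .enum i = point (List.lookup L i)
    list⇒card L uniq mem .sound i = from _ (Equivalence.to (mem _) (∈-lookup i))
    list⇒card L uniq mem .distinct eq =
      lookup-injective uniq (trans (sym (unpoint-point _)) (trans (unpoint-cong eq) (unpoint-point _)))
    list⇒card L uniq mem .complete {p} x = index p∈ , ≈-trans (≈-sym (point-unpoint p)) (λ c → cong (λ v → point v c) (lookup-index p∈))
      where
      p∈ : unpoint p ∈ L
      p∈ = Equivalence.from (mem (unpoint p)) (to (unpoint p) (P-resp (≈-sym (point-unpoint p)) x))

  module _ {N} (G : SimpleGraph N) where

    allowed? : Decidable (Allowed G)
    allowed? i j = (i ≟ j) ⊎-dec (adj G i j Bool.≟ true)

    cone⇒dilate : ∀ t v → Cone (Allowed G) t (point v) → InDilate G t v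
    cone⇒dilate t v κ with toMatrix κ
    ... | μ , supp , rows , cols , deg =
      (λ i j → ℕ→ℚ (μ i j)) , (λ i j → ℤ→ℚ-mono-≤ {+ 0} {+ μ i j} (ℤ.+≤+ ℕ.z≤n)) , off ,
      trans (sums (λ i → ∑ (λ j → ℕ→ℚ (μ i j))) (row μ) (λ i → sums (λ j → ℕ→ℚ (μ i j)) (μ i) (λ _ → refl))) (cong ℕ→ℚ deg) ,
      (λ a → trans (sums (λ j → ℕ→ℚ (μ a j)) (μ a) (λ _ → refl)) (cong ℤ→ℚ (sym (rows a)))) ,
      (λ b → trans (sums (λ i → ℕ→ℚ (μ i b)) (λ i → μ i b) (λ _ → refl)) (cong ℤ→ℚ (sym (cols b))))
      where
      sums : ∀ {n} (f : Fin n → ℚ) (g : Fin n → ℕ) → (∀ i → f i ≡ ℕ→ℚ (g i)) → ∑ f ≡ ℕ→ℚ (sum g)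
      sums f g eq = trans (sym (ℚ.*-identityʳ (∑ f))) (∑-ℕ→ℚ f g 1ℚ (λ i → trans (ℚ.*-identityʳ (f i)) (eq i)))
      off : ∀ i j → ¬ Allowed G i j → ℕ→ℚ (μ i j) ≡ 0ℚ
      off i j ¬w with μ i j in eq
      ... | zero = refl
      ... | suc _ = contradiction (supp i j (subst (0 ℕ.<_) (sym eq) ℕ.z<s)) ¬w

    -- The integer decomposition property: multiplied by a common denominator D, the weights form an
    -- integral matrix whose marginals are D times those of the point, and `saturated` divides by D.
    dilate⇒cone : ∀ t v → InDilate G t v → Cone (Allowed G) t (point v)
    dilate⇒cone t (x , y) (λ′ , nonneg , off , tot , rows , cols) with common-denominator₂ λ′ nonneg
    ... | D-1 , Λ , eq = saturated allowed? D-1 Λ supp deg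
        (λ a → scaled (λ j → λ′ a j) (Λ a) (eq a) (rows a))
        (λ b → scaled (λ i → λ′ i b) (λ i → Λ i b) (λ i → eq i b) (cols b))
      where
      D = suc D-1
      scaled : ∀ {n} (f : Fin n → ℚ) (g : Fin n → ℕ) → (∀ i → f i * ℕ→ℚ D ≡ ℕ→ℚ (g i)) → ∀ {z} → ∑ f ≡ ℤ→ℚ z →
               + D ℤ.* z ≡ + sum g
      scaled f g eq {z} s = ℤ→ℚ-injective {+ D ℤ.* z} {+ sum g} (begin
        ℤ→ℚ (+ D ℤ.* z)       ≡⟨ cong ℤ→ℚ (ℤ.*-comm (+ D) z) ⟩
        ℤ→ℚ (z ℤ.* + D)       ≡⟨ ℤ→ℚ-* z (+ D) ⟩
        ℤ→ℚ z * ℕ→ℚ D         ≡⟨ cong (_* ℕ→ℚ D) s ⟨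
        ∑ f * ℕ→ℚ D           ≡⟨ ∑-ℕ→ℚ f g (ℕ→ℚ D) eq ⟩
        ℤ→ℚ (+ sum g) ∎)
        where open ≡-Reasoning
      deg : sum (row Λ) ≡ D ℕ.* t
      deg = ℤ.+-injective (trans (sym (scaled (λ i → ∑ (λ j → λ′ i j)) (row Λ) (λ i → ∑-ℕ→ℚ (λ′ i) (Λ i) (ℕ→ℚ D) (eq i)) tot))
                                (sym (ℤ.pos-* D t)))
      supp : Supported (Allowed G) Λ
      supp i j Λ>0 with allowed? i j
      ... | yes w = w
      ... | no ¬w = contradiction (subst (0 ℕ.<_) Λ≡0 Λ>0) λ ()
        where
        Λ≡0 : Λ i j ≡ 0
        Λ≡0 = ℤ.+-injective (ℤ→ℚ-injective {+ Λ i j} {+ 0} (trans (sym (eq i j)) (trans (cong (_* ℕ→ℚ D) (off i j ¬w)) (ℚ.*-zeroˡ (ℕ→ℚ D)))))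

    card⇒lattice-count : ∀ {t c} → Card (Cone (Allowed G) t) c → LatticeCount G t c
    card⇒lattice-count {t} = card⇒list {I = InDilate G t} cone-resp (cone⇒dilate t) (dilate⇒cone t)

    lattice-count-unique : ∀ {t c c′} → Card (Cone (Allowed G) t) c → LatticeCount G t c′ → c′ ≡ c
    lattice-count-unique {t} card (L , uniq , mem , refl) =
      card-unique (list⇒card {I = InDilate G t} cone-resp (cone⇒dilate t) (dilate⇒cone t) L uniq mem) card

-- The limit that defines the volume, in terms of integers

module Volumes where

  open import Data.Nat.Base as ℕ using (ℕ; zero; suc; _!; _^_; _⊔_)
  import Data.Nat.Properties as ℕ
  open import Data.Nat.Coprimality using (1-coprimeTo)
  open import Data.Integer.Base as ℤ using (ℤ; +_; -[1+_]; 0ℤ; 1ℤ)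
  import Data.Integer.Properties as ℤ
  import Data.Integer.Tactic.RingSolver as ℤ-Solver
  open import Data.Rational.Base using (ℚ; mkℚ; 0ℚ; 1ℚ; _+_; _*_; _-_; -_; _≤_; _<_; ∣_∣; *<*; ↥_; positive; nonNegative; Positive; NonNegative)
  import Data.Rational.Properties as ℚ
  open import Data.Product.Base using (Σ; ∃; _×_; _,_; proj₁; proj₂)
  open import Data.Sum.Base using (inj₁; inj₂)
  open import Relation.Binary.PropositionalEquality
  open import Relation.Nullary
  open Cones
  open Counting
  open Sequences
  open Binomials
  open Asymptotics
  open Rationals
  open LatticePoints
  open import Defs using (SimpleGraph; ℤ→ℚ; ℕ→ℚ; LatticeCount)

  -- For k = a/b the deviation X equals Z/b with an integer Z, so estimates for X become integer
  -- estimates for Z.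
  module Deviation (A p b-1 : ℕ) (k : ℚ) (a : ℤ) (k≡ : k * ℕ→ℚ (suc b-1) ≡ ℤ→ℚ a) where

    b = suc b-1

    X : ℚ
    X = ℕ→ℚ A - k * ℕ→ℚ p

    Z : ℤ
    Z = + A ℤ.* + b ℤ.- a ℤ.* + p

    X*b : X * ℕ→ℚ b ≡ ℤ→ℚ Z
    X*b = begin
      (ℕ→ℚ A - k * ℕ→ℚ p) * ℕ→ℚ b                  ≡⟨ ℚ.*-distribʳ-+ (ℕ→ℚ b) (ℕ→ℚ A) (- (k * ℕ→ℚ p)) ⟩
      ℕ→ℚ A * ℕ→ℚ b + - (k * ℕ→ℚ p) * ℕ→ℚ b        ≡⟨ cong₂ _+_ (sym (ℤ→ℚ-* (+ A) (+ b))) (sym (ℚ.neg-distribˡ-* (k * ℕ→ℚ p) (ℕ→ℚ b))) ⟩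
      ℤ→ℚ (+ A ℤ.* + b) + - (k * ℕ→ℚ p * ℕ→ℚ b)    ≡⟨ cong (λ z → ℤ→ℚ (+ A ℤ.* + b) + - z) kpb ⟩
      ℤ→ℚ (+ A ℤ.* + b) + - ℤ→ℚ (a ℤ.* + p)        ≡⟨ cong (_+_ (ℤ→ℚ (+ A ℤ.* + b))) (ℤ→ℚ-neg (a ℤ.* + p)) ⟨
      ℤ→ℚ (+ A ℤ.* + b) + ℤ→ℚ (ℤ.- (a ℤ.* + p))    ≡⟨ ℤ→ℚ-+ (+ A ℤ.* + b) (ℤ.- (a ℤ.* + p)) ⟨
      ℤ→ℚ Z ∎
      where
      open ≡-Reasoning
      kpb : k * ℕ→ℚ p * ℕ→ℚ b ≡ ℤ→ℚ (a ℤ.* + p)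
      kpb = begin
        k * ℕ→ℚ p * ℕ→ℚ b      ≡⟨ ℚ.*-assoc k (ℕ→ℚ p) (ℕ→ℚ b) ⟩
        k * (ℕ→ℚ p * ℕ→ℚ b)    ≡⟨ cong (k *_) (ℚ.*-comm (ℕ→ℚ p) (ℕ→ℚ b)) ⟩
        k * (ℕ→ℚ b * ℕ→ℚ p)    ≡⟨ ℚ.*-assoc k (ℕ→ℚ b) (ℕ→ℚ p) ⟨
        k * ℕ→ℚ b * ℕ→ℚ p      ≡⟨ cong (_* ℕ→ℚ p) k≡ ⟩
        ℤ→ℚ a * ℕ→ℚ p          ≡⟨ ℤ→ℚ-* a (+ p) ⟨
        ℤ→ℚ (a ℤ.* + p) ∎

    -X*b : - X * ℕ→ℚ b ≡ ℤ→ℚ (ℤ.- Z)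
    -X*b = trans (sym (ℚ.neg-distribˡ-* X (ℕ→ℚ b))) (trans (cong -_ X*b) (sym (ℤ→ℚ-neg Z)))

    module _ (m : ℕ) where

      n = suc m

      -- It is 1/(n b), as b - 1 + m b is the predecessor of n b. With X = Z/b, the bound |X| < p/(n
      -- b) reads n |Z| < p.
      tolerance : ℚ
      tolerance = mkℚ 1ℤ (b-1 ℕ.+ m ℕ.* b) (1-coprimeTo _)

      tolerance>0 : 0ℚ < tolerance
      tolerance>0 = *<* (ℤ.+<+ (ℕ.s≤s ℕ.z≤n))

      private
        nb : ℚ
        nb = ℤ→ℚ (+ (n ℕ.* b))

        bounded : ∀ {Y z} → Y * ℕ→ℚ b ≡ ℤ→ℚ z → Y < tolerance * ℕ→ℚ p → + n ℤ.* z ℤ.≤ + p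
        bounded {Y} {z} eq lt = ℤ→ℚ-cancel-≤ {+ n ℤ.* z} {+ p} (ℚ.<⇒≤ (subst₂ _<_ left right (ℚ.*-monoˡ-<-pos nb {{nb>0}} lt)))
          where
          open ≡-Reasoning
          nb>0 : Positive nb
          nb>0 = positive (ℤ→ℚ-mono-< {+ 0} {+ (n ℕ.* b)} (ℤ.+<+ (ℕ.s≤s ℕ.z≤n)))
          left : Y * nb ≡ ℤ→ℚ (+ n ℤ.* z)
          left = begin
            Y * nb                           ≡⟨ cong (λ w → Y * ℤ→ℚ w) (trans (cong +_ (ℕ.*-comm n b)) (ℤ.pos-* b n)) ⟩
            Y * ℤ→ℚ (+ b ℤ.* + n)            ≡⟨ cong (Y *_) (ℤ→ℚ-* (+ b) (+ n)) ⟩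
            Y * (ℕ→ℚ b * ℤ→ℚ (+ n))          ≡⟨ ℚ.*-assoc Y (ℕ→ℚ b) (ℤ→ℚ (+ n)) ⟨
            Y * ℕ→ℚ b * ℤ→ℚ (+ n)            ≡⟨ cong (_* ℤ→ℚ (+ n)) eq ⟩
            ℤ→ℚ z * ℤ→ℚ (+ n)                ≡⟨ ℤ→ℚ-* z (+ n) ⟨
            ℤ→ℚ (z ℤ.* + n)                  ≡⟨ cong ℤ→ℚ (ℤ.*-comm z (+ n)) ⟩
            ℤ→ℚ (+ n ℤ.* z) ∎
          right : tolerance * ℕ→ℚ p * nb ≡ ℕ→ℚ p
          right = begin
            tolerance * ℕ→ℚ p * nb           ≡⟨ ℚ.*-assoc tolerance (ℕ→ℚ p) nb ⟩
            tolerance * (ℕ→ℚ p * nb)         ≡⟨ cong (tolerance *_) (ℚ.*-comm (ℕ→ℚ p) nb) ⟩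
            tolerance * (nb * ℕ→ℚ p)         ≡⟨ ℚ.*-assoc tolerance nb (ℕ→ℚ p) ⟨
            tolerance * nb * ℕ→ℚ p           ≡⟨ cong (_* ℕ→ℚ p) (*-denominator tolerance) ⟩
            1ℚ * ℕ→ℚ p                       ≡⟨ ℚ.*-identityˡ (ℕ→ℚ p) ⟩
            ℕ→ℚ p ∎

      deviation-bound : ∣ X ∣ < tolerance * ℕ→ℚ p → + n ℤ.* Z ℤ.≤ + p × + n ℤ.* ℤ.- Z ℤ.≤ + p
      deviation-bound lt = bounded {X} {Z} X*b (ℚ.≤-<-trans (p≤∣p∣ X) lt) ,
        bounded { - X} {ℤ.- Z} -X*b (ℚ.≤-<-trans (subst (- X ≤_) (ℚ.∣-p∣≡∣p∣ X) (p≤∣p∣ (- X))) lt)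
        where
        p≤∣p∣ : ∀ q → q ≤ ∣ q ∣
        p≤∣p∣ q with ℚ.∣p∣≡p∨∣p∣≡-p q
        ... | inj₁ eq = ℚ.≤-reflexive (sym eq)
        ... | inj₂ eq with ℚ.≤-total 0ℚ q
        ...   | inj₁ 0≤q = ℚ.≤-reflexive (sym (ℚ.0≤p⇒∣p∣≡p 0≤q))
        ...   | inj₂ q≤0 = ℚ.≤-trans q≤0 (ℚ.0≤∣p∣ q)

    private
      positive-numerator : ∀ q → 0ℚ < q → ∃ λ s → ↥ q ≡ + suc s
      positive-numerator (mkℚ (+ zero) _ _) (*<* (ℤ.+<+ ()))
      positive-numerator (mkℚ (+ suc s) _ _) _ = s , refl
      positive-numerator (mkℚ -[1+ _ ] _ _) (*<* ())

      -- Let ε = r/q. The precision q + 1 instead of q yields the strict inequality: Y ≥ ε p would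
      -- give p ≤ z q, and together with (q + 1) z ≤ p this forces z ≤ 0 and hence p ≤ 0.
      small : ∀ ε → 0ℚ < ε → 1 ℕ.≤ p → ∀ {Y z} → Y * ℕ→ℚ b ≡ ℤ→ℚ z → + suc (suc (ℚ.denominator-1 ε)) ℤ.* z ℤ.≤ + p → Y < ε * ℕ→ℚ p
      small ε@(mkℚ r q-1 _) ε>0 p≥1 {Y} {z} eq h with ε * ℕ→ℚ p ℚ.≤? Y
      ... | no ≰ = ℚ.≰⇒> ≰
      ... | yes le = contradiction big (ℤ.<⇒≱ (ℤ.≤-<-trans zq≤0 (ℤ.+<+ p≥1)))
        where
        q = suc q-1
        bq≥0 : NonNegative (ℤ→ℚ (+ b ℤ.* + q))
        bq≥0 = nonNegative (ℤ→ℚ-mono-≤ {+ 0} {+ b ℤ.* + q} (ℤ.+≤+ ℕ.z≤n))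
        open ≡-Reasoning
        left : ε * ℕ→ℚ p * ℤ→ℚ (+ b ℤ.* + q) ≡ ℤ→ℚ (r ℤ.* (+ p ℤ.* + b))
        left = begin
          ε * ℕ→ℚ p * ℤ→ℚ (+ b ℤ.* + q)          ≡⟨ ℚ.*-assoc ε (ℕ→ℚ p) _ ⟩
          ε * (ℕ→ℚ p * ℤ→ℚ (+ b ℤ.* + q))        ≡⟨ cong (ε *_) (trans (sym (ℤ→ℚ-* (+ p) (+ b ℤ.* + q))) (cong ℤ→ℚ (lem (+ p) (+ b) (+ q)))) ⟩
          ε * ℤ→ℚ (+ q ℤ.* (+ p ℤ.* + b))        ≡⟨ cong (ε *_) (ℤ→ℚ-* (+ q) (+ p ℤ.* + b)) ⟩
          ε * (ℤ→ℚ (+ q) * ℤ→ℚ (+ p ℤ.* + b))    ≡⟨ ℚ.*-assoc ε (ℤ→ℚ (+ q)) _ ⟨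
          ε * ℤ→ℚ (+ q) * ℤ→ℚ (+ p ℤ.* + b)      ≡⟨ cong (_* ℤ→ℚ (+ p ℤ.* + b)) (*-denominator ε) ⟩
          ℤ→ℚ r * ℤ→ℚ (+ p ℤ.* + b)              ≡⟨ ℤ→ℚ-* r (+ p ℤ.* + b) ⟨
          ℤ→ℚ (r ℤ.* (+ p ℤ.* + b)) ∎
          where
          lem : ∀ p b q → p ℤ.* (b ℤ.* q) ≡ q ℤ.* (p ℤ.* b)
          lem = ℤ-Solver.solve-∀
        right : Y * ℤ→ℚ (+ b ℤ.* + q) ≡ ℤ→ℚ (z ℤ.* + q)
        right = begin
          Y * ℤ→ℚ (+ b ℤ.* + q)         ≡⟨ cong (Y *_) (ℤ→ℚ-* (+ b) (+ q)) ⟩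
          Y * (ℕ→ℚ b * ℤ→ℚ (+ q))       ≡⟨ ℚ.*-assoc Y (ℕ→ℚ b) _ ⟨
          Y * ℕ→ℚ b * ℤ→ℚ (+ q)         ≡⟨ cong (_* ℤ→ℚ (+ q)) eq ⟩
          ℤ→ℚ z * ℤ→ℚ (+ q)             ≡⟨ ℤ→ℚ-* z (+ q) ⟨
          ℤ→ℚ (z ℤ.* + q) ∎
        big′ : r ℤ.* (+ p ℤ.* + b) ℤ.≤ z ℤ.* + q
        big′ = ℤ→ℚ-cancel-≤ {r ℤ.* (+ p ℤ.* + b)} {z ℤ.* + q} (subst₂ _≤_ left right (ℚ.*-monoʳ-≤-nonNeg (ℤ→ℚ (+ b ℤ.* + q)) {{bq≥0}} le))
        big : + p ℤ.≤ z ℤ.* + q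
        big with positive-numerator ε ε>0
        ... | s , r≡ = ℤ.≤-trans (subst (+ p ℤ.≤_) (trans (ℤ.pos-* (suc s) (p ℕ.* b)) (cong₂ ℤ._*_ (sym r≡) (ℤ.pos-* p b)))
                         (ℤ.+≤+ (ℕ.≤-trans (ℕ.m≤m*n p b) (ℕ.m≤m+n (p ℕ.* b) (s ℕ.* (p ℕ.* b)))))) big′
        z≤0 : z ℤ.≤ 0ℤ
        z≤0 = lin≤₂ big h (lem z (+ p) (+ q))
          where
          lem : ∀ z p q → z ℤ.+ z ℤ.* q ℤ.+ p ≡ 0ℤ ℤ.+ p ℤ.+ (1ℤ ℤ.+ q) ℤ.* z
          lem = ℤ-Solver.solve-∀
        zq≤0 : z ℤ.* + q ℤ.≤ 0ℤ
        zq≤0 = ℤ.*-monoʳ-≤-nonNeg (+ q) z≤0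

    deviation-small : ∀ ε → 0ℚ < ε → 1 ℕ.≤ p → let n = suc (suc (ℚ.denominator-1 ε)) in
                      + n ℤ.* Z ℤ.≤ + p → + n ℤ.* ℤ.- Z ℤ.≤ + p → ∣ X ∣ < ε * ℕ→ℚ p
    deviation-small ε ε>0 p≥1 up down with ℚ.∣p∣≡p∨∣p∣≡-p X
    ... | inj₁ eq = subst (_< ε * ℕ→ℚ p) (sym eq) (small ε ε>0 p≥1 {X} {Z} X*b up)
    ... | inj₂ eq = subst (_< ε * ℕ→ℚ p) (sym eq) (small ε ε>0 p≥1 { - X} {ℤ.- Z} -X*b down)

  private
    rescale : ∀ {φ f a} w → Below φ f a → Below (λ t → suc w ℕ.* φ t) (λ t → + suc w ℤ.* f t) a
    rescale {φ} {f} {a} w below .bound m = proj₁ (bound below m) , λ t T≤t →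
      subst₂ ℤ._≤_ (l₁ (+ suc w) (+ suc m) (f t)) (trans (l₁ (+ suc w) (+ suc m ℤ.* a ℤ.+ 1ℤ) (+ φ t)) (cong (ℤ._*_ (+ suc m ℤ.* a ℤ.+ 1ℤ)) (sym (ℤ.pos-* (suc w) (φ t)))))
        (scale (suc w) (proj₂ (bound below m) t T≤t))
      where
      l₁ : ∀ w n x → w ℤ.* (n ℤ.* x) ≡ n ℤ.* (w ℤ.* x)
      l₁ = ℤ-Solver.solve-∀

    unscale : ∀ {φ f a} w → Below (λ t → suc w ℕ.* φ t) (λ t → + suc w ℤ.* f t) a → Below φ f a
    unscale {φ} {f} {a} w below .bound m = proj₁ (bound below m) , λ t T≤t → cancel w
      (subst₂ ℤ._≤_ (l₁ (+ suc m) (+ suc w) (f t)) (trans (cong (ℤ._*_ (+ suc m ℤ.* a ℤ.+ 1ℤ)) (ℤ.pos-* (suc w) (φ t))) (l₁ (+ suc m ℤ.* a ℤ.+ 1ℤ) (+ suc w) (+ φ t)))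
        (proj₂ (bound below m) t T≤t))
      where
      l₁ : ∀ w n x → w ℤ.* (n ℤ.* x) ≡ n ℤ.* (w ℤ.* x)
      l₁ = ℤ-Solver.solve-∀

    factorial-suc : ∀ d → ∃ λ w → d ! ≡ suc w
    factorial-suc d with d ! | ℕ.1≤n! d
    ... | suc w | _ = w , refl

  -- The analytic clause of `NVolIs` with the dimension as a parameter, so that it can be
  -- transported along `dim-unique`.
  Limit : ∀ {N} → SimpleGraph N → ℕ → ℚ → Set
  Limit G d k = ∀ (ε : ℚ) → 0ℚ < ε → Σ ℕ λ T → ∀ t → T ℕ.≤ t →
    Σ ℕ λ c → LatticeCount G t c × (∣ ℕ→ℚ ((d !) ℕ.* c) - k * ℕ→ℚ (t ℕ.^ d) ∣ < ε * ℕ→ℚ (t ℕ.^ d))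

  count : ∀ {N} → SimpleGraph N → ℕ → ℕ
  count G = size (allowed? G)

  module _ {N} (G : SimpleGraph N) (d b-1 : ℕ) (k : ℚ) (a : ℤ) (k≡ : k * ℕ→ℚ (suc b-1) ≡ ℤ→ℚ a) where

    private
      b = suc b-1
      f : ℕ → ℤ
      f t = + b ℤ.* + count G t

      module Dev (t : ℕ) = Deviation (d ! ℕ.* count G t) (t ^ d) b-1 k a k≡

      Z≡ : ∀ t → Dev.Z t ≡ + (d !) ℤ.* f t ℤ.- a ℤ.* + (t ^ d)
      Z≡ t = cong (ℤ._- a ℤ.* + (t ^ d)) (trans (cong (ℤ._* + b) (ℤ.pos-* (d !) (count G t))) (lem (+ (d !)) (+ count G t) (+ b)))
        where
        lem : ∀ x y z → x ℤ.* y ℤ.* z ≡ x ℤ.* (z ℤ.* y)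
        lem = ℤ-Solver.solve-∀

      lemᵘ : ∀ n y a p → n ℤ.* y ℤ.+ p ≡ (n ℤ.* a ℤ.+ 1ℤ) ℤ.* p ℤ.+ n ℤ.* (y ℤ.- a ℤ.* p)
      lemᵘ = ℤ-Solver.solve-∀
      lemˡ : ∀ n w x a p → n ℤ.* (w ℤ.* ℤ.- x) ℤ.+ p ≡ (n ℤ.* ℤ.- a ℤ.+ 1ℤ) ℤ.* p ℤ.+ n ℤ.* ℤ.- (w ℤ.* x ℤ.- a ℤ.* p)
      lemˡ = ℤ-Solver.solve-∀
      lemᵘ′ : ∀ n y a p → n ℤ.* (y ℤ.- a ℤ.* p) ℤ.+ (n ℤ.* a ℤ.+ 1ℤ) ℤ.* p ≡ p ℤ.+ n ℤ.* y
      lemᵘ′ = ℤ-Solver.solve-∀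
      lemˡ′ : ∀ n w x a p → n ℤ.* ℤ.- (w ℤ.* x ℤ.- a ℤ.* p) ℤ.+ (n ℤ.* ℤ.- a ℤ.+ 1ℤ) ℤ.* p ≡ p ℤ.+ n ℤ.* (w ℤ.* ℤ.- x)
      lemˡ′ = ℤ-Solver.solve-∀

      powers⇒tends : Below (_^ d) (λ t → + (d !) ℤ.* f t) a → Below (_^ d) (λ t → + (d !) ℤ.* ℤ.- f t) (ℤ.- a) → Tends (binom d) f a
      powers⇒tends up down with factorial-suc d | near-power d
      ... | w , eq | near , _ = unscale w (subst (λ v → Below (λ t → v ℕ.* binom d t) (λ t → + v ℤ.* f t) a) eq (below-gauge near up)) ,
        unscale w (subst (λ v → Below (λ t → v ℕ.* binom d t) (λ t → + v ℤ.* ℤ.- f t) (ℤ.- a)) eq (below-gauge near down))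

      tends⇒powers : Tends (binom d) f a → Below (_^ d) (λ t → + (d !) ℤ.* f t) a × Below (_^ d) (λ t → + (d !) ℤ.* ℤ.- f t) (ℤ.- a)
      tends⇒powers (up , down) with factorial-suc d | near-power d
      ... | w , eq | _ , near = below-gauge near (subst (λ v → Below (λ t → v ℕ.* binom d t) (λ t → + v ℤ.* f t) a) (sym eq) (rescale w up)) ,
        below-gauge near (subst (λ v → Below (λ t → v ℕ.* binom d t) (λ t → + v ℤ.* ℤ.- f t) (ℤ.- a)) (sym eq) (rescale w down))

    limit⇒tends : Limit G d k → Tends (binom d) f a
    limit⇒tends lim = powers⇒tends up down
      where
      bounds : ∀ m → ∃ λ T → ∀ t → T ℕ.≤ t → + suc m ℤ.* Dev.Z t ℤ.≤ + (t ^ d) × + suc m ℤ.* ℤ.- Dev.Z t ℤ.≤ + (t ^ d)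
      bounds m with lim (Dev.tolerance 0 m) (Dev.tolerance>0 0 m)
      ... | T , h = T , λ t T≤t → at t (h t T≤t)
        where
        at : ∀ t → (Σ ℕ λ c → LatticeCount G t c × (∣ ℕ→ℚ ((d !) ℕ.* c) - k * ℕ→ℚ (t ℕ.^ d) ∣ < Dev.tolerance 0 m * ℕ→ℚ (t ℕ.^ d))) →
             + suc m ℤ.* Dev.Z t ℤ.≤ + (t ^ d) × + suc m ℤ.* ℤ.- Dev.Z t ℤ.≤ + (t ^ d)
        -- The c supplied by the hypothesis is only known to be some lattice count; uniqueness
        -- identifies it with `count G t`.
        at t (c , lc , lt) = Dev.deviation-bound t m
          (subst (λ c → ∣ ℕ→ℚ ((d !) ℕ.* c) - k * ℕ→ℚ (t ℕ.^ d) ∣ < Dev.tolerance 0 m * ℕ→ℚ (t ℕ.^ d))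
            (lattice-count-unique G {t} {_} {c} (card-cone (allowed? G) t) lc) lt)
      up : Below (_^ d) (λ t → + (d !) ℤ.* f t) a
      up .bound m = proj₁ (bounds m) , λ t T≤t → lin≤ (subst (λ z → + suc m ℤ.* z ℤ.≤ + (t ^ d)) (Z≡ t) (proj₁ (proj₂ (bounds m) t T≤t)))
        (lemᵘ (+ suc m) (+ (d !) ℤ.* f t) a (+ (t ^ d)))
      down : Below (_^ d) (λ t → + (d !) ℤ.* ℤ.- f t) (ℤ.- a)
      down .bound m = proj₁ (bounds m) , λ t T≤t → lin≤ (subst (λ z → + suc m ℤ.* ℤ.- z ℤ.≤ + (t ^ d)) (Z≡ t) (proj₂ (proj₂ (bounds m) t T≤t)))
        (lemˡ (+ suc m) (+ (d !)) (f t) a (+ (t ^ d)))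

    tends⇒limit : Tends (binom d) f a → Limit G d k
    -- The successor excludes t = 0, so that t ^ d is positive and a strict inequality is possible.
    tends⇒limit tends ε ε>0 = suc (T₁ ⊔ T₂) , λ t T≤t → count G t , card⇒lattice-count G {t} (card-cone (allowed? G) t) ,
      Dev.deviation-small t ε ε>0 (positive-power t (ℕ.≤-trans (ℕ.s≤s ℕ.z≤n) T≤t))
        (subst (λ z → + n ℤ.* z ℤ.≤ + (t ^ d)) (sym (Z≡ t)) (lin≤ (h₁ t (ℕ.m⊔n≤o⇒m≤o T₁ T₂ (ℕ.≤-trans (ℕ.n≤1+n _) T≤t)))
          (lemᵘ′ (+ n) (+ (d !) ℤ.* f t) a (+ (t ^ d)))))
        (subst (λ z → + n ℤ.* ℤ.- z ℤ.≤ + (t ^ d)) (sym (Z≡ t)) (lin≤ (h₂ t (ℕ.m⊔n≤o⇒n≤o T₁ T₂ (ℕ.≤-trans (ℕ.n≤1+n _) T≤t)))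
          (lemˡ′ (+ n) (+ (d !)) (f t) a (+ (t ^ d)))))
      where
      n = suc (suc (ℚ.denominator-1 ε))
      up = bound (proj₁ (tends⇒powers tends)) (suc (ℚ.denominator-1 ε))
      down = bound (proj₂ (tends⇒powers tends)) (suc (ℚ.denominator-1 ε))
      T₁ = proj₁ up
      T₂ = proj₁ down
      h₁ = proj₂ up
      h₂ = proj₂ down
      positive-power : ∀ t → 1 ℕ.≤ t → 1 ℕ.≤ t ^ d
      positive-power (suc t) _ = ℕ.m^n>0 (suc t) d

-- The dimension 2N - 2 for connected graphs

module Dimension where

  open import Data.Nat.Base as ℕ using (ℕ; zero; suc; z≤n; s≤s)
  import Data.Nat.Properties as ℕ
  open import Data.Integer.Base as ℤ using (ℤ; 0ℤ; 1ℤ)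
  import Data.Integer.Properties as ℤ
  import Data.Integer.Tactic.RingSolver as ℤ-Solver
  open import Data.Rational.Base using (ℚ; 0ℚ; _+_)
  import Data.Rational.Properties as ℚ
  open import Data.Bool.Base using (true; false; if_then_else_)
  import Data.Bool.Properties as Bool
  open import Data.Fin.Base using (Fin; zero; suc; splitAt; _↑ˡ_; _↑ʳ_; punchIn; punchOut)
  open import Data.Fin.Properties using (_≟_; any?; splitAt-↑ˡ; splitAt-↑ʳ; splitAt⁻¹-↑ˡ; splitAt⁻¹-↑ʳ; punchIn-punchOut)
  open import Data.Product.Base using (Σ; ∃; _×_; _,_; proj₁; proj₂)
  open import Data.Sum.Base using (_⊎_; inj₁; inj₂; [_,_]′; map₁)
  open import Function.Base using (_∘_)
  open import Relation.Binary.PropositionalEquality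
  open import Relation.Nullary
  open import Relation.Binary.Definitions using (tri<; tri≈; tri>)
  open import Algebra.Properties.Semiring.Sum (ℤ.+-*-semiring) as ℤ-Sum using ()
    renaming (sum to total; sum-cong-≗ to total-cong; ∑-distrib-+ to total-+; ∑-comm to total-comm; *-distribˡ-sum to *-total; sum-replicate-zero to total-zero)
  open Flows using (sum; term≤sum)
  open Rationals using (ℤ→ℚ-+; ℤ→ℚ-injective)
  open import Defs hiding (sym)

  -- Gaussian elimination without fractions: with a pivot a in the first column, the other rows are
  -- combined to A′, and a solution y of the smaller system is scaled by a. Without a pivot the
  -- first unit vector is a solution.
  homogeneous-solution : ∀ m (A : Fin m → Fin (suc m) → ℤ) →
    Σ (Fin (suc m) → ℤ) λ x → (∃ λ s → x s ≢ 0ℤ) × (∀ r → total (λ s → A r s ℤ.* x s) ≡ 0ℤ)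
  homogeneous-solution zero A = (λ _ → 1ℤ) , (zero , λ ()) , λ ()
  homogeneous-solution (suc m) A with any? (λ r → ¬? (A r zero ℤ.≟ 0ℤ))
  ... | no none = x , (zero , λ ()) , λ r → begin
      A r zero ℤ.* 1ℤ ℤ.+ total (λ s → A r (suc s) ℤ.* 0ℤ)   ≡⟨ cong₂ ℤ._+_ (trans (ℤ.*-identityʳ _) (zero-column r)) (trans (total-cong (λ s → ℤ.*-zeroʳ (A r (suc s)))) (total-zero (suc m))) ⟩
      0ℤ ∎
    where
    open ≡-Reasoning
    x : Fin (suc (suc m)) → ℤ
    x zero = 1ℤ
    x (suc _) = 0ℤ
    zero-column : ∀ r → A r zero ≡ 0ℤ
    zero-column r with A r zero ℤ.≟ 0ℤ
    ... | yes eq = eq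
    ... | no neq = contradiction (r , neq) none
  ... | yes (r₀ , pivot≢0) = x , nonzero , solves
    where
    open ≡-Reasoning
    a = A r₀ zero
    A′ : Fin m → Fin (suc m) → ℤ
    A′ r s = a ℤ.* A (punchIn r₀ r) (suc s) ℤ.- A (punchIn r₀ r) zero ℤ.* A r₀ (suc s)
    rec = homogeneous-solution m A′
    y = proj₁ rec
    σ = total (λ s → A r₀ (suc s) ℤ.* y s)
    x : Fin (suc (suc m)) → ℤ
    x zero = ℤ.- σ
    x (suc s) = a ℤ.* y s
    nonzero : ∃ λ s → x s ≢ 0ℤ
    nonzero with proj₁ (proj₂ rec)
    ... | s , ys≢0 = suc s , λ eq → [ pivot≢0 , ys≢0 ]′ (ℤ.i*j≡0⇒i≡0∨j≡0 a eq)
    row-value : ∀ r → total (λ s → A r s ℤ.* x s) ≡ total (λ s → (a ℤ.* A r (suc s) ℤ.- A r zero ℤ.* A r₀ (suc s)) ℤ.* y s)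
    row-value r = begin
      A r zero ℤ.* ℤ.- σ ℤ.+ total (λ s → A r (suc s) ℤ.* (a ℤ.* y s))
        ≡⟨ cong (ℤ._+ total (λ s → A r (suc s) ℤ.* (a ℤ.* y s))) (trans (neg-swap (A r zero) σ) (*-total (ℤ.- A r zero) (λ s → A r₀ (suc s) ℤ.* y s))) ⟩
      total (λ s → ℤ.- A r zero ℤ.* (A r₀ (suc s) ℤ.* y s)) ℤ.+ total (λ s → A r (suc s) ℤ.* (a ℤ.* y s))
        ≡⟨ total-+ (λ s → ℤ.- A r zero ℤ.* (A r₀ (suc s) ℤ.* y s)) (λ s → A r (suc s) ℤ.* (a ℤ.* y s)) ⟨
      total (λ s → ℤ.- A r zero ℤ.* (A r₀ (suc s) ℤ.* y s) ℤ.+ A r (suc s) ℤ.* (a ℤ.* y s))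
        ≡⟨ total-cong (λ s → lem (A r zero) (A r₀ (suc s)) (y s) (A r (suc s)) a) ⟩
      total (λ s → (a ℤ.* A r (suc s) ℤ.- A r zero ℤ.* A r₀ (suc s)) ℤ.* y s) ∎
      where
      neg-swap : ∀ p q → p ℤ.* ℤ.- q ≡ ℤ.- p ℤ.* q
      neg-swap = ℤ-Solver.solve-∀
      lem : ∀ p q y t a → ℤ.- p ℤ.* (q ℤ.* y) ℤ.+ t ℤ.* (a ℤ.* y) ≡ (a ℤ.* t ℤ.- p ℤ.* q) ℤ.* y
      lem = ℤ-Solver.solve-∀
    solves : ∀ r → total (λ s → A r s ℤ.* x s) ≡ 0ℤ
    solves r with r₀ ≟ r
    ... | yes refl = trans (row-value r₀) (trans (total-cong (λ s → lem a (A r₀ (suc s)) (y s))) (total-zero (suc m)))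
      where
      lem : ∀ a t y → (a ℤ.* t ℤ.- a ℤ.* t) ℤ.* y ≡ 0ℤ
      lem = ℤ-Solver.solve-∀
    ... | no r₀≢r = trans (row-value r) (subst (λ r → total (λ s → (a ℤ.* A r (suc s) ℤ.- A r zero ℤ.* A r₀ (suc s)) ℤ.* y s) ≡ 0ℤ)
                      (punchIn-punchOut r₀≢r) (proj₂ (proj₂ rec) (punchOut r₀≢r)))

  eqᵇ-suc : ∀ {n} (i a : Fin n) → eqᵇ (suc i) (suc a) ≡ eqᵇ i a
  eqᵇ-suc i a with i ≟ a
  ... | yes _ = refl
  ... | no _ = refl

  if-ℤ→ℚ : ∀ b x → (if b then ℤ→ℚ x else 0ℚ) ≡ ℤ→ℚ (if b then x else 0ℤ)
  if-ℤ→ℚ true x = refl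
  if-ℤ→ℚ false x = refl

  ∑-ℤ→ℚ : ∀ {n} (f : Fin n → ℤ) → ∑ (λ i → ℤ→ℚ (f i)) ≡ ℤ→ℚ (total f)
  ∑-ℤ→ℚ {zero} f = refl
  ∑-ℤ→ℚ {suc n} f = trans (cong (_+_ (ℤ→ℚ (f zero))) (∑-ℤ→ℚ (f ∘ suc))) (sym (ℤ→ℚ-+ (f zero) (total (f ∘ suc))))

  ∑-cong : ∀ {n} {f g : Fin n → ℚ} → (∀ i → f i ≡ g i) → ∑ f ≡ ∑ g
  ∑-cong {zero} eq = refl
  ∑-cong {suc n} eq = cong₂ _+_ (eq zero) (∑-cong (eq ∘ suc))

  ∑-zero : ∀ {n} {f : Fin n → ℚ} → (∀ i → f i ≡ 0ℚ) → ∑ f ≡ 0ℚ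
  ∑-zero {zero} eq = refl
  ∑-zero {suc n} eq = trans (cong₂ _+_ (eq zero) (∑-zero (eq ∘ suc))) (ℚ.+-identityˡ 0ℚ)

  ∑-pick : ∀ {n} (f : Fin n → ℚ) a → ∑ (λ i → if eqᵇ i a then f i else 0ℚ) ≡ f a
  ∑-pick {suc n} f zero = trans (cong (f zero +_) (∑-zero {n} (λ i → refl))) (ℚ.+-identityʳ (f zero))
  ∑-pick {suc n} f (suc a) = trans (ℚ.+-identityˡ _)
    (trans (∑-cong (λ i → cong (λ b → if b then f (suc i) else 0ℚ) (eqᵇ-suc i a))) (∑-pick (f ∘ suc) a))

  ∑-splitAt : ∀ m {n} (f : Fin m ⊎ Fin n → ℚ) → ∑ (f ∘ splitAt m) ≡ ∑ (f ∘ inj₁) + ∑ (f ∘ inj₂)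
  ∑-splitAt zero f = sym (ℚ.+-identityˡ _)
  ∑-splitAt (suc m) f = trans (cong (f (inj₁ zero) +_) (trans (∑-cong (λ i → merge (splitAt m i))) (∑-splitAt m f′))) (sym (ℚ.+-assoc (f (inj₁ zero)) _ _))
    where
    f′ : Fin m ⊎ _ → ℚ
    f′ (inj₁ i) = f (inj₁ (suc i))
    f′ (inj₂ j) = f (inj₂ j)
    merge : ∀ z → f (map₁ suc z) ≡ f′ z
    merge (inj₁ i) = refl
    merge (inj₂ j) = refl

  total-pick : ∀ {n} (i : Fin n) x → total (λ a → if eqᵇ i a then x else 0ℤ) ≡ x
  total-pick {suc n} zero x = trans (cong (ℤ._+_ x) (total-zero n)) (ℤ.+-identityʳ x)
  total-pick {suc n} (suc i) x = trans (ℤ.+-identityˡ _)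
    (trans (total-cong (λ a → cong (λ b → if b then x else 0ℤ) (eqᵇ-suc i a))) (total-pick i x))

  drop-first : ∀ {N k} (G : SimpleGraph N) (f : Fin (suc k) → Fin N × Fin N) → AffIndep G f → AffIndep G (f ∘ suc)
  drop-first G f indep μ tot left right s = indep μ′ (trans (ℚ.+-identityˡ _) tot)
      (λ a → trans (cong₂ _+_ (if-same (eqᵇ (proj₁ (f zero)) a)) refl) (trans (ℚ.+-identityˡ _) (left a)))
      (λ b → trans (cong₂ _+_ (if-same (eqᵇ (proj₂ (f zero)) b)) refl) (trans (ℚ.+-identityˡ _) (right b))) (suc s)
    where
    μ′ : Fin (suc _) → ℚ
    μ′ zero = 0ℚ
    μ′ (suc s) = μ s
    if-same : ∀ b → (if b then 0ℚ else 0ℚ) ≡ 0ℚ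
    if-same true = refl
    if-same false = refl

  subfamily : ∀ {N k l} {G : SimpleGraph N} → k ℕ.≤′ l → (f : Fin l → Fin N × Fin N) → AffIndep G f →
              Σ (Fin k → Fin l) λ h → AffIndep G (f ∘ h)
  subfamily ℕ.≤′-refl f indep = (λ s → s) , indep
  subfamily {G = G} (ℕ.≤′-step k≤l) f indep with subfamily {G = G} k≤l (f ∘ suc) (drop-first G f indep)
  ... | h , indep′ = suc ∘ h , indep′

  module _ {n} (G : SimpleGraph (suc n)) where

    private
      N = suc n

    -- The 2N marginals satisfy one linear relation, so one of them can be dropped.
    dependent : (f : Fin (suc (suc (n ℕ.+ n))) → Fin N × Fin N) → ¬ AffIndep G f
    dependent f indep with homogeneous-solution (suc (n ℕ.+ n)) A
      where
      A : Fin (N ℕ.+ n) → Fin (suc (suc (n ℕ.+ n))) → ℤ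
      A r s = [ (λ a → if eqᵇ (proj₁ (f s)) a then 1ℤ else 0ℤ) , (λ b → if eqᵇ (proj₂ (f s)) (suc b) then 1ℤ else 0ℤ) ]′ (splitAt N r)
    ... | x , (s , xs≢0) , solves = xs≢0 (ℤ→ℚ-injective {x s} {0ℤ} (indep (ℤ→ℚ ∘ x) total-x left right s))
      where
      coord : (Fin (suc (suc (n ℕ.+ n))) → Fin N) → Fin N → ℤ
      coord g a = total (λ s → if eqᵇ (g s) a then x s else 0ℤ)
      if-* : ∀ b y → (if b then 1ℤ else 0ℤ) ℤ.* y ≡ (if b then y else 0ℤ)
      if-* true y = ℤ.*-identityˡ y
      if-* false y = ℤ.*-zeroˡ y
      left′ : ∀ a → coord (proj₁ ∘ f) a ≡ 0ℤ
      left′ a = trans (total-cong (λ s → trans (sym (if-* (eqᵇ (proj₁ (f s)) a) (x s)))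
          (cong (λ z → [ (λ a → if eqᵇ (proj₁ (f s)) a then 1ℤ else 0ℤ) , (λ b → if eqᵇ (proj₂ (f s)) (suc b) then 1ℤ else 0ℤ) ]′ z ℤ.* x s)
            (sym (splitAt-↑ˡ N a n))))) (solves (a ↑ˡ n))
      right-suc : ∀ b → coord (proj₂ ∘ f) (suc b) ≡ 0ℤ
      right-suc b = trans (total-cong (λ s → trans (sym (if-* (eqᵇ (proj₂ (f s)) (suc b)) (x s)))
          (cong (λ z → [ (λ a → if eqᵇ (proj₁ (f s)) a then 1ℤ else 0ℤ) , (λ b → if eqᵇ (proj₂ (f s)) (suc b) then 1ℤ else 0ℤ) ]′ z ℤ.* x s)
            (sym (splitAt-↑ʳ N n b))))) (solves (N ↑ʳ b))
      coord-total : ∀ g → total (coord g) ≡ total x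
      coord-total g = trans (total-comm (λ a s → if eqᵇ (g s) a then x s else 0ℤ)) (total-cong (λ s → total-pick (g s) (x s)))
      x-total : total x ≡ 0ℤ
      x-total = trans (sym (coord-total (proj₁ ∘ f))) (trans (total-cong left′) (total-zero N))
      right-zero : coord (proj₂ ∘ f) zero ≡ 0ℤ
      right-zero = begin
        coord (proj₂ ∘ f) zero                                            ≡⟨ ℤ.+-identityʳ _ ⟨
        coord (proj₂ ∘ f) zero ℤ.+ 0ℤ                                     ≡⟨ cong (ℤ._+_ (coord (proj₂ ∘ f) zero)) (trans (total-cong right-suc) (total-zero n)) ⟨
        total (coord (proj₂ ∘ f))                                         ≡⟨ coord-total (proj₂ ∘ f) ⟩
        total x                                                           ≡⟨ x-total ⟩
        0ℤ ∎
        where open ≡-Reasoning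
      right′ : ∀ b → coord (proj₂ ∘ f) b ≡ 0ℤ
      right′ zero = right-zero
      right′ (suc b) = right-suc b
      total-x : ∑ (ℤ→ℚ ∘ x) ≡ 0ℚ
      total-x = trans (∑-ℤ→ℚ x) (cong ℤ→ℚ x-total)
      lift : ∀ g a → coord g a ≡ 0ℤ → ∑ (λ s → if eqᵇ (g s) a then ℤ→ℚ (x s) else 0ℚ) ≡ 0ℚ
      lift g a eq = trans (∑-cong (λ s → if-ℤ→ℚ (eqᵇ (g s) a) (x s))) (trans (∑-ℤ→ℚ (λ s → if eqᵇ (g s) a then x s else 0ℤ)) (cong ℤ→ℚ eq))
      left : ∀ a → ∑ (λ s → if eqᵇ (proj₁ (f s)) a then ℤ→ℚ (x s) else 0ℚ) ≡ 0ℚ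
      left a = lift (proj₁ ∘ f) a (left′ a)
      right : ∀ b → ∑ (λ s → if eqᵇ (proj₂ (f s)) b then ℤ→ℚ (x s) else 0ℚ) ≡ 0ℚ
      right b = lift (proj₂ ∘ f) b (right′ b)

    -- Balls around the root `zero`. As they are decidable, there is a least radius, the distance
    -- from the root, and with it a breadth-first spanning tree.
    Within : ℕ → Fin N → Set
    Within zero i = i ≡ zero
    Within (suc k) i = Within k i ⊎ ∃ λ j → adj G i j ≡ true × Within k j

    within? : ∀ k i → Dec (Within k i)
    within? zero i = i ≟ zero
    within? (suc k) i = within? k i ⊎-dec any? (λ j → (adj G i j Bool.≟ true) ×-dec within? k j)

    within-mono : ∀ {k l i} → k ℕ.≤ l → Within k i → Within l i
    within-mono {l = zero} z≤n w = w
    within-mono {k} {suc l} k≤l w with k ℕ.≟ suc l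
    ... | yes refl = w
    ... | no k≢l = inj₁ (within-mono (ℕ.s≤s⁻¹ (ℕ.≤∧≢⇒< k≤l k≢l)) w)

    reach⇒within : ∀ {i} → Reach G i zero → ∃ λ k → Within k i
    reach⇒within here = 0 , refl
    reach⇒within (step e r) with reach⇒within r
    ... | k , w = suc k , inj₂ (_ , e , w)

    least : ∀ k {i} → Within k i → ∃ λ d → Within d i × (∀ {l} → Within l i → d ℕ.≤ l)
    least zero w = 0 , w , λ _ → z≤n
    least (suc k) {i} w with within? k i
    ... | yes w′ = least k w′
    ... | no ¬w = suc k , w , λ {l} w′ → ℕ.≰⇒> (λ l≤k → ¬w (within-mono l≤k w′))

    module _ (conn : Connected G) where

      private
        distance : ∀ i → ∃ λ d → Within d i × (∀ {l} → Within l i → d ℕ.≤ l)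
        distance i with reach⇒within (conn i zero)
        ... | k , w = least k w

      depth : Fin N → ℕ
      depth i = proj₁ (distance i)

      parent : ∀ i → ∃ λ j → adj G (suc i) j ≡ true × depth j ℕ.< depth (suc i)
      parent i with distance (suc i)
      ... | suc d , inj₁ w , minimal = contradiction (minimal w) (ℕ.<⇒≱ (ℕ.n<1+n d))
      ... | suc d , inj₂ (j , e , w) , _ = j , e , s≤s (proj₂ (proj₂ (distance j)) w)

      -- All N loops and, for each vertex except the root, the edge to its parent in one of its two
      -- orientations: 2n + 1 generators.
      tree : Fin (suc (n ℕ.+ n)) → Fin N × Fin N
      tree zero = zero , zero
      tree (suc s) = [ (λ i → suc i , suc i) , (λ i → suc i , proj₁ (parent i)) ]′ (splitAt n s)

      tree-allowed : AllowedFamily G tree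
      tree-allowed zero = inj₁ refl
      tree-allowed (suc s) with splitAt n s
      ... | inj₁ i = inj₁ refl
      ... | inj₂ i = inj₂ (proj₁ (proj₂ (parent i)))

      -- From the deepest vertices upwards: column i kills the coefficient of the loop at i, then row i that of the edge to its parent.
      tree-independent : AffIndep G tree
      tree-independent μ _ left right = vanish
        where
        open ≡-Reasoning
        m t : Fin n → ℚ
        m i = μ (suc (i ↑ˡ n))
        t i = μ (suc (n ↑ʳ i))
        w : Fin n ⊎ Fin n → ℚ
        w = [ m , t ]′
        w-splitAt : ∀ s → μ (suc s) ≡ w (splitAt n s)
        w-splitAt s with splitAt n s in eq
        ... | inj₁ i = cong (μ ∘ suc) (sym (splitAt⁻¹-↑ˡ eq))
        ... | inj₂ i = cong (μ ∘ suc) (sym (splitAt⁻¹-↑ʳ eq))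
        pair : Fin n ⊎ Fin n → Fin N × Fin N
        pair = [ (λ i → suc i , suc i) , (λ i → suc i , proj₁ (parent i)) ]′
        expand : ∀ (π : Fin N × Fin N → Fin N) a → ∑ (λ s → if eqᵇ (π (tree s)) a then μ s else 0ℚ) ≡
                 (if eqᵇ (π (zero , zero)) a then μ zero else 0ℚ) +
                 (∑ (λ i → if eqᵇ (π (suc i , suc i)) a then m i else 0ℚ) + ∑ (λ i → if eqᵇ (π (suc i , proj₁ (parent i))) a then t i else 0ℚ))
        expand π a = cong (_+_ (if eqᵇ (π (zero , zero)) a then μ zero else 0ℚ))
          (trans (∑-cong (λ s → cong (λ y → if eqᵇ (π (pair (splitAt n s))) a then y else 0ℚ) (w-splitAt s)))
                 (∑-splitAt n (λ z → if eqᵇ (π (pair z)) a then w z else 0ℚ)))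
        pick-suc : ∀ (f : Fin n → ℚ) i → ∑ (λ j → if eqᵇ (suc j) (suc i) then f j else 0ℚ) ≡ f i
        pick-suc f i = trans (∑-cong (λ j → cong (λ b → if b then f j else 0ℚ) (eqᵇ-suc j i))) (∑-pick f i)
        root : μ zero ≡ 0ℚ
        root = begin
          μ zero                                     ≡⟨ trans (cong (μ zero +_) (ℚ.+-identityˡ 0ℚ)) (ℚ.+-identityʳ (μ zero)) ⟨
          μ zero + (0ℚ + 0ℚ)                         ≡⟨ cong (μ zero +_) (cong₂ _+_ (∑-zero {f = λ (_ : Fin n) → 0ℚ} (λ _ → refl)) (∑-zero {f = λ (_ : Fin n) → 0ℚ} (λ _ → refl))) ⟨
          _                                          ≡⟨ expand proj₁ zero ⟨
          _                                          ≡⟨ left zero ⟩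
          0ℚ ∎
        left-suc : ∀ i → m i + t i ≡ 0ℚ
        left-suc i = trans (sym (ℚ.+-identityˡ _)) (trans (cong (0ℚ +_) (sym (cong₂ _+_ (pick-suc m i) (pick-suc t i)))) (trans (sym (expand proj₁ (suc i))) (left (suc i))))
        right-suc : ∀ i → m i + ∑ (λ j → if eqᵇ (proj₁ (parent j)) (suc i) then t j else 0ℚ) ≡ 0ℚ
        right-suc i = trans (sym (ℚ.+-identityˡ _)) (trans (cong (λ z → 0ℚ + (z + ∑ (λ j → if eqᵇ (proj₁ (parent j)) (suc i) then t j else 0ℚ))) (sym (pick-suc m i)))
          (trans (sym (expand proj₂ (suc i))) (right (suc i))))
        t≡0⇐m≡0 : ∀ i → m i ≡ 0ℚ → t i ≡ 0ℚ
        t≡0⇐m≡0 i m≡0 = trans (sym (ℚ.+-identityˡ (t i))) (trans (cong (_+ t i) (sym m≡0)) (left-suc i))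
        m≡0 : ∀ k i → sum depth ℕ.< k ℕ.+ depth (suc i) → m i ≡ 0ℚ
        m≡0 zero i lt = contradiction (term≤sum depth (suc i)) (ℕ.<⇒≱ lt)
        m≡0 (suc k) i lt = trans (sym (ℚ.+-identityʳ (m i))) (trans (cong (m i +_) (sym (∑-zero children))) (right-suc i))
          where
          children : ∀ j → (if eqᵇ (proj₁ (parent j)) (suc i) then t j else 0ℚ) ≡ 0ℚ
          children j with proj₁ (parent j) ≟ suc i
          ... | no _ = refl
          ... | yes eq = t≡0⇐m≡0 j (m≡0 k j (ℕ.<-≤-trans lt (ℕ.≤-trans (ℕ.≤-reflexive (sym (ℕ.+-suc k (depth (suc i)))))
                  (ℕ.+-monoʳ-≤ k (subst (λ p → depth p ℕ.< depth (suc j)) eq (proj₂ (proj₂ (parent j))))))))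
        m-all : ∀ i → m i ≡ 0ℚ
        m-all i = m≡0 (suc (sum depth)) i (ℕ.m≤m+n (suc (sum depth)) (depth (suc i)))
        vanish : ∀ s → μ s ≡ 0ℚ
        vanish zero = root
        vanish (suc s) with splitAt n s | w-splitAt s
        ... | inj₁ i | eq = trans eq (m-all i)
        ... | inj₂ i | eq = trans eq (t≡0⇐m≡0 i (m-all i))

      dim-connected : Dim G (n ℕ.+ n)
      dim-connected = (tree , tree-allowed , tree-independent) , λ f _ → dependent f

      -- Affine independence passes to subfamilies. A smaller d is refuted by a part of `tree`, a
      -- larger one by a part of the given family, which is too big by `dependent`.
      dim-unique : ∀ {d} → Dim G d → d ≡ n ℕ.+ n
      dim-unique {d} ((f , allowed , indep) , maximal) with ℕ.<-cmp d (n ℕ.+ n)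
      ... | tri≈ _ eq _ = eq
      ... | tri< lt _ _ with subfamily {G = G} (ℕ.≤⇒≤′ (s≤s lt)) tree tree-independent
      ...   | h , indep′ = contradiction indep′ (maximal (tree ∘ h) (tree-allowed ∘ h))
      dim-unique {d} ((f , allowed , indep) , maximal) | tri> _ _ gt with subfamily {G = G} (ℕ.≤⇒≤′ (s≤s gt)) f indep
      ...   | h , indep′ = contradiction indep′ (dependent (f ∘ h))

-- The inequalities between the counts of G and G △ e

module Sandwich where

  open import Data.Nat.Base
  open import Data.Nat.Properties
  open import Data.Nat.Tactic.RingSolver using (solve-∀)
  open import Relation.Binary.PropositionalEquality
  open Sequences

  private
    lin≤ : ∀ {x y l r} → x ≤ y → l + y ≤ r + x → l ≤ r
    lin≤ {x} {y} {l} {r} h le = +-cancelʳ-≤ x l r (≤-trans (+-monoʳ-≤ l h) le)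

  before-mono : ∀ {f g} → (∀ s → f s ≤ g s) → ∀ t → before f t ≤ before g t
  before-mono le zero = z≤n
  before-mono le (suc t) = +-mono-≤ (le t) (before-mono le t)

  before-suc : ∀ f t → before f (suc t) ≡ f 0 + before (λ s → f (suc s)) t
  before-suc f zero = refl
  before-suc f (suc t) = trans (cong (f (suc t) +_) (before-suc f t)) (lem (f (suc t)) (f 0) _)
    where
    lem : ∀ x y z → x + (y + z) ≡ y + (x + z)
    lem = solve-∀

  before-* : ∀ k f t → before (λ s → k * f s) t ≡ k * before f t
  before-* k f zero = sym (*-zeroʳ k)
  before-* k f (suc t) = trans (cong (k * f t +_) (before-* k f t)) (sym (*-distribˡ-+ k (f t) (before f t)))

  -- The virtual edges come in steps of degree 2 and contribute `skip`. In the sum of two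
  -- consecutive terms of h both parities occur, `skip+skip` makes ordinary partial sums of them,
  -- and these combine with f to m.
  half-sum : ∀ {h f x y m : ℕ → ℕ} → h 0 ≡ f 0 → (∀ t → h (suc t) ≡ h t + (f (suc t) + (skip x (suc t) + skip y (suc t)))) →
             (∀ t → f t + before x t ≡ m t) → (∀ t → f t + before y t ≡ m t) →
             ∀ t → h (suc t) + h t ≡ f (suc t) + (before m (suc t) + before m (suc t))
  half-sum {h} {f} {x} {y} {m} h0 hs fx fy zero = begin
    h 1 + h 0                              ≡⟨ cong₂ _+_ (trans (hs 0) (cong (_+ (f 1 + 0)) h0)) h0 ⟩
    f 0 + (f 1 + 0) + f 0                  ≡⟨ lem (f 0) (f 1) ⟩
    f 1 + (f 0 + 0 + 0 + (f 0 + 0 + 0))    ≡⟨ cong (λ z → f 1 + (z + 0 + (z + 0))) (fx 0) ⟩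
    f 1 + (m 0 + 0 + (m 0 + 0)) ∎
    where
    open ≡-Reasoning
    lem : ∀ a b → a + (b + 0) + a ≡ b + (a + 0 + 0 + (a + 0 + 0))
    lem = solve-∀
  half-sum {h} {f} {x} {y} {m} h0 hs fx fy (suc t) = begin
    h (2 + t) + h (1 + t)
      ≡⟨ cong₂ _+_ (hs (suc t)) (hs t) ⟩
    h (1 + t) + (f (2 + t) + (skip x (2 + t) + skip y (2 + t))) + (h t + (f (1 + t) + (skip x (1 + t) + skip y (1 + t))))
      ≡⟨ l₁ (h (1 + t)) (f (2 + t)) (skip x (2 + t)) (skip y (2 + t)) (h t) (f (1 + t)) (skip x (1 + t)) (skip y (1 + t)) ⟩
    h (1 + t) + h t + (f (2 + t) + (f (1 + t) + (skip x (2 + t) + skip x (1 + t)) + (skip y (2 + t) + skip y (1 + t))))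
      ≡⟨ cong₂ (λ p q → p + (f (2 + t) + q)) (half-sum {h} {f} {x} {y} {m} h0 hs fx fy t) (cong₂ (λ p q → f (1 + t) + p + q) (skip+skip x (1 + t)) (skip+skip y (1 + t))) ⟩
    f (1 + t) + (b + b) + (f (2 + t) + (f (1 + t) + before x (1 + t) + before y (1 + t)))
      ≡⟨ l₂ (f (1 + t)) b (f (2 + t)) (before x (1 + t)) (before y (1 + t)) ⟩
    f (2 + t) + (f (1 + t) + before x (1 + t) + b + (f (1 + t) + before y (1 + t) + b))
      ≡⟨ cong₂ (λ p q → f (2 + t) + (p + b + (q + b))) (fx (1 + t)) (fy (1 + t)) ⟩
    f (2 + t) + (m (1 + t) + b + (m (1 + t) + b)) ∎
    where
    open ≡-Reasoning
    b = before m (1 + t)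
    l₁ : ∀ a b c d e f g i → a + (b + (c + d)) + (e + (f + (g + i))) ≡ a + e + (b + (f + (c + g) + (d + i)))
    l₁ = solve-∀
    l₂ : ∀ a b c d e → a + (b + b) + (c + (a + d + e)) ≡ c + (a + d + b + (a + e + b))
    l₂ = solve-∀

  -- c, h, a count a graph G with a vertex of degree 2 (all, one half, the strict half) and c′, h′, a′ count G △ e;
  -- f and f′ count the fans in which only the left copy of the new vertex is attached, m the graph with two right vertices identified.
  module Bounds {c h a f m c′ h′ a′ f′ : ℕ → ℕ}
    (c≡ : ∀ t → c t ≡ h t + a t) (a≤h : ∀ t → a t ≤ h t) (h≤a : ∀ t → h t ≤ a (suc t)) (h-step : ∀ t → h t + f (suc t) ≤ h (suc t))
    (h-sum : ∀ t → h (suc t) + h t ≡ f (suc t) + (before m (suc t) + before m (suc t)))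
    (c′≡ : ∀ t → c′ t ≡ h′ t + a′ t) (a′≤h′ : ∀ t → a′ t ≤ h′ t) (h′≤a′ : ∀ t → h′ t ≤ a′ (suc t)) (h′0 : h′ 0 ≡ f′ 0)
    (h′-sum : ∀ t → h′ (suc t) + h′ t ≡ f′ (suc t) + (before f′ (suc t) + before f′ (suc t)))
    (f′0 : f′ 0 ≡ c 0) (f′-step : ∀ t → f′ (suc t) ≡ f′ t + (c (suc t) + before m (suc t))) where

    private
      b : ℕ → ℕ
      b = before m

      -- Together with `2b≤c` it encloses c(t) between 2 b(t) and 2 b(t + 1). The isolated summand
      -- f(t + 1) of `h-sum` is absorbed by `h-step`, which trades it for the step from h(t) to h(t
      -- + 1).
      c≤2b : ∀ t → c t ≤ 2 * b (suc t)
      c≤2b t = lin≤ (h-step t) (begin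
        c t + h (suc t)                                   ≡⟨ cong (_+ h (suc t)) (c≡ t) ⟩
        h t + a t + h (suc t)                             ≤⟨ +-monoˡ-≤ (h (suc t)) (+-monoʳ-≤ (h t) (a≤h t)) ⟩
        h t + h t + h (suc t)                             ≡⟨ l₁ (h t) (h (suc t)) ⟩
        h (suc t) + h t + h t                             ≡⟨ cong (_+ h t) (h-sum t) ⟩
        f (suc t) + (b (suc t) + b (suc t)) + h t         ≡⟨ l₂ (f (suc t)) (b (suc t)) (h t) ⟩
        2 * b (suc t) + (h t + f (suc t)) ∎)
        where
        open ≤-Reasoning
        l₁ : ∀ x y → x + x + y ≡ y + x + x
        l₁ = solve-∀
        l₂ : ∀ x y z → x + (y + y) + z ≡ 2 * y + (z + x)
        l₂ = solve-∀

      2b≤c : ∀ t → 2 * b t ≤ c t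
      2b≤c zero = z≤n
      2b≤c (suc t) = begin
        2 * b (suc t)                                ≡⟨ cong (b (suc t) +_) (+-identityʳ _) ⟩
        b (suc t) + b (suc t)                        ≤⟨ m≤n+m _ (f (suc t)) ⟩
        f (suc t) + (b (suc t) + b (suc t))          ≡⟨ h-sum t ⟨
        h (suc t) + h t                              ≤⟨ +-monoʳ-≤ (h (suc t)) (h≤a t) ⟩
        h (suc t) + a (suc t)                        ≡⟨ c≡ (suc t) ⟨
        c (suc t) ∎
        where open ≤-Reasoning

      f′≡ : ∀ t → f′ t ≡ upto c t + upto b t
      f′≡ zero = trans f′0 (lem (c 0))
        where
        lem : ∀ x → x ≡ x + 0 + 0
        lem = solve-∀
      f′≡ (suc t) = trans (f′-step t) (trans (cong (_+ (c (suc t) + b (suc t))) (f′≡ t)) (lem (upto c t) (upto b t) (c (suc t)) (b (suc t))))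
        where
        lem : ∀ x y z w → x + y + (z + w) ≡ z + x + (w + y)
        lem = solve-∀

      2f′≡ : ∀ t → 2 * f′ t ≡ 2 * upto c t + upto (λ s → 2 * b s) t
      2f′≡ t = trans (cong (2 *_) (f′≡ t)) (trans (*-distribˡ-+ 2 (upto c t) (upto b t)) (cong (2 * upto c t +_) (sym (before-* 2 b (suc t)))))

      2f′≤ : ∀ t → 2 * f′ t ≤ 3 * upto c t
      2f′≤ t = begin
        2 * f′ t                                     ≡⟨ 2f′≡ t ⟩
        2 * upto c t + upto (λ s → 2 * b s) t        ≤⟨ +-monoʳ-≤ (2 * upto c t) (before-mono 2b≤c (suc t)) ⟩
        2 * upto c t + upto c t                      ≡⟨ lem (upto c t) ⟩
        3 * upto c t ∎
        where
        open ≤-Reasoning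
        lem : ∀ x → 2 * x + x ≡ 3 * x
        lem = solve-∀

      2f′≥ : ∀ t → 3 * before c t ≤ 2 * f′ t
      2f′≥ t = begin
        3 * before c t                                      ≡⟨ lem (before c t) ⟩
        2 * before c t + before c t                         ≤⟨ +-mono-≤ (*-monoʳ-≤ 2 (m≤n+m (before c t) (c t))) (before-mono c≤2b t) ⟩
        2 * upto c t + before (λ s → 2 * b (suc s)) t       ≡⟨ cong (2 * upto c t +_) (before-suc (λ s → 2 * b s) t) ⟨
        2 * upto c t + upto (λ s → 2 * b s) t               ≡⟨ 2f′≡ t ⟨
        2 * f′ t ∎
        where
        open ≤-Reasoning
        lem : ∀ x → 3 * x ≡ 2 * x + x
        lem = solve-∀

      -- In `h′-sum` the place of m is taken by f′ itself. So the equation is the one satisfied by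
      -- the partial sums of f′, and induction applies.
      h′≡ : ∀ t → h′ t ≡ upto f′ t
      h′≡ zero = trans h′0 (sym (+-identityʳ _))
      h′≡ (suc t) = +-cancelʳ-≡ (h′ t) _ _ (trans (h′-sum t) (trans (sym (+-assoc (f′ (suc t)) (upto f′ t) (upto f′ t))) (cong (upto f′ (suc t) +_) (sym (h′≡ t)))))

      before-before : ∀ t → before (before c) (suc t) ≡ before (upto c) t
      before-before t = before-suc (before c) t

    count-upper : ∀ t → c′ t ≤ 3 * upto (upto c) t
    count-upper t = begin
      c′ t                                 ≡⟨ c′≡ t ⟩
      h′ t + a′ t                          ≤⟨ +-monoʳ-≤ (h′ t) (a′≤h′ t) ⟩
      h′ t + h′ t                          ≡⟨ trans (cong (λ z → z + z) (h′≡ t)) (sym (cong (upto f′ t +_) (+-identityʳ _))) ⟩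
      2 * upto f′ t                        ≡⟨ before-* 2 f′ (suc t) ⟨
      upto (λ s → 2 * f′ s) t              ≤⟨ before-mono 2f′≤ (suc t) ⟩
      upto (λ s → 3 * upto c s) t          ≡⟨ before-* 3 (upto c) (suc t) ⟩
      3 * upto (upto c) t ∎
      where open ≤-Reasoning

    -- One unit of the shift stems from c(t) ≤ 2 b(t + 1), the other from the passage from a half to
    -- the strict half.
    count-lower : ∀ t → 3 * upto (upto c) t ≤ c′ (2 + t)
    count-lower t = begin
      3 * upto (upto c) t                  ≡⟨ cong (3 *_) (before-before (suc t)) ⟨
      3 * upto (before c) (suc t)          ≡⟨ before-* 3 (before c) (2 + t) ⟨
      upto (λ s → 3 * before c s) (suc t)  ≤⟨ before-mono 2f′≥ (2 + t) ⟩
      upto (λ s → 2 * f′ s) (suc t)        ≡⟨ before-* 2 f′ (2 + t) ⟩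
      2 * upto f′ (suc t)                  ≡⟨ trans (cong (upto f′ (suc t) +_) (+-identityʳ _)) (cong (λ z → z + z) (sym (h′≡ (suc t)))) ⟩
      h′ (suc t) + h′ (suc t)              ≤⟨ +-mono-≤ (≤-trans (h′≤a′ (suc t)) (a′≤h′ (2 + t))) (h′≤a′ (suc t)) ⟩
      h′ (2 + t) + a′ (2 + t)              ≡⟨ c′≡ (2 + t) ⟨
      c′ (2 + t) ∎
      where open ≤-Reasoning

-- The two extensions: G over G - u, and G △ e over G

module Triangle where

  open import Data.Nat.Base as ℕ using (ℕ; zero; suc)
  import Data.Nat.Properties as ℕ
  open import Data.Integer.Base using (+_; 0ℤ)
  open import Data.Bool.Base using (true; false; _∨_)
  import Data.Bool.Properties as Bool
  open import Data.Maybe.Base as Maybe using (Maybe; just; nothing; maybe′)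
  open import Data.Fin.Base using (Fin; zero; suc; inject₁; fromℕ)
  open import Data.Fin.Properties using (_≟_; any?; inject₁-injective; fromℕ≢inject₁)
  open import Data.Fin.Relation.Unary.Top using (View; view; ‵fromℕ; ‵inject₁)
  open import Data.List.Base using ([]; _∷_; length; filterᵇ; allFin)
  open import Data.List.Membership.Propositional using (_∈_)
  open import Data.List.Membership.Propositional.Properties using (∈-filter⁺; ∈-filter⁻; ∈-allFin)
  open import Data.List.Relation.Unary.Any using (here; there)
  open import Data.List.Relation.Unary.All using ([]; _∷_)
  open import Data.List.Relation.Unary.AllPairs using ([]; _∷_)
  open import Data.List.Relation.Unary.Unique.Propositional using (Unique)
  open import Data.List.Relation.Unary.Unique.Propositional.Properties using (filter⁺; allFin⁺)
  open import Data.Product.Base using (∃; _×_; _,_; proj₂)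
  open import Data.Sum.Base using (_⊎_; inj₁; inj₂)
  open import Function.Base using (_∘_)
  open import Function.Bundles using (Equivalence)
  open import Relation.Binary.PropositionalEquality
  open import Relation.Binary.Definitions using (Decidable)
  open import Relation.Nullary
  open Flows
  open Cones
  open Counting
  open Sequences
  open Fans
  open Merging
  open Extensions
  open Sandwich
  open LatticePoints
  open Volumes using (count)
  open import Defs using (SimpleGraph; adj; irrefl; Allowed; classify; eqᵇ; triAdjM; _△_; degree; Reach; here; step; Connected)

  classify-inject₁ : ∀ {N} (a : Fin N) → classify (inject₁ a) ≡ just a
  classify-inject₁ zero = refl
  classify-inject₁ (suc a) = cong (Maybe.map suc) (classify-inject₁ a)

  classify-fromℕ : ∀ N → classify (fromℕ N) ≡ nothing
  classify-fromℕ zero = refl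
  classify-fromℕ (suc N) = cong (Maybe.map suc) (classify-fromℕ N)

  eqᵇ-true : ∀ {N} {i j : Fin N} → eqᵇ i j ≡ true → i ≡ j
  eqᵇ-true {i = i} {j} eq with i ≟ j
  ... | yes i≡j = i≡j

  eqᵇ-refl : ∀ {N} (i : Fin N) → eqᵇ i i ≡ true
  eqᵇ-refl i with i ≟ i
  ... | yes _ = refl
  ... | no i≢i = contradiction refl i≢i

  ∨-true : ∀ {x y} → x ∨ y ≡ true → x ≡ true ⊎ y ≡ true
  ∨-true {true} _ = inj₁ refl
  ∨-true {false} eq = inj₂ eq

  other-neighbour : ∀ {N} (G : SimpleGraph N) {u v} → adj G u v ≡ true → degree G u ≡ 2 →
                    ∃ λ w → adj G u w ≡ true × v ≢ w × (∀ {x} → adj G u x ≡ true → x ≡ v ⊎ x ≡ w)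
  other-neighbour {N} G {u} {v} uv deg = pick (filterᵇ (adj G u) (allFin N)) deg (filter⁺ T?′ (allFin⁺ N)) from (to uv) to
    where
    T?′ = Bool.T? ∘ adj G u
    to : ∀ {x} → adj G u x ≡ true → x ∈ filterᵇ (adj G u) (allFin N)
    to {x} e = ∈-filter⁺ T?′ (∈-allFin x) (Equivalence.from Bool.T-≡ e)
    from : ∀ {x} → x ∈ filterᵇ (adj G u) (allFin N) → adj G u x ≡ true
    from x∈ = Equivalence.to Bool.T-≡ (proj₂ (∈-filter⁻ T?′ {xs = allFin N} x∈))
    pick : ∀ L → length L ≡ 2 → Unique L → (∀ {x} → x ∈ L → adj G u x ≡ true) → v ∈ L → (∀ {x} → adj G u x ≡ true → x ∈ L) →
           ∃ λ w → adj G u w ≡ true × v ≢ w × (∀ {x} → adj G u x ≡ true → x ≡ v ⊎ x ≡ w)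
    pick (x ∷ y ∷ []) refl ((x≢y ∷ []) ∷ _) adjacent (here refl) covers = y , adjacent (there (here refl)) , x≢y , split
      where
      split : ∀ {z} → adj G u z ≡ true → z ≡ x ⊎ z ≡ y
      split e with covers e
      ... | here eq = inj₁ eq
      ... | there (here eq) = inj₂ eq
    pick (x ∷ y ∷ []) refl ((x≢y ∷ []) ∷ _) adjacent (there (here refl)) covers = x , adjacent (here refl) , x≢y ∘ sym , split
      where
      split : ∀ {z} → adj G u z ≡ true → z ≡ y ⊎ z ≡ x
      split e with covers e
      ... | here eq = inj₂ eq
      ... | there (here eq) = inj₁ eq

  triangle-connected : ∀ {N} (G : SimpleGraph N) u v → Connected G → Connected (G △ (u , v))
  triangle-connected {N} G u v conn i j = go (view i) (view j)
    where
    H = G △ (u , v)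
    lift : ∀ {a b} → Reach G a b → Reach H (inject₁ a) (inject₁ b)
    lift here = here
    lift (step {i = a} {k} e r) = step (trans (cong₂ (triAdjM G u v) (classify-inject₁ a) (classify-inject₁ k)) e) (lift r)
    u-new : adj H (inject₁ u) (fromℕ N) ≡ true
    u-new = trans (cong₂ (triAdjM G u v) (classify-inject₁ u) (classify-fromℕ N)) (cong (_∨ eqᵇ u v) (eqᵇ-refl u))
    new-u : adj H (fromℕ N) (inject₁ u) ≡ true
    new-u = trans (SimpleGraph.sym H (fromℕ N) (inject₁ u)) u-new
    snoc : ∀ {a b} → Reach H a (inject₁ u) → adj H (inject₁ u) b ≡ true → Reach H a b
    snoc here e = step e here
    snoc (step e′ r) e = step e′ (snoc r e)
    go : ∀ {i j} → View i → View j → Reach H i j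
    go ‵fromℕ ‵fromℕ = here
    go ‵fromℕ (‵inject₁ b) = step new-u (lift (conn u b))
    go (‵inject₁ a) ‵fromℕ = snoc (lift (conn a u)) u-new
    go (‵inject₁ a) (‵inject₁ b) = lift (conn a b)

  module Lifting {N} (G : SimpleGraph N) where

    -- G carried over to N + 1 vertices. The new vertex has no edge, not even its loop, as required
    -- of the base of an extension.
    D : Edges (suc N)
    D i j = ∃ λ a → ∃ λ b → i ≡ inject₁ a × j ≡ inject₁ b × Allowed G a b

    D? : Decidable D
    D? i j = any? (λ a → any? (λ b → (i ≟ inject₁ a) ×-dec (j ≟ inject₁ b) ×-dec allowed? G a b))

    allowed-sym : ∀ {a b} → Allowed G a b → Allowed G b a
    allowed-sym (inj₁ eq) = inj₁ (sym eq)
    allowed-sym {a} {b} (inj₂ e) = inj₂ (trans (SimpleGraph.sym G b a) e)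

    D-sym : ∀ {i j} → D i j → D j i
    D-sym (a , b , i≡ , j≡ , w) = b , a , j≡ , i≡ , allowed-sym w

    D-lift : ∀ {a b} → Allowed G a b → D (inject₁ a) (inject₁ b)
    D-lift w = _ , _ , refl , refl , w

    D-isolated : ∀ j → ¬ D (fromℕ N) j
    D-isolated j (a , _ , eq , _) = fromℕ≢inject₁ eq

    embed : Hom N (suc N)
    embed .Hom.⟦_⟧ p (inj₁ i) = maybe′ (p ∘ inj₁) 0ℤ (classify i)
    embed .Hom.⟦_⟧ p (inj₂ j) = maybe′ (p ∘ inj₂) 0ℤ (classify j)
    embed .Hom.cong-≈ eq (inj₁ i) with classify i
    ... | just a = eq (inj₁ a)
    ... | nothing = refl
    embed .Hom.cong-≈ eq (inj₂ j) with classify j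
    ... | just b = eq (inj₂ b)
    ... | nothing = refl
    embed .Hom.homo-𝟎 (inj₁ i) with classify i
    ... | just a = refl
    ... | nothing = refl
    embed .Hom.homo-𝟎 (inj₂ j) with classify j
    ... | just b = refl
    ... | nothing = refl
    embed .Hom.homo-⊕ p q (inj₁ i) with classify i
    ... | just a = refl
    ... | nothing = refl
    embed .Hom.homo-⊕ p q (inj₂ j) with classify j
    ... | just b = refl
    ... | nothing = refl

    open Hom embed using () renaming (⟦_⟧ to ι)

    ι-inject₁ˡ : ∀ p a → ι p (inj₁ (inject₁ a)) ≡ p (inj₁ a)
    ι-inject₁ˡ p a = cong (maybe′ (p ∘ inj₁) 0ℤ) (classify-inject₁ a)

    ι-inject₁ʳ : ∀ p b → ι p (inj₂ (inject₁ b)) ≡ p (inj₂ b)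
    ι-inject₁ʳ p b = cong (maybe′ (p ∘ inj₂) 0ℤ) (classify-inject₁ b)

    ι-injective : ∀ {p q} → ι p ≈ ι q → p ≈ q
    ι-injective {p} {q} eq (inj₁ a) = trans (sym (ι-inject₁ˡ p a)) (trans (eq (inj₁ (inject₁ a))) (ι-inject₁ˡ q a))
    ι-injective {p} {q} eq (inj₂ b) = trans (sym (ι-inject₁ʳ p b)) (trans (eq (inj₂ (inject₁ b))) (ι-inject₁ʳ q b))

    δ-lift : ∀ a i → maybe′ (λ x → + δ a x) 0ℤ (classify i) ≡ + δ (inject₁ a) i
    δ-lift a i = go (view i)
      where
      go : ∀ {i} → View i → maybe′ (λ x → + δ a x) 0ℤ (classify i) ≡ + δ (inject₁ a) i
      go ‵fromℕ = trans (cong (maybe′ (λ x → + δ a x) 0ℤ) (classify-fromℕ N)) (cong +_ (sym (ind-no (inject₁ a ≟ fromℕ N) (fromℕ≢inject₁ ∘ sym))))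
      go (‵inject₁ x) = trans (cong (maybe′ (λ x → + δ a x) 0ℤ) (classify-inject₁ x)) (cong +_ agree)
        where
        agree : δ a x ≡ δ (inject₁ a) (inject₁ x)
        agree with a ≟ x
        ... | yes refl = sym (ind-yes (inject₁ a ≟ inject₁ a) refl)
        ... | no a≢x = sym (ind-no (inject₁ a ≟ inject₁ x) (a≢x ∘ inject₁-injective))

    ι-e : ∀ a b → ι (e a b) ≈ e (inject₁ a) (inject₁ b)
    ι-e a b (inj₁ i) = δ-lift a i
    ι-e a b (inj₂ j) = δ-lift b j

    size-lift : ∀ t → size D? t ≡ count G t
    size-lift t = card-unique (card-cone D? t) (card-⇔ to from
      (card-image ι (Hom.cong-≈ embed) (λ _ _ → ι-injective) (card-cone (allowed? G) t)))
      where
      to : ∀ {r} → Image ι (Cone (Allowed G) t) r → Cone D t r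
      to (p , κ , eq) = cone-resp eq (cone-image embed (λ {a} {b} w → _ , _ , D-lift w , ι-e a b) κ)
      from : ∀ {r} → Cone D t r → Image ι (Cone (Allowed G) t) r
      from = cone-preimage embed λ { (a , b , refl , refl , w) → a , b , w , ι-e a b }

    module _ (u v : Fin N) where

      private
        X : Edges (suc N)
        X = Ext D (fromℕ N) (inject₁ u) (inject₁ v)

      triangle-edges : ∀ {i j} → Allowed (G △ (u , v)) i j → X i j
      triangle-edges {i} {j} = go (view i) (view j)
        where
        new : ∀ {a} → eqᵇ a u ∨ eqᵇ a v ≡ true → a ≡ u ⊎ a ≡ v
        new e with ∨-true e
        ... | inj₁ e′ = inj₁ (eqᵇ-true e′)
        ... | inj₂ e′ = inj₂ (eqᵇ-true e′)
        go : ∀ {i j} → View i → View j → Allowed (G △ (u , v)) i j → X i j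
        go ‵fromℕ ‵fromℕ _ = inj₁ (inj₁ (inj₂ (refl , refl)))
        go ‵fromℕ (‵inject₁ b) (inj₁ eq) = contradiction eq fromℕ≢inject₁
        go ‵fromℕ (‵inject₁ b) (inj₂ e) with new {b} (trans (sym (cong₂ (triAdjM G u v) (classify-fromℕ N) (classify-inject₁ b))) e)
        ... | inj₁ refl = inj₁ (inj₁ (inj₁ (inj₁ (inj₂ (refl , refl)))))
        ... | inj₂ refl = inj₁ (inj₁ (inj₁ (inj₂ (refl , refl))))
        go (‵inject₁ a) ‵fromℕ (inj₁ eq) = contradiction (sym eq) fromℕ≢inject₁
        go (‵inject₁ a) ‵fromℕ (inj₂ e) with new {a} (trans (sym (cong₂ (triAdjM G u v) (classify-inject₁ a) (classify-fromℕ N))) e)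
        ... | inj₁ refl = inj₁ (inj₂ (refl , refl))
        ... | inj₂ refl = inj₂ (refl , refl)
        go (‵inject₁ a) (‵inject₁ b) (inj₁ eq) = inj₁ (inj₁ (inj₁ (inj₁ (inj₁ (D-lift (inj₁ (inject₁-injective eq)))))))
        go (‵inject₁ a) (‵inject₁ b) (inj₂ e) = inj₁ (inj₁ (inj₁ (inj₁ (inj₁ (D-lift (inj₂
          (trans (sym (cong₂ (triAdjM G u v) (classify-inject₁ a) (classify-inject₁ b))) e)))))))

      edges-triangle : ∀ {i j} → X i j → Allowed (G △ (u , v)) i j
      edges-triangle (inj₁ (inj₁ (inj₁ (inj₁ (inj₁ (a , b , refl , refl , inj₁ refl)))))) = inj₁ refl
      edges-triangle (inj₁ (inj₁ (inj₁ (inj₁ (inj₁ (a , b , refl , refl , inj₂ e)))))) =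
        inj₂ (trans (cong₂ (triAdjM G u v) (classify-inject₁ a) (classify-inject₁ b)) e)
      edges-triangle (inj₁ (inj₁ (inj₁ (inj₁ (inj₂ (refl , refl)))))) =
        inj₂ (trans (cong₂ (triAdjM G u v) (classify-fromℕ N) (classify-inject₁ u)) (cong (_∨ eqᵇ u v) (eqᵇ-refl u)))
      edges-triangle (inj₁ (inj₁ (inj₁ (inj₂ (refl , refl))))) =
        inj₂ (trans (cong₂ (triAdjM G u v) (classify-fromℕ N) (classify-inject₁ v)) (trans (cong (eqᵇ v u ∨_) (eqᵇ-refl v)) (Bool.∨-zeroʳ (eqᵇ v u))))
      edges-triangle (inj₁ (inj₁ (inj₂ (refl , refl)))) = inj₁ refl
      edges-triangle (inj₁ (inj₂ (refl , refl))) =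
        inj₂ (trans (cong₂ (triAdjM G u v) (classify-inject₁ u) (classify-fromℕ N)) (cong (_∨ eqᵇ u v) (eqᵇ-refl u)))
      edges-triangle (inj₂ (refl , refl)) =
        inj₂ (trans (cong₂ (triAdjM G u v) (classify-inject₁ v) (classify-fromℕ N)) (trans (cong (eqᵇ v u ∨_) (eqᵇ-refl v)) (Bool.∨-zeroʳ (eqᵇ v u))))

  module CountSandwich {N} (G : SimpleGraph N) (u v w : Fin N) (uv : adj G u v ≡ true) (uw : adj G u w ≡ true) (v≢w : v ≢ w)
                       (only : ∀ {x} → adj G u x ≡ true → x ≡ v ⊎ x ≡ w) where

    open Lifting G

    private
      n p q r : Fin (suc N)
      n = fromℕ N
      p = inject₁ u
      q = inject₁ v
      r = inject₁ w

      loop : ∀ x → D (inject₁ x) (inject₁ x)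
      loop x = D-lift (inj₁ refl)

      not-loop : ∀ {x} → adj G u x ≡ true → u ≢ x
      not-loop e refl with trans (sym (irrefl G u)) e
      ... | ()

      p≢q : p ≢ q
      p≢q = not-loop uv ∘ inject₁-injective
      p≢r : p ≢ r
      p≢r = not-loop uw ∘ inject₁-injective
      q≢r : q ≢ r
      q≢r = v≢w ∘ inject₁-injective

      -- G - u on the unchanged vertex set: u stays as a vertex without edges and without loop,
      -- ready to be attached again by `Ext`.
      D₀ : Edges (suc N)
      D₀ i j = D i j × p ≢ i × p ≢ j
      D₀? : Decidable D₀
      D₀? i j = D? i j ×-dec ¬? (p ≟ i) ×-dec ¬? (p ≟ j)
      D₀-sym : ∀ {i j} → D₀ i j → D₀ j i
      D₀-sym (d , p≢i , p≢j) = D-sym d , p≢j , p≢i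
      D₀-isolated : ∀ j → ¬ D₀ p j
      D₀-isolated j (_ , p≢p , _) = p≢p refl
      D₀-qq : D₀ q q
      D₀-qq = loop v , p≢q , p≢q
      D₀-rr : D₀ r r
      D₀-rr = loop w , p≢r , p≢r

      D-from-p : ∀ {j} → D p j → j ≡ p ⊎ j ≡ q ⊎ j ≡ r
      D-from-p (a , b , eq , refl , w) with inject₁-injective eq
      D-from-p (a , b , eq , refl , inj₁ refl) | refl = inj₁ refl
      D-from-p (a , b , eq , refl , inj₂ e) | refl with only e
      ... | inj₁ refl = inj₂ (inj₁ refl)
      ... | inj₂ refl = inj₂ (inj₂ refl)

      D⇒Ext : ∀ {i j} → D i j → Ext D₀ p q r i j
      D⇒Ext {i} {j} d with p ≟ i | p ≟ j
      ... | no p≢i | no p≢j = inj₁ (inj₁ (inj₁ (inj₁ (inj₁ (d , p≢i , p≢j)))))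
      ... | yes refl | _ with D-from-p d
      ...   | inj₁ refl = inj₁ (inj₁ (inj₂ (refl , refl)))
      ...   | inj₂ (inj₁ refl) = inj₁ (inj₁ (inj₁ (inj₁ (inj₂ (refl , refl)))))
      ...   | inj₂ (inj₂ refl) = inj₁ (inj₁ (inj₁ (inj₂ (refl , refl))))
      D⇒Ext {i} {j} d | no p≢i | yes refl with D-from-p (D-sym d)
      ...   | inj₁ refl = contradiction refl p≢i
      ...   | inj₂ (inj₁ refl) = inj₁ (inj₂ (refl , refl))
      ...   | inj₂ (inj₂ refl) = inj₂ (refl , refl)

      Ext⇒D : ∀ {i j} → Ext D₀ p q r i j → D i j
      Ext⇒D (inj₁ (inj₁ (inj₁ (inj₁ (inj₁ (d , _)))))) = d
      Ext⇒D (inj₁ (inj₁ (inj₁ (inj₁ (inj₂ (refl , refl)))))) = D-lift (inj₂ uv)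
      Ext⇒D (inj₁ (inj₁ (inj₁ (inj₂ (refl , refl))))) = D-lift (inj₂ uw)
      Ext⇒D (inj₁ (inj₁ (inj₂ (refl , refl)))) = loop u
      Ext⇒D (inj₁ (inj₂ (refl , refl))) = D-sym (D-lift (inj₂ uv))
      Ext⇒D (inj₂ (refl , refl)) = D-sym (D-lift (inj₂ uw))

      module E₀ = Extension D₀? D₀-sym p q r D₀-isolated p≢q p≢r q≢r D₀-qq D₀-rr
      module E₁ = Extension D? D-sym n p q D-isolated fromℕ≢inject₁ fromℕ≢inject₁ p≢q (loop u) (loop v)
      module F₁ = FanSize D? n p q D-isolated

      qr? = ▸? D₀? q r
      rq? = ▸? D₀? r q

      -- The fan of u over G - u with the virtual edge wv. Either virtual edge leads to the same
      -- count: `fan₀-rq` by reordering the edges, `fan₀-qr` through `fan-symmetric`.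
      m : ℕ → ℕ
      m t = size (fan? rq? p q r) t

      reorder : ∀ a b {i j} → (Fan D₀ p q r ▸ (a , b)) i j → Fan (D₀ ▸ (a , b)) p q r i j
      reorder a b (inj₁ (inj₁ (inj₁ d))) = inj₁ (inj₁ (inj₁ d))
      reorder a b (inj₁ (inj₁ (inj₂ h))) = inj₁ (inj₂ h)
      reorder a b (inj₁ (inj₂ h)) = inj₂ h
      reorder a b (inj₂ h) = inj₁ (inj₁ (inj₂ h))

      reorder⁻¹ : ∀ a b {i j} → Fan (D₀ ▸ (a , b)) p q r i j → (Fan D₀ p q r ▸ (a , b)) i j
      reorder⁻¹ a b (inj₁ (inj₁ (inj₁ d))) = inj₁ (inj₁ (inj₁ d))
      reorder⁻¹ a b (inj₁ (inj₁ (inj₂ h))) = inj₂ h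
      reorder⁻¹ a b (inj₁ (inj₂ h)) = inj₁ (inj₁ (inj₂ h))
      reorder⁻¹ a b (inj₂ h) = inj₁ (inj₂ h)

      fan₀-rq : ∀ t → size E₀.F? t ℕ.+ before (top-size E₀.F? 1 (e r q)) t ≡ m t
      fan₀-rq t = trans (sym (size-▸ E₀.F? r q t)) (size-cong (▸? E₀.F? r q) (fan? rq? p q r) (reorder r q) (reorder⁻¹ r q) t)

      fan₀-qr : ∀ t → size E₀.F? t ℕ.+ before (top-size E₀.F? 1 (e q r)) t ≡ m t
      fan₀-qr t = trans (sym (size-▸ E₀.F? q r t)) (trans (size-cong (▸? E₀.F? q r) (fan? qr? p q r) (reorder q r) (reorder⁻¹ q r) t)
        (sym (fan-symmetric D₀? D₀-sym p q r D₀-isolated p≢q p≢r q≢r D₀-qq D₀-rr t)))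

      -- In G △ e the neighbours u and v of the new vertex are adjacent, so the virtual edges are
      -- genuine and enlarge nothing. This is why f′ replaces m in `h₁-sum`.
      F₁-redundant : ∀ {a b} → D a b → ∀ t → size E₁.F? t ℕ.+ before (top-size E₁.F? 1 (e a b)) t ≡ size E₁.F? t
      F₁-redundant {a} {b} d t = trans (sym (size-▸ E₁.F? a b t)) (size-cong (▸? E₁.F? a b) E₁.F?
        (λ { (inj₁ f) → f ; (inj₂ (refl , refl)) → inj₁ (inj₁ d) }) inj₁ t)

      -- Identifying the right vertices u and v of G turns the edges at the right vertex u into vv, vv and wv.
      merged⇒fan : ∀ {i j} → Merged D p q i j → Fan (D₀ ▸ (r , q)) p q r i j
      merged⇒fan {i} (j , d , refl) = go (D⇒Ext d)
        where
        go : ∀ {i j} → Ext D₀ p q r i j → Fan (D₀ ▸ (r , q)) p q r i (redirect p q j)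
        go (inj₁ (inj₁ (inj₁ (inj₁ (inj₁ d₀@(_ , _ , p≢j)))))) = subst (Fan (D₀ ▸ (r , q)) p q r _) (sym (redirect-other p q (p≢j ∘ sym))) (inj₁ (inj₁ (inj₁ d₀)))
        go (inj₁ (inj₁ (inj₁ (inj₁ (inj₂ (refl , refl)))))) = inj₁ (inj₂ (refl , redirect-other p q (p≢q ∘ sym)))
        go (inj₁ (inj₁ (inj₁ (inj₂ (refl , refl))))) = inj₂ (refl , redirect-other p q (p≢r ∘ sym))
        go (inj₁ (inj₁ (inj₂ (refl , refl)))) = inj₁ (inj₂ (refl , redirect-self p q))
        go (inj₁ (inj₂ (refl , refl))) = inj₁ (inj₁ (inj₁ (subst (D₀ q) (sym (redirect-self p q)) D₀-qq)))
        go (inj₂ (refl , refl)) = inj₁ (inj₁ (inj₂ (refl , redirect-self p q)))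

      fan⇒merged : ∀ {i j} → Fan (D₀ ▸ (r , q)) p q r i j → Merged D p q i j
      fan⇒merged {j = j} (inj₁ (inj₁ (inj₁ (d , _ , p≢j)))) = j , d , redirect-other p q (p≢j ∘ sym)
      fan⇒merged (inj₁ (inj₁ (inj₂ (refl , refl)))) = p , Ext⇒D (inj₂ (refl , refl)) , redirect-self p q
      fan⇒merged (inj₁ (inj₂ (refl , refl))) = q , D-lift (inj₂ uv) , redirect-other p q (p≢q ∘ sym)
      fan⇒merged (inj₂ (refl , refl)) = r , D-lift (inj₂ uw) , redirect-other p q (p≢r ∘ sym)

      -- The link between the two extensions: the last points in the fan recursion over G are
      -- counted by G with the right vertices u and v identified, and this graph is the fan that
      -- governs the count of G itself.
      tops≡m : ∀ t → top-size D? 0 F₁.shift t ≡ m t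
      tops≡m t = card-unique (card-⇔ (cone-mono merged⇒fan) (cone-mono fan⇒merged) (card-merged n p q p≢q D? t)) (card-cone (fan? rq? p q r) t)

      count₀ : ∀ t → count G t ≡ size E₀.X? t
      count₀ t = trans (sym (size-lift t)) (size-cong D? E₀.X? D⇒Ext Ext⇒D t)

      count₁ : ∀ t → count (G △ (u , v)) t ≡ size E₁.X? t
      count₁ = size-cong (allowed? (G △ (u , v))) E₁.X? (triangle-edges u v) (edges-triangle u v)

      h-step : ∀ t → E₀.half t ℕ.+ size E₀.F? (suc t) ℕ.≤ E₀.half (suc t)
      h-step t = ℕ.≤-trans (ℕ.+-monoʳ-≤ (E₀.half t) (ℕ.m≤m+n _ _)) (ℕ.≤-reflexive (sym (E₀.half-suc t)))

      f′-step : ∀ t → size E₁.F? (suc t) ≡ size E₁.F? t ℕ.+ (count G (suc t) ℕ.+ before m (suc t))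
      f′-step t = trans (F₁.fan-suc t) (cong (size E₁.F? t ℕ.+_) (cong₂ ℕ._+_ (size-lift (suc t)) (before-cong tops≡m (suc t))))

      h₀-sum = half-sum {E₀.half} {size E₀.F?} E₀.half-zero E₀.half-suc fan₀-rq fan₀-qr
      h₁-sum = half-sum {E₁.half} {size E₁.F?} E₁.half-zero E₁.half-suc (F₁-redundant (D-sym (D-lift (inj₂ uv)))) (F₁-redundant (D-lift (inj₂ uv)))

      split₀ : ∀ t → count G t ≡ E₀.half t ℕ.+ E₀.above t
      split₀ t = trans (count₀ t) (E₀.half+above t)

      split₁ : ∀ t → count (G △ (u , v)) t ≡ E₁.half t ℕ.+ E₁.above t
      split₁ t = trans (count₁ t) (E₁.half+above t)

      f′0 = trans F₁.fan-zero (size-lift 0)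

      module B = Bounds {count G} {E₀.half} {E₀.above} {size E₀.F?} {m} {count (G △ (u , v))} {E₁.half} {E₁.above} {size E₁.F?}
        split₀ E₀.above≤half E₀.half≤above h-step h₀-sum split₁ E₁.above≤half E₁.half≤above E₁.half-zero h₁-sum f′0 f′-step

    triangle-upper : ∀ t → count (G △ (u , v)) t ℕ.≤ 3 ℕ.* upto (upto (count G)) t
    triangle-upper = B.count-upper

    triangle-lower : ∀ t → 3 ℕ.* upto (upto (count G)) t ℕ.≤ count (G △ (u , v)) (2 ℕ.+ t)
    triangle-lower = B.count-lower

    count-mono : ∀ t → count G t ℕ.≤ count G (suc t)
    count-mono t = subst₂ ℕ._≤_ (sym (count₀ t)) (sym (count₀ (suc t))) (E₀.size-mono t)

-- Transfer of the asymptotics in both directions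

module Tripling where

  open import Data.Nat.Base as ℕ using (ℕ; zero; suc)
  import Data.Nat.Properties as ℕ
  open import Data.Integer.Base hiding (suc)
  open import Data.Integer.Properties hiding (suc-pred)
  open import Data.Integer.Tactic.RingSolver using (solve-∀)
  open import Data.Product.Base using (_,_)
  open import Function.Base using (_∘_)
  open import Relation.Binary.PropositionalEquality
  open Sequences
  open Binomials
  open Asymptotics
  open Tauberian

  below-triple : ∀ {φ f a} → Below φ f a → Below φ (λ t → + 3 * f t) (+ 3 * a)
  -- The precision is 3(m + 1), since multiplication by 3 triples the error.
  below-triple {φ} {f} {a} below .bound m with bound below (m ℕ.+ suc (m ℕ.+ suc m))
  ... | T , h = T , λ t T≤t → lin≤ (h t T≤t) (lem (+ suc m) (f t) a (+ φ t))
    where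
    lem : ∀ n x a p → n * (+ 3 * x) + ((n + (n + n)) * a + 1ℤ) * p ≡ (n * (+ 3 * a) + 1ℤ) * p + (n + (n + n)) * x
    lem = solve-∀

  below-third : ∀ {φ f a} → Below φ (λ t → + 3 * f t) (+ 3 * a) → Below φ f a
  below-third {φ} {f} {a} below .bound m with bound below m
  ... | T , h = T , λ t T≤t → cancel 2 (lin≤₂ (h t T≤t) (+≤+ (ℕ.z≤n {2 ℕ.* φ t})) (trans (cong (λ z → + 3 * (+ suc m * f t) + (+ suc m * (+ 3 * a) + 1ℤ) * + φ t + z) (pos-* 2 (φ t)))
          (lem (+ suc m) (f t) a (+ φ t))))
    where
    lem : ∀ n x a p → + 3 * (n * x) + (n * (+ 3 * a) + 1ℤ) * p + + 2 * p ≡ + 3 * ((n * a + 1ℤ) * p) + n * (+ 3 * x) + 0ℤ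
    lem = solve-∀

  module _ {c c′ : ℕ → ℕ} (mono : ∀ t → c t ℕ.≤ c (suc t)) (upper : ∀ t → c′ t ℕ.≤ 3 ℕ.* upto (upto c) t)
           (lower : ∀ t → 3 ℕ.* upto (upto c) t ℕ.≤ c′ (2 ℕ.+ t)) (b d : ℕ) (a : ℤ) where

    private
      f f′ U 3U : ℕ → ℤ
      f t = + b * + c t
      f′ t = + b * + c′ t
      U = total (total f)
      3U t = + 3 * U t

      total-upto : ∀ g t → total (λ t → + b * + g t) t ≡ + b * + upto g t
      total-upto g zero = cong (λ z → + b * + z) (sym (ℕ.+-identityʳ (g 0)))
      total-upto g (suc t) = trans (cong (_+_ (+ b * + g (suc t))) (total-upto g t)) (sym (*-distribˡ-+ (+ b) (+ g (suc t)) (+ upto g t)))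

      total-cong : ∀ {g h} → (∀ t → g t ≡ h t) → ∀ t → total g t ≡ total h t
      total-cong eq zero = eq 0
      total-cong eq (suc t) = cong₂ _+_ (eq (suc t)) (total-cong eq t)

      3U≡ : ∀ t → 3U t ≡ + b * + (3 ℕ.* upto (upto c) t)
      3U≡ t = trans (cong (_*_ (+ 3)) (trans (total-cong (total-upto c) t) (total-upto (upto c) t)))
        (trans (lem (+ b) (+ upto (upto c) t)) (cong (_*_ (+ b)) (sym (pos-* 3 (upto (upto c) t)))))
        where
        lem : ∀ b u → + 3 * (b * u) ≡ b * (+ 3 * u)
        lem = solve-∀

      f′≤3U : ∀ t → f′ t ≤ 3U t
      f′≤3U t = subst (f′ t ≤_) (sym (3U≡ t)) (scale b (+≤+ (upper t)))
      3U≤f′ : ∀ t → 3U t ≤ f′ (2 ℕ.+ t)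
      3U≤f′ t = subst (_≤ f′ (2 ℕ.+ t)) (sym (3U≡ t)) (scale b (+≤+ (lower t)))

      neg-triple : ∀ {φ} {g : ℕ → ℤ} → Below φ (λ t → + 3 * - g t) (+ 3 * - a) → Below φ (λ t → - (+ 3 * g t)) (- (+ 3 * a))
      neg-triple {φ} {g} below = subst (Below φ (λ t → - (+ 3 * g t))) (sym (neg-distribʳ-* (+ 3) a))
        (below-≤ (λ t → ≤-reflexive (neg-distribʳ-* (+ 3) (g t))) below)
      triple-neg : ∀ {φ} {g : ℕ → ℤ} → Below φ (λ t → - (+ 3 * g t)) (- (+ 3 * a)) → Below φ (λ t → + 3 * - g t) (+ 3 * - a)
      triple-neg {φ} {g} below = subst (Below φ (λ t → + 3 * - g t)) (neg-distribʳ-* (+ 3) a)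
        (below-≤ (λ t → ≤-reflexive (sym (neg-distribʳ-* (+ 3) (g t)))) below)

    tends-triple : Tends (binom d) f a → Tends (binom (2 ℕ.+ d)) f′ (+ 3 * a)
    tends-triple tends with tends-total (suc d) (tends-total d tends)
    ... | up , down = below-≤ f′≤3U (below-triple {f = U} {a} up) ,
      below-pred (2 ℕ.+ d) (below-pred (2 ℕ.+ d) (below-≤ (λ t → neg-mono-≤ (3U≤f′ t)) (neg-triple {g = U} (below-triple {f = -_ ∘ U} { - a} down))))

    -- Two Tauberian steps undo the two summations. The first needs `total f` to be monotone, which
    -- holds as f is nonnegative, the second f itself.
    triple-tends : Tends (binom (2 ℕ.+ d)) f′ (+ 3 * a) → Tends (binom d) f a
    triple-tends (up , down) = tends-untotal d f-mono (tends-untotal (suc d) total-mono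
      (below-third {f = U} {a} (below-≤ 3U≤f′ (below-suc (2 ℕ.+ d) (below-suc (2 ℕ.+ d) up))) ,
       below-third {f = -_ ∘ U} { - a} (triple-neg {g = U} (below-≤ (λ t → neg-mono-≤ (f′≤3U t)) down))))
      where
      f-mono : ∀ t → f t ≤ f (suc t)
      f-mono t = scale b (+≤+ (mono t))
      total-mono : ∀ t → total f t ≤ total f (suc t)
      total-mono t = subst (_≤ f (suc t) + total f t) (+-identityˡ (total f t))
        (+-monoˡ-≤ (total f t) (subst (0ℤ ≤_) (pos-* b (c (suc t))) (+≤+ ℕ.z≤n)))

-- The volumes of G and G △ e

module Tripled where

  open import Data.Nat.Base as ℕ using (ℕ; suc)
  import Data.Nat.Properties as ℕ
  open import Data.Integer.Base as ℤ using (ℤ; +_)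
  open import Data.Rational.Base using (ℚ; _*_; ↥_)
  import Data.Rational.Properties as ℚ
  open import Data.Bool.Base using (true)
  open import Data.Fin.Base using (Fin)
  open import Data.Product.Base using (_,_)
  open import Data.Sum.Base using (_⊎_)
  open import Function.Bundles using (_⇔_; mk⇔)
  open import Relation.Binary.PropositionalEquality
  open Binomials
  open Asymptotics
  open Rationals
  open Volumes
  open Dimension
  open Triangle
  open Tripling
  open import Defs hiding (sym)

  module _ {N} (G : SimpleGraph (suc N)) (u v w : Fin (suc N)) (conn : Connected G)
           (uv : adj G u v ≡ true) (uw : adj G u w ≡ true) (v≢w : v ≢ w)
           (only : ∀ {x} → adj G u x ≡ true → x ≡ v ⊎ x ≡ w) (k : ℚ) where

    private
      module C = CountSandwich G u v w uv uw v≢w only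

      G′ = G △ (u , v)
      -- With k = a/b the counts are multiplied by b and compared with a, so that all limits are
      -- limits of integer sequences to an integer.
      b-1 = ℚ.denominator-1 k
      a = ↥ k
      d = N ℕ.+ N

      conn′ : Connected G′
      conn′ = triangle-connected G u v conn

      dim≡ : suc N ℕ.+ suc N ≡ 2 ℕ.+ d
      dim≡ = cong suc (ℕ.+-suc N N)

      k≡ : k * ℕ→ℚ (suc b-1) ≡ ℤ→ℚ a
      k≡ = *-denominator k

      3k≡ : ℕ→ℚ 3 * k * ℕ→ℚ (suc b-1) ≡ ℤ→ℚ (+ 3 ℤ.* a)
      3k≡ = trans (ℚ.*-assoc (ℕ→ℚ 3) k (ℕ→ℚ (suc b-1))) (trans (cong (ℕ→ℚ 3 *_) k≡) (sym (ℤ→ℚ-* (+ 3) a)))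

    nvol-triple : NVolIs G k → NVolIs G′ (ℕ→ℚ 3 * k)
    nvol-triple (d₀ , dim , lim) = 2 ℕ.+ d , subst (Dim G′) dim≡ (dim-connected G′ conn′) ,
      tends⇒limit G′ (2 ℕ.+ d) b-1 (ℕ→ℚ 3 * k) (+ 3 ℤ.* a) 3k≡
        (tends-triple C.count-mono C.triangle-upper C.triangle-lower (suc b-1) d a
          (limit⇒tends G d b-1 k a k≡ (subst (λ d → Limit G d k) (dim-unique G conn dim) lim)))

    triple-nvol : NVolIs G′ (ℕ→ℚ 3 * k) → NVolIs G k
    triple-nvol (d₀ , dim , lim) = d , dim-connected G conn ,
      tends⇒limit G d b-1 k a k≡
        (triple-tends C.count-mono C.triangle-upper C.triangle-lower (suc b-1) d a
          (limit⇒tends G′ (2 ℕ.+ d) b-1 (ℕ→ℚ 3 * k) (+ 3 ℤ.* a) 3k≡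
            (subst (λ d → Limit G′ d (ℕ→ℚ 3 * k)) (trans (dim-unique G′ conn′ dim) dim≡) lim)))

open import Defs
open import Data.Nat using (ℕ; suc)
open import Data.Fin using (Fin)
open import Data.Bool using (true)
open import Data.Product using (_,_)
open import Data.Rational using (ℚ; _*_)
open import Relation.Binary.PropositionalEquality using (_≡_)
open import Function.Bundles using (_⇔_; mk⇔)
open Triangle using (other-neighbour)
open Tripled using (nvol-triple; triple-nvol)

theorem3p18 : (N : ℕ) (G : SimpleGraph N) (u v : Fin N) →
    Connected G → adj G u v ≡ true → degree G u ≡ 2 →
    (k : ℚ) → NVolIs G k ⇔ NVolIs (G △ (u , v)) (ℕ→ℚ 3 * k)
theorem3p18 (suc N) G u v conn uv deg k with other-neighbour G uv deg
... | w , uw , v≢w , only =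
  mk⇔ (nvol-triple G u v w conn uv uw v≢w only k) (triple-nvol G u v w conn uv uw v≢w only k)
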